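{- Let $p_1,p_2\in\mathbb{R}[x]$ be nonzero polynomials. If $\mathscr{W}(p_1)\in \mathrm{ULC}(\deg p_1)$ and $\mathscr{W}(p_2)\in \mathrm{ULC}(\deg p_2)$, then $\mathscr{W}(p_1p_2)\in \mathrm{ULC}(\deg p_1+\deg p_2)$.
   Context: For a polynomial $p\in\mathbb{R}[x]$ of degree $d$, $\mathscr{W}(p)\in\mathbb{R}[x]$ denotes the polynomial (of degree at most $d$) defined by $\sum_{j\ge 0} p(j)x^j = \mathscr{W}(p)(x)/(1-x)^{d+1}$; equivalently, $\mathscr{W}(p)=\sum_{i=0}^d h_ix^i$ where $p(x)=\sum_{i=0}^d h_i\binom{x+d-i}{d}$. For an integer $m$, $\mathrm{ULC}(m)$ denotes the set of polynomials $a(x)=\sum_{j=0}^{e} a_jx^j$ with nonnegative coefficients, $e\le m$, such that the sequence $\big(a_j/\binom{m}{j}\big)_{j=0}^{e}$ is log-concave (i.e. $c_j^2\ge c_{j-1}c_{j+1}$ for all interior $j$) and $a$ has no internal zeros (there are no indices $i<j<k$ with $a_j=0$ and $a_ia_k\neq 0$). -}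

module Defs where

open import Level using (0ℓ)
open import Data.Nat as ℕ using (ℕ; zero; suc; _∸_)
open import Data.Nat.Combinatorics using (_C_)
open import Data.Product using (Σ; ∃; _×_; _,_)
open import Relation.Nullary using (¬_)
open import Relation.Binary.PropositionalEquality using (_≡_; _≢_)
open import Relation.Binary.Structures using (IsTotalOrder)
open import Algebra.Structures using (IsCommutativeRing)

record RealField : Set₁ where
  infixl 6 _+_
  infixl 7 _*_
  infix  8 -_
  infix  9 _⁻¹
  infix  4 _≤_
  field
    Carrier : Set
    _+_ _*_ : Carrier → Carrier → Carrier
    -_ _⁻¹  : Carrier → Carrier
    0# 1#   : Carrier
    _≤_     : Carrier → Carrier → Set
    isCommutativeRing : IsCommutativeRing _≡_ _+_ _*_ -_ 0# 1#
    0≢1        : 0# ≢ 1#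
    ⁻¹-inverse : ∀ x → x ≢ 0# → x * x ⁻¹ ≡ 1#
    0⁻¹≡0      : 0# ⁻¹ ≡ 0#
    ≤-isTotalOrder : IsTotalOrder _≡_ _≤_
    +-monoˡ-≤  : ∀ x y z → x ≤ y → x + z ≤ y + z
    *-nonneg   : ∀ x y → 0# ≤ x → 0# ≤ y → 0# ≤ x * y
    complete : (P : Carrier → Set) → ∃ P → (∃ λ b → ∀ x → P x → x ≤ b) →
               ∃ λ s → (∀ x → P x → x ≤ s) ×
                       (∀ b → (∀ x → P x → x ≤ b) → s ≤ b)

module _ (R : RealField) where
  open RealField R

  fromℕ : ℕ → Carrier
  fromℕ zero    = 0#
  fromℕ (suc n) = 1# + fromℕ n

  infixr 8 _^_
  _^_ : Carrier → ℕ → Carrier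
  x ^ zero  = 1#
  x ^ suc n = x * (x ^ n)

  sumTo : ℕ → (ℕ → Carrier) → Carrier
  sumTo zero    f = 0#
  sumTo (suc n) f = sumTo n f + f n

  -- A polynomial is represented by its coefficient sequence ℕ → ℝ
  -- (coefficient of x^i at index i).  `HasDegree p d` : p is a nonzero
  -- polynomial of degree exactly d.
  HasDegree : (ℕ → Carrier) → ℕ → Set
  HasDegree p d = (p d ≢ 0#) × (∀ i → d ℕ.< i → p i ≡ 0#)

  eval : ℕ → (ℕ → Carrier) → Carrier → Carrier
  eval d p x = sumTo (suc d) (λ i → p i * x ^ i)

  polyMul : (ℕ → Carrier) → (ℕ → Carrier) → (ℕ → Carrier)
  polyMul p q k = sumTo (suc k) (λ i → p i * q (k ∸ i))

  -- 𝒲(p) for p of degree d: the polynomial with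
  --   Σ_{j≥0} p(j) x^j = 𝒲(p)(x) / (1-x)^{d+1},
  -- i.e. the coefficients of (1-x)^{d+1} · Σ_j p(j) x^j, which vanish above
  -- degree d; coefficient i (0 ≤ i ≤ d) is Σ_{k≤i} (-1)^k C(d+1,k) p(i-k).
  W : ℕ → (ℕ → Carrier) → (ℕ → Carrier)
  W d p i with i ℕ.≤? d
  ... | Relation.Nullary.yes _ =
        sumTo (suc i) (λ k → ((- 1#) ^ k) * fromℕ ((suc d) C k) * eval d p (fromℕ (i ∸ k)))
  ... | Relation.Nullary.no _ = 0#

  ULC : ℕ → (ℕ → Carrier) → Set
  ULC m a =
    (∀ j → 0# ≤ a j) ×
    (∀ j → m ℕ.< j → a j ≡ 0#) ×
    (∀ j → 1 ℕ.≤ j → suc j ℕ.≤ m → c (j ∸ 1) * c (suc j) ≤ c j * c j) ×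
    ¬ (Σ ℕ λ i → Σ ℕ λ j → Σ ℕ λ k →
         i ℕ.< j × j ℕ.< k × a j ≡ 0# × a i * a k ≢ 0#)
    where
    c : ℕ → Carrier
    c j = a j * fromℕ (m C j) ⁻¹

{-# OPTIONS --safe #-}
module Submission where

-- Write 𝒲(p₁) = Σ C(d,i) αᵢ xⁱ and 𝒲(p₂) = Σ C(e,j) βⱼ xʲ with homogenisations
-- H(x,y) and G(x,y), and let D = ∂x + ∂y.  The homogenisation of 𝒲(p₁p₂) is
-- f(x,y,x,y), where
--   f(x₁,y₁,x₂,y₂) = Σₙ (x₂y₂)ⁿ/n!² · DⁿH(x₁,y₁) · DⁿG(x₂,y₂).
-- Ultra log-concavity of 𝒲(p₁p₂) says that the second derivatives of
-- (∂x₁+∂x₂)ᵃ(∂y₁+∂y₂)ᵇ f in the directions x₁+x₂ and y₁+y₂ satisfy the reversed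
-- Cauchy-Schwarz inequality, so it is enough that the 4×4 Hessians of these
-- derivatives are Lorentzian (at most one positive eigenvalue).
--
-- The Hessian of (∂₁+∂₂)g is the sum of those of ∂₁g and ∂₂g; the column of the
-- first in direction 2 is the column of the second in direction 1, so both
-- forms are negative semidefinite on the orthogonal complement of one common
-- vector, and the sum is Lorentzian again.  It remains to treat the Hessians of
-- the monomial derivatives of f.  There completing the square in H leaves a
-- ternary form whose entries are binomial multiples of entries of (1+E)ⁿβ,
-- E the shift; it is Lorentzian because (1+E)ⁿβ is log-concave, but by
-- pascal-newton not too log-concave.
--
-- All this is done for positive α and β; the general case is a limit.

open import Defs
open import Level using (0ℓ)
open import Data.Nat as ℕ using (ℕ; zero; suc; z≤n; s≤s)
import Data.Nat.Properties as ℕₚ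
open ℕₚ using
  (+-cancelʳ-<; +-cancelʳ-≡; +-cancelˡ-<; +-cancelˡ-≡; +-monoʳ-<; +-monoʳ-≤
  ; +-monoˡ-<; +-suc; <-cmp; <-≤-connex; <-≤-trans; <⇒≤
  ; <⇒≱; m+[n∸m]≡n; m+n∸n≡m; m+n≡0⇒m≡0; m+n≡0⇒n≡0; m+n≤o⇒m≤o∸n
  ; m<m+n; m<n+m; m<n⇒0<n∸m; m∸n+n≡m; m≤m+n; m≤n+m
  ; m≤n+o⇒m∸n≤o; m≤n⇒m<n∨m≡n; m≤n⇒m≤1+n; n<1+n; n≤1+n; suc-injective
  ; ≤-<-trans; ≮⇒≥; ≰⇒>)
open import Data.Nat.Combinatorics using (_C_; nCk+nC[k+1]≡[n+1]C[k+1]; nCn≡1; nC1≡n; k>n⇒nCk≡0)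
import Data.Nat.Solver
open import Data.Integer as ℤ using (ℤ; -[1+_]; _⊖_)
import Data.Integer.Properties as ℤₚ
open import Data.Maybe using (map)
open import Data.Product using (Σ; ∃; _×_; _,_; proj₁; proj₂)
open import Data.Sum using (_⊎_; inj₁; inj₂)
open import Data.Empty using (⊥; ⊥-elim)
open import Relation.Nullary using (Dec; yes; no)
open import Relation.Nullary.Decidable using (dec⇒maybe)
open import Relation.Binary.Definitions using (tri<; tri≈; tri>)
open import Relation.Binary.PropositionalEquality using (_≡_; _≢_; refl; sym; trans; cong; cong₂; subst; subst₂; module ≡-Reasoning)
open import Relation.Binary.Structures using (IsTotalOrder)
open import Algebra.Bundles using (CommutativeRing)
import Algebra.Properties.Ring as RingProperties
open import Algebra.Solver.Ring.AlmostCommutativeRing using (fromCommutativeRing; _-Raw-AlmostCommutative⟶_)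
import Algebra.Solver.Ring

module NS = Data.Nat.Solver.+-*-Solver

-- By Taylor's formula along D, f is the part of degree d + e of H(x₁ + 1, y₁ + 1) G(x₂ + x₂y₂, y₂ +
-- x₂y₂). For H = x^i₀ y^i₁ and G = x^j₀ y^j₁, setting x₁ = x₂ = x and y₁ = y₂ = y turns this
-- product into x^j₀ (1 + x)^(i₀ + j₁) times y^j₁ (1 + y)^(i₁ + j₀). Its coefficients are products
-- of two binomials, and so are those of 𝒲 of a product of two basis polynomials C(x + i₁, i₀ + i₁)
-- and C(x + j₁, j₀ + j₁). That the two agree identifies f(x,y,x,y) with 𝒲(p₁p₂). The sum of two
-- Lorentzian forms is under control only if the shared column is nonzero. Positive coefficients
-- ensure this except where one of the two Hessians vanishes altogether. This is why α is made
-- positive on all of ℕ, not only up to d: the coefficients of f then have no edge in the direction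
-- of x₁, and only the exponents of x₂ and y₂ have a support to be followed. The upper bound on
-- log-concavity enters at one point: the mixed entry of the reduced form must be nonnegative before
-- its upper bound can be squared.

module Development (R : RealField) where

  open RealField R

  -- A ring solver with integer coefficients

  commutativeRing : CommutativeRing 0ℓ 0ℓ
  commutativeRing = record { isCommutativeRing = isCommutativeRing }

  open CommutativeRing commutativeRing using (ring; +-comm; +-assoc; +-identityˡ; +-identityʳ; *-comm; *-assoc; *-identityˡ; *-identityʳ; distribˡ; distribʳ; -‿inverseʳ; zeroˡ; zeroʳ)
  open RingProperties ring using (-‿involutive; -0#≈0#; -‿distribˡ-*; -‿distribʳ-*; -‿+-comm)
  open IsTotalOrder ≤-isTotalOrder using (total) renaming (refl to ≤-refl; trans to ≤-trans; antisym to ≤-antisym; reflexive to ≤-reflexive)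

  infixr 5 _·_
  _·_ : ∀ {A : Set} {x y z : A} → x ≡ y → y ≡ z → x ≡ z
  _·_ = trans

  ι : ℕ → Carrier
  ι = fromℕ R

  ι-+ : ∀ m n → ι (m ℕ.+ n) ≡ ι m + ι n
  ι-+ zero    n = sym (+-identityˡ _)
  ι-+ (suc m) n = trans (cong (1# +_) (ι-+ m n)) (sym (+-assoc _ _ _))

  ι-* : ∀ m n → ι (m ℕ.* n) ≡ ι m * ι n
  ι-* zero    n = sym (zeroˡ _)
  ι-* (suc m) n = begin
    ι (n ℕ.+ m ℕ.* n)       ≡⟨ ι-+ n (m ℕ.* n) ⟩
    ι n + ι (m ℕ.* n)       ≡⟨ cong₂ _+_ (sym (*-identityˡ _)) (ι-* m n) ⟩
    1# * ι n + ι m * ι n    ≡⟨ sym (distribʳ _ _ _) ⟩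
    (1# + ι m) * ι n        ∎
    where open ≡-Reasoning

  ι-1 : ι 1 ≡ 1#
  ι-1 = +-identityʳ 1#

  private
    ⟦_⟧ᶻ : ℤ → Carrier
    ⟦ ℤ.+ n ⟧ᶻ    = ι n
    ⟦ -[1+ n ] ⟧ᶻ = - ι (suc n)

    cancel-suc : ∀ x y → x + - y ≡ (1# + x) + - (1# + y)
    cancel-suc x y = sym (begin
      (1# + x) + - (1# + y)      ≡⟨ cong₂ _+_ (+-comm 1# x) (sym (-‿+-comm 1# y)) ⟩
      (x + 1#) + (- 1# + - y)    ≡⟨ +-assoc x 1# _ ⟩
      x + (1# + (- 1# + - y))    ≡⟨ cong (x +_) (sym (+-assoc 1# (- 1#) (- y))) ⟩
      x + ((1# + - 1#) + - y)    ≡⟨ cong (λ z → x + (z + - y)) (-‿inverseʳ 1#) ⟩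
      x + (0# + - y)             ≡⟨ cong (x +_) (+-identityˡ _) ⟩
      x + - y                    ∎)
      where open ≡-Reasoning

    ⊖-homo : ∀ m n → ⟦ m ⊖ n ⟧ᶻ ≡ ι m + - ι n
    ⊖-homo m zero = sym (trans (cong (ι m +_) -0#≈0#) (+-identityʳ _))
    ⊖-homo zero (suc n) = sym (+-identityˡ _)
    ⊖-homo (suc m) (suc n) =
      trans (cong ⟦_⟧ᶻ (ℤₚ.[1+m]⊖[1+n]≡m⊖n m n)) (trans (⊖-homo m n) (cancel-suc (ι m) (ι n)))

    +-homo : ∀ x y → ⟦ x ℤ.+ y ⟧ᶻ ≡ ⟦ x ⟧ᶻ + ⟦ y ⟧ᶻ
    +-homo (ℤ.+ m) (ℤ.+ n) = ι-+ m n
    +-homo (ℤ.+ m) -[1+ n ] = ⊖-homo m (suc n)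
    +-homo -[1+ m ] (ℤ.+ n) = trans (⊖-homo n (suc m)) (+-comm _ _)
    +-homo -[1+ m ] -[1+ n ] = begin
      - ι (suc (suc (m ℕ.+ n)))   ≡⟨ cong (λ k → - ι k) (sym (+-suc (suc m) n)) ⟩
      - ι (suc m ℕ.+ suc n)       ≡⟨ cong -_ (ι-+ (suc m) (suc n)) ⟩
      - (ι (suc m) + ι (suc n))   ≡⟨ sym (-‿+-comm _ _) ⟩
      - ι (suc m) + - ι (suc n)   ∎
      where open ≡-Reasoning

    -‿homo : ∀ x → ⟦ ℤ.- x ⟧ᶻ ≡ - ⟦ x ⟧ᶻ
    -‿homo (ℤ.+ zero)  = sym -0#≈0#
    -‿homo (ℤ.+ suc n) = refl
    -‿homo -[1+ n ]    = sym (-‿involutive _)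

    pos-*-homo : ∀ m y → ⟦ ℤ.+ m ℤ.* y ⟧ᶻ ≡ ι m * ⟦ y ⟧ᶻ
    pos-*-homo m (ℤ.+ n) = trans (cong ⟦_⟧ᶻ (sym (ℤₚ.pos-* m n))) (ι-* m n)
    pos-*-homo m -[1+ n ] = begin
      ⟦ ℤ.+ m ℤ.* ℤ.- (ℤ.+ suc n) ⟧ᶻ  ≡⟨ cong ⟦_⟧ᶻ (sym (ℤₚ.neg-distribʳ-* (ℤ.+ m) (ℤ.+ suc n))) ⟩
      ⟦ ℤ.- (ℤ.+ m ℤ.* ℤ.+ suc n) ⟧ᶻ  ≡⟨ -‿homo (ℤ.+ m ℤ.* ℤ.+ suc n) ⟩
      - ⟦ ℤ.+ m ℤ.* ℤ.+ suc n ⟧ᶻ      ≡⟨ cong -_ (pos-*-homo m (ℤ.+ suc n)) ⟩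
      - (ι m * ι (suc n))             ≡⟨ -‿distribʳ-* _ _ ⟩
      ι m * - ι (suc n)               ∎
      where open ≡-Reasoning

    *-homo : ∀ x y → ⟦ x ℤ.* y ⟧ᶻ ≡ ⟦ x ⟧ᶻ * ⟦ y ⟧ᶻ
    *-homo (ℤ.+ m) y = pos-*-homo m y
    *-homo -[1+ m ] y = begin
      ⟦ ℤ.- (ℤ.+ suc m) ℤ.* y ⟧ᶻ      ≡⟨ cong ⟦_⟧ᶻ (sym (ℤₚ.neg-distribˡ-* (ℤ.+ suc m) y)) ⟩
      ⟦ ℤ.- (ℤ.+ suc m ℤ.* y) ⟧ᶻ      ≡⟨ -‿homo (ℤ.+ suc m ℤ.* y) ⟩
      - ⟦ ℤ.+ suc m ℤ.* y ⟧ᶻ          ≡⟨ cong -_ (pos-*-homo (suc m) y) ⟩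
      - (ι (suc m) * ⟦ y ⟧ᶻ)          ≡⟨ -‿distribˡ-* _ _ ⟩
      - ι (suc m) * ⟦ y ⟧ᶻ            ∎
      where open ≡-Reasoning

    -- Sends 1 to 1# itself rather than to 1# + 0#, so that the solver
    -- recognises the literal 1#.
    literal : ℕ → Carrier
    literal zero          = 0#
    literal (suc zero)    = 1#
    literal (suc (suc n)) = 1# + literal (suc n)

    literal≡ι : ∀ n → literal n ≡ ι n
    literal≡ι zero          = refl
    literal≡ι (suc zero)    = sym ι-1
    literal≡ι (suc (suc n)) = cong (1# +_) (literal≡ι (suc n))

    ⟦_⟧ : ℤ → Carrier
    ⟦ ℤ.+ n ⟧    = literal n
    ⟦ -[1+ n ] ⟧ = - literal (suc n)

    ⟦⟧≡ : ∀ x → ⟦ x ⟧ ≡ ⟦ x ⟧ᶻ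
    ⟦⟧≡ (ℤ.+ n)  = literal≡ι n
    ⟦⟧≡ -[1+ n ] = cong -_ (literal≡ι (suc n))

    morphism : ℤ.+-*-rawRing -Raw-AlmostCommutative⟶ fromCommutativeRing commutativeRing
    morphism = record
      { ⟦_⟧    = ⟦_⟧
      ; +-homo = λ x y → trans (⟦⟧≡ (x ℤ.+ y)) (trans (+-homo x y) (sym (cong₂ _+_ (⟦⟧≡ x) (⟦⟧≡ y))))
      ; *-homo = λ x y → trans (⟦⟧≡ (x ℤ.* y)) (trans (*-homo x y) (sym (cong₂ _*_ (⟦⟧≡ x) (⟦⟧≡ y))))
      ; -‿homo = λ x → trans (⟦⟧≡ (ℤ.- x)) (trans (-‿homo x) (cong -_ (sym (⟦⟧≡ x))))
      ; 0-homo = refl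
      ; 1-homo = refl
      }

  open Algebra.Solver.Ring ℤ.+-*-rawRing (fromCommutativeRing commutativeRing) morphism
    (λ x y → map (cong ⟦_⟧) (dec⇒maybe (x ℤ.≟ y)))
    using (solve; _:=_; _:+_; _:*_; _:-_; :-_; con; Polynomial)

  #_ : ∀ {k} → ℕ → Polynomial k
  # n = con (ℤ.+ n)

  -- Equality is decidable because `total x y` and `total y x` pick
  -- different sides exactly when x ≢ y.
  infix 4 _≟_
  _≟_ : (x y : Carrier) → Dec (x ≡ y)
  x ≟ y with total x y in p | total y x in q
  ... | inj₁ x≤y | inj₁ y≤x = yes (≤-antisym x≤y y≤x)
  ... | inj₂ y≤x | inj₂ x≤y = yes (≤-antisym x≤y y≤x)
  ... | inj₁ x≤y | inj₂ _   = no λ { refl → clash (trans (sym p) q) }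
    where clash : ∀ {A B : Set} {a : A} {b : B} → inj₁ a ≡ inj₂ b → ⊥
          clash ()
  ... | inj₂ _   | inj₁ _   = no λ { refl → clash (trans (sym q) p) }
    where clash : ∀ {A B : Set} {a : A} {b : B} → inj₁ a ≡ inj₂ b → ⊥
          clash ()

  -- Ordered field arithmetic

  Pos : Carrier → Set
  Pos x = (0# ≤ x) × (x ≢ 0#)

  ≤⇒0≤ : ∀ {x y} → x ≤ y → 0# ≤ y + - x
  ≤⇒0≤ {x} {y} x≤y = subst (_≤ y + - x) (-‿inverseʳ x) (+-monoˡ-≤ x y (- x) x≤y)

  0≤⇒≤ : ∀ {x y} → 0# ≤ y + - x → x ≤ y
  0≤⇒≤ {x} {y} h = subst₂ _≤_ (+-identityˡ x)
    (solve 2 (λ x y → (y :- x) :+ x := y) refl x y) (+-monoˡ-≤ 0# (y + - x) x h)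

  +-mono : ∀ {w x y z} → w ≤ x → y ≤ z → w + y ≤ x + z
  +-mono {w} {x} {y} {z} p q = ≤-trans (+-monoˡ-≤ w x y p)
    (subst₂ _≤_ (+-comm y x) (+-comm z x) (+-monoˡ-≤ y z x q))

  0≤+ : ∀ {x y} → 0# ≤ x → 0# ≤ y → 0# ≤ x + y
  0≤+ {x} {y} p q = subst (_≤ x + y) (+-identityˡ 0#) (+-mono p q)

  0≤* : ∀ {x y} → 0# ≤ x → 0# ≤ y → 0# ≤ x * y
  0≤* = *-nonneg _ _

  by-diff : ∀ {x y z} → 0# ≤ z → z ≡ y + - x → x ≤ y
  by-diff h eq = 0≤⇒≤ (subst (0# ≤_) eq h)

  *-monoʳ : ∀ {x y z} → 0# ≤ z → x ≤ y → x * z ≤ y * z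
  *-monoʳ {x} {y} {z} 0≤z x≤y = by-diff (0≤* (≤⇒0≤ x≤y) 0≤z)
    (solve 3 (λ x y z → (y :- x) :* z := y :* z :- x :* z) refl x y z)

  *-monoˡ : ∀ {x y z} → 0# ≤ z → x ≤ y → z * x ≤ z * y
  *-monoˡ {x} {y} {z} 0≤z x≤y = subst₂ _≤_ (*-comm x z) (*-comm y z) (*-monoʳ 0≤z x≤y)

  *-mono : ∀ {w x y z} → 0# ≤ w → 0# ≤ z → w ≤ x → y ≤ z → w * y ≤ x * z
  *-mono 0≤w 0≤z p q = ≤-trans (*-monoˡ 0≤w q) (*-monoʳ 0≤z p)

  neg≤0 : ∀ {x} → 0# ≤ x → - x ≤ 0#
  neg≤0 {x} h = by-diff h (solve 1 (λ x → x := # 0 :- (:- x)) refl x)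

  ≤0⇒0≤neg : ∀ {x} → x ≤ 0# → 0# ≤ - x
  ≤0⇒0≤neg {x} h = subst (0# ≤_) (+-identityˡ _) (≤⇒0≤ h)

  sq≥0 : ∀ x → 0# ≤ x * x
  sq≥0 x with total 0# x
  ... | inj₁ p = 0≤* p p
  ... | inj₂ p = subst (0# ≤_) (solve 1 (λ x → (:- x) :* (:- x) := x :* x) refl x)
                   (0≤* (≤0⇒0≤neg p) (≤0⇒0≤neg p))

  0≤1 : 0# ≤ 1#
  0≤1 = subst (0# ≤_) (*-identityˡ 1#) (sq≥0 1#)

  1-pos : Pos 1#
  1-pos = 0≤1 , λ p → 0≢1 (sym p)

  0≤ι : ∀ n → 0# ≤ ι n
  0≤ι zero    = ≤-refl
  0≤ι (suc n) = 0≤+ 0≤1 (0≤ι n)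

  pos+ : ∀ {x y} → Pos x → 0# ≤ y → Pos (x + y)
  pos+ {x} {y} (0≤x , x≢0) 0≤y = 0≤+ 0≤x 0≤y ,
    λ s → x≢0 (≤-antisym (by-diff 0≤y (trans (solve 2 (λ x y → y := (x :+ y) :- x) refl x y) (cong (_+ - x) s))) 0≤x)

  +pos : ∀ {x y} → 0# ≤ x → Pos y → Pos (x + y)
  +pos {x} {y} 0≤x p = subst Pos (+-comm y x) (pos+ p 0≤x)

  ι-pos : ∀ n → Pos (ι (suc n))
  ι-pos n = pos+ 1-pos (0≤ι n)

  no-zero-divisors : ∀ {x y} → x * y ≡ 0# → x ≢ 0# → y ≡ 0#
  no-zero-divisors {x} {y} xy≡0 x≢0 = begin
    y                ≡⟨ sym (*-identityˡ y) ⟩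
    1# * y           ≡⟨ cong (_* y) (sym (⁻¹-inverse x x≢0)) ⟩
    (x * x ⁻¹) * y   ≡⟨ solve 3 (λ x i y → (x :* i) :* y := i :* (x :* y)) refl x (x ⁻¹) y ⟩
    x ⁻¹ * (x * y)   ≡⟨ cong (x ⁻¹ *_) xy≡0 ⟩
    x ⁻¹ * 0#        ≡⟨ zeroʳ _ ⟩
    0#               ∎
    where open ≡-Reasoning

  *-≢0 : ∀ {x y} → x ≢ 0# → y ≢ 0# → x * y ≢ 0#
  *-≢0 x≢0 y≢0 xy≡0 = y≢0 (no-zero-divisors xy≡0 x≢0)

  pos* : ∀ {x y} → Pos x → Pos y → Pos (x * y)
  pos* (p , p') (q , q') = 0≤* p q , *-≢0 p' q'

  cancel-0≤ : ∀ {x z} → Pos z → 0# ≤ z * x → 0# ≤ x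
  cancel-0≤ {x} {z} (0≤z , z≢0) h with total 0# x
  ... | inj₁ p = p
  ... | inj₂ p = ≤-reflexive (sym (no-zero-divisors (≤-antisym (subst (z * x ≤_) (zeroʳ z) (*-monoˡ 0≤z p)) h) z≢0))

  cancel-≤ˡ : ∀ {x y z} → Pos z → z * x ≤ z * y → x ≤ y
  cancel-≤ˡ {x} {y} {z} p h = 0≤⇒≤ (cancel-0≤ p
    (subst (0# ≤_) (solve 3 (λ x y z → z :* y :- z :* x := z :* (y :- x)) refl x y z) (≤⇒0≤ h)))

  cancel-≡ˡ : ∀ {x y z} → z ≢ 0# → z * x ≡ z * y → x ≡ y
  cancel-≡ˡ {x} {y} {z} z≢0 h = begin
    x               ≡⟨ solve 2 (λ x y → x := (x :- y) :+ y) refl x y ⟩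
    (x + - y) + y   ≡⟨ cong (_+ y) (no-zero-divisors
                         (trans (solve 3 (λ x y z → z :* (x :- y) := z :* x :- z :* y) refl x y z)
                         (trans (cong (_+ - (z * y)) h) (-‿inverseʳ _))) z≢0) ⟩
    0# + y          ≡⟨ +-identityˡ y ⟩
    y               ∎
    where open ≡-Reasoning

  inv-nonneg : ∀ {x} → 0# ≤ x → 0# ≤ x ⁻¹
  inv-nonneg {x} 0≤x with x ≟ 0#
  ... | yes refl = subst (0# ≤_) (sym 0⁻¹≡0) ≤-refl
  ... | no x≢0 = cancel-0≤ (0≤x , x≢0) (subst (0# ≤_) (sym (⁻¹-inverse x x≢0)) 0≤1)

  sq≡0 : ∀ {x} → x * x ≤ 0# → x ≡ 0#
  sq≡0 {x} h with x ≟ 0#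
  ... | yes p = p
  ... | no p = no-zero-divisors (≤-antisym h (sq≥0 x)) p

  ι-mono : ∀ {m n} → m ℕ.≤ n → ι m ≤ ι n
  ι-mono {n = n} ℕ.z≤n = 0≤ι n
  ι-mono (ℕ.s≤s m≤n) = +-mono ≤-refl (ι-mono m≤n)

  -- Log-concave sequences

  -- Log-concavity together with the absence of internal zeros: for i ≤ k,
  -- moving the outer indices i, t + k inwards to t + i, k increases the product.
  LC : (ℕ → Carrier) → Set
  LC x = ∀ t {i k} → i ℕ.≤ k → x i * x (t ℕ.+ k) ≤ x (t ℕ.+ i) * x k

  -- Each step moves both outer indices one place inwards; once i = k, the two products differ only
  -- in the order of their factors.
  adjacent⇒LC : ∀ {x} → (∀ {i k} → i ℕ.≤ k → x i * x (suc k) ≤ x (suc i) * x k) → LC x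
  adjacent⇒LC adj zero i≤k = ≤-refl
  adjacent⇒LC {x} adj (suc t) {i} {k} i≤k with m≤n⇒m<n∨m≡n i≤k
  ... | inj₂ refl = ≤-reflexive (*-comm _ _)
  ... | inj₁ i<k = ≤-trans (adj (ℕₚ.≤-trans i≤k (m≤n+m k t)))
    (subst (λ j → x (suc i) * x (t ℕ.+ k) ≤ x j * x k) (+-suc t i) (adjacent⇒LC adj t i<k))

  -- In the expansion by powers of ε, the coefficients of 1 and ε² are instances of log-concavity.
  -- That of ε is a sum of two instances, with the gap widened by one (`outer`) and narrowed by one
  -- (`inner`).
  LC-+shift : ∀ {x} ε → 0# ≤ ε → LC x → LC (λ i → x i + ε * x (suc i))
  LC-+shift {x} ε 0≤ε lc zero i≤k = ≤-refl
  LC-+shift {x} ε 0≤ε lc (suc t) {i} {k} i≤k =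
    by-diff (0≤+ (0≤+ (≤⇒0≤ (lc (suc t) i≤k)) (0≤* 0≤ε (0≤+ (≤⇒0≤ outer) (≤⇒0≤ inner))))
                 (0≤* (sq≥0 ε) (≤⇒0≤ both)))
      (solve 9 (λ ε a a′ b b′ c c′ d d′ →
          (c :* d :- a :* b) :+ ε :* ((c′ :* d :- a :* b′) :+ (c :* d′ :- a′ :* b)) :+ (ε :* ε) :* (c′ :* d′ :- a′ :* b′)
          := (c :+ ε :* c′) :* (d :+ ε :* d′) :- (a :+ ε :* a′) :* (b :+ ε :* b′))
        refl ε (x i) (x (suc i)) (x (suc (t ℕ.+ k))) (x (suc (suc (t ℕ.+ k))))
        (x (suc (t ℕ.+ i))) (x (suc (suc (t ℕ.+ i)))) (x k) (x (suc k)))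
    where
    outer : x i * x (suc (suc (t ℕ.+ k))) ≤ x (suc (suc (t ℕ.+ i))) * x k
    outer = lc (suc (suc t)) i≤k
    inner : x (suc i) * x (suc (t ℕ.+ k)) ≤ x (suc (t ℕ.+ i)) * x (suc k)
    inner = subst₂ (λ p q → x (suc i) * x p ≤ x q * x (suc k)) (+-suc t k) (+-suc t i) (lc t (s≤s i≤k))
    both : x (suc i) * x (suc (suc (t ℕ.+ k))) ≤ x (suc (suc (t ℕ.+ i))) * x (suc k)
    both = subst₂ (λ p q → x (suc i) * x p ≤ x q * x (suc k)) (cong suc (+-suc t k)) (cong suc (+-suc t i)) (lc (suc t) (s≤s i≤k))

  LC-resp : ∀ {x y} → (∀ i → x i ≡ y i) → LC x → LC y
  LC-resp {x} {y} e lc t {i} {k} i≤k = subst₂ _≤_ (cong₂ _*_ (e _) (e _)) (cong₂ _*_ (e _) (e _)) (lc t i≤k)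

  -- (1 + E)ⁿ applied to a sequence, E being the left shift.
  pascal : ℕ → (ℕ → Carrier) → (ℕ → Carrier)
  pascal zero    x i = x i
  pascal (suc n) x i = pascal n x i + pascal n x (suc i)

  pascal-LC : ∀ n {x} → LC x → LC (pascal n x)
  pascal-LC zero    lc = lc
  pascal-LC (suc n) {x} lc = LC-resp (λ i → cong (pascal n x i +_) (*-identityˡ _)) (LC-+shift 1# 0≤1 (pascal-LC n lc))

  pascal-nonneg : ∀ n {x} → (∀ i → 0# ≤ x i) → ∀ i → 0# ≤ pascal n x i
  pascal-nonneg zero    h i = h i
  pascal-nonneg (suc n) h i = 0≤+ (pascal-nonneg n h i) (pascal-nonneg n h (suc i))

  pascal-pos : ∀ n {x} → (∀ i → Pos (x i)) → ∀ i → Pos (pascal n x i)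
  pascal-pos zero    h i = h i
  pascal-pos (suc n) h i = pos+ (pascal-pos n h i) (proj₁ (pascal-pos n h (suc i)))

  RatioIncreasing : (x y : ℕ → Carrier) → Set
  RatioIncreasing x y = ∀ {k l} → k ℕ.≤ l → x l * y k ≤ x k * y l

  -- A factor 1 + E turns the minor on columns k, l into the sum of those on (k, l), (k, l + 1), (k
  -- + 1, l) and (k + 1, l + 1). The third needs k < l, whence the separate case k = l.
  pascal-ratio : ∀ n {x y} → RatioIncreasing x y → RatioIncreasing (pascal n x) (pascal n y)
  pascal-ratio zero    h = h
  pascal-ratio (suc n) {x} {y} h {k} {l} k≤l with m≤n⇒m<n∨m≡n k≤l
  ... | inj₂ refl = ≤-refl
  ... | inj₁ k<l = by-diff
    (0≤+ (0≤+ (≤⇒0≤ (ih k≤l)) (≤⇒0≤ (ih (m≤n⇒m≤1+n k≤l)))) (0≤+ (≤⇒0≤ (ih (s≤s k≤l))) (≤⇒0≤ (ih k<l))))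
    (solve 8 (λ a a′ b b′ c c′ d d′ →
        ((a :* d :- b :* c) :+ (a :* d′ :- b′ :* c)) :+ ((a′ :* d′ :- b′ :* c′) :+ (a′ :* d :- b :* c′))
        := (a :+ a′) :* (d :+ d′) :- (b :+ b′) :* (c :+ c′))
      refl (p x k) (p x (suc k)) (p x l) (p x (suc l)) (p y k) (p y (suc k)) (p y l) (p y (suc l)))
    where p = pascal n
          ih = pascal-ratio n h

  -- The commutator of E with multiplication by the index is E, so that of (1 + E)ⁿ⁺¹ is (n + 1) E
  -- (1 + E)ⁿ.
  pascal-moment : ∀ n x l → pascal (suc n) (λ i → ι i * x i) l ≡ ι l * pascal (suc n) x l + ι (suc n) * pascal n x (suc l)
  pascal-moment zero x l = solve 4 (λ o l a b → l :* a :+ (o :+ l) :* b := l :* (a :+ b) :+ (o :+ # 0) :* b) refl 1# (ι l) (x l) (x (suc l))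
  pascal-moment (suc n) x l = begin
    pascal (suc n) (λ i → ι i * x i) l + pascal (suc n) (λ i → ι i * x i) (suc l)
      ≡⟨ cong₂ _+_ (pascal-moment n x l) (pascal-moment n x (suc l)) ⟩
    (ι l * (p0 + p1) + ι (suc n) * p1) + (ι (suc l) * (p1 + p2) + ι (suc n) * p2)
      ≡⟨ solve 6 (λ o l n a b c → (l :* (a :+ b) :+ n :* b) :+ ((o :+ l) :* (b :+ c) :+ n :* c)
                   := l :* ((a :+ b) :+ (b :+ c)) :+ (o :+ n) :* (b :+ c)) refl 1# (ι l) (ι (suc n)) p0 p1 p2 ⟩
    ι l * ((p0 + p1) + (p1 + p2)) + ι (suc (suc n)) * (p1 + p2) ∎
    where open ≡-Reasoning
          p0 = pascal n x l
          p1 = pascal n x (suc l)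
          p2 = pascal n x (suc (suc l))

  -- The quotient of l xₗ by xₗ increases, hence so does the quotient of
  -- their images under (1 + E)ⁿ⁺¹; pascal-moment turns this into a bound on
  -- how log-concave (1 + E)ⁿ x can be.
  pascal-newton : ∀ n {x} → (∀ i → 0# ≤ x i) → ∀ l → let h = pascal n x in
    ι (suc n) * (h (suc l) * h (suc l) + - (h l * h (suc (suc l)))) ≤ (h l + h (suc l)) * (h (suc l) + h (suc (suc l)))
  pascal-newton n {x} 0≤x l = by-diff (≤⇒0≤ ratio)
    (trans (cong₂ (λ u v → (h0 + h1) * u + - ((h1 + h2) * v)) (pascal-moment n x (suc l)) (pascal-moment n x l))
      (solve 6 (λ o l n a b c →
         (a :+ b) :* ((o :+ l) :* (b :+ c) :+ n :* c) :- (b :+ c) :* (l :* (a :+ b) :+ n :* b)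
         := (o :* (a :+ b)) :* (b :+ c) :- n :* (b :* b :- a :* c)) refl 1# (ι l) (ι (suc n)) h0 h1 h2
       · cong (λ u → u * (h1 + h2) + - (ι (suc n) * (h1 * h1 + - (h0 * h2)))) (*-identityˡ _)))
    where
    h0 = pascal n x l
    h1 = pascal n x (suc l)
    h2 = pascal n x (suc (suc l))
    start : RatioIncreasing x (λ i → ι i * x i)
    start {k} {l} k≤l = subst₂ _≤_
      (solve 3 (λ a b c → a :* (b :* c) := c :* (a :* b)) refl (ι k) (x k) (x l))
      (solve 3 (λ a b c → a :* (b :* c) := b :* (a :* c)) refl (ι l) (x k) (x l))
      (*-monoʳ (0≤* (0≤x k) (0≤x l)) (ι-mono k≤l))
    ratio = pascal-ratio (suc n) start (n≤1+n l)

  -- Convolution with the geometric sequence εⁱ.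
  geometric : Carrier → (ℕ → Carrier) → (ℕ → Carrier)
  geometric ε x zero    = x 0
  geometric ε x (suc i) = x (suc i) + ε * geometric ε x i

  module _ {ε : Carrier} (0≤ε : 0# ≤ ε) {x : ℕ → Carrier} (0≤x : ∀ i → 0# ≤ x i) where

    geometric-nonneg : ∀ i → 0# ≤ geometric ε x i
    geometric-nonneg zero    = 0≤x 0
    geometric-nonneg (suc i) = 0≤+ (0≤x (suc i)) (0≤* 0≤ε (geometric-nonneg i))

    geometric-≥ : ∀ i → x i ≤ geometric ε x i
    geometric-≥ zero    = ≤-refl
    geometric-≥ (suc i) = by-diff (0≤* 0≤ε (geometric-nonneg i)) (solve 2 (λ a b → b := (a :+ b) :- a) refl (x (suc i)) _)

    -- In the log-concavity of g = `geometric ε x` the products ε gᵢ gₖ cancel, and the case t = 1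
    -- of this inequality remains. The offset t is general because the recursion of g lowers i and k
    -- while the other index stays in place.
    geometric-ratio : LC x → ∀ t {i k} → i ℕ.≤ k → geometric ε x i * x (t ℕ.+ k) ≤ x (t ℕ.+ i) * geometric ε x k
    geometric-ratio lc t {zero} {k} z≤n = ≤-trans (lc t z≤n) (*-monoˡ (0≤x _) (geometric-≥ k))
    geometric-ratio lc t {suc i} {suc k} (s≤s i≤k) = subst₂ _≤_
      (solve 4 (λ ε a b c → a :* c :+ ε :* (b :* c) := (a :+ ε :* b) :* c) refl ε (x (suc i)) (geometric ε x i) (x (t ℕ.+ suc k)))
      (solve 4 (λ ε a b c → a :* b :+ ε :* (a :* c) := a :* (b :+ ε :* c)) refl ε (x (t ℕ.+ suc i)) (x (suc k)) (geometric ε x k))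
      (+-mono (lc t (s≤s i≤k)) (*-monoˡ 0≤ε
        (subst₂ (λ p q → geometric ε x i * x p ≤ x q * geometric ε x k) (sym (+-suc t k)) (sym (+-suc t i)) (geometric-ratio lc (suc t) i≤k))))

    geometric-LC : LC x → LC (geometric ε x)
    geometric-LC lc = adjacent⇒LC λ {i} {k} i≤k → by-diff (≤⇒0≤ (geometric-ratio lc 1 i≤k))
      (solve 5 (λ ε a b c d → c :* b :- a :* d := (c :+ ε :* a) :* b :- a :* (d :+ ε :* b)) refl
        ε (geometric ε x i) (geometric ε x k) (x (suc i)) (x (suc k)))

  geometric-pos : ∀ {ε x} → Pos ε → (∀ i → 0# ≤ x i) → Pos (x 0) → ∀ i → Pos (geometric ε x i)
  geometric-pos pε 0≤x p0 zero    = p0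
  geometric-pos pε 0≤x p0 (suc i) = +pos (0≤x (suc i)) (pos* pε (geometric-pos pε 0≤x p0 i))

  -- Lorentzian quadratic forms

  data Dir : Set where
    x₁ y₁ x₂ y₂ : Dir

  Vect Matr : Set
  Vect = Dir → Carrier
  Matr = Dir → Dir → Carrier

  dot : Vect → Vect → Carrier
  dot u v = (u x₁ * v x₁ + u y₁ * v y₁) + (u x₂ * v x₂ + u y₂ * v y₂)

  dot-comm : ∀ u v → dot u v ≡ dot v u
  dot-comm u v = cong₂ _+_ (cong₂ _+_ (*-comm _ _) (*-comm _ _)) (cong₂ _+_ (*-comm _ _) (*-comm _ _))

  dot-cong : ∀ u {v w} → (∀ p → v p ≡ w p) → dot u v ≡ dot u w
  dot-cong u h = cong₂ _+_ (cong₂ _+_ (cong (_ *_) (h x₁)) (cong (_ *_) (h y₁))) (cong₂ _+_ (cong (_ *_) (h x₂)) (cong (_ *_) (h y₂)))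

  dot-+ : ∀ u v w → dot u (λ p → v p + w p) ≡ dot u v + dot u w
  dot-+ u v w = solve 12 (λ a b c d e f g h i j k l →
      (a :* (e :+ i) :+ b :* (f :+ j)) :+ (c :* (g :+ k) :+ d :* (h :+ l))
      := ((a :* e :+ b :* f) :+ (c :* g :+ d :* h)) :+ ((a :* i :+ b :* j) :+ (c :* k :+ d :* l)))
    refl (u x₁) (u y₁) (u x₂) (u y₂) (v x₁) (v y₁) (v x₂) (v y₂) (w x₁) (w y₁) (w x₂) (w y₂)

  dot-* : ∀ u s v → dot u (λ p → s * v p) ≡ s * dot u v
  dot-* u s v = solve 9 (λ s a b c d e f g h →
      (a :* (s :* e) :+ b :* (s :* f)) :+ (c :* (s :* g) :+ d :* (s :* h))
      := s :* ((a :* e :+ b :* f) :+ (c :* g :+ d :* h)))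
    refl s (u x₁) (u y₁) (u x₂) (u y₂) (v x₁) (v y₁) (v x₂) (v y₂)

  infixl 6 _⊕_
  infixl 7 _⊙_
  _⊕_ : Vect → Vect → Vect
  (u ⊕ v) p = u p + v p
  _⊙_ : Carrier → Vect → Vect
  (s ⊙ v) p = s * v p

  dot-lin : ∀ u s v t w → dot u (s ⊙ v ⊕ t ⊙ w) ≡ s * dot u v + t * dot u w
  dot-lin u s v t w = trans (dot-+ u (s ⊙ v) (t ⊙ w)) (cong₂ _+_ (dot-* u s v) (dot-* u t w))

  basis : Dir → Vect
  basis x₁ x₁ = 1#
  basis y₁ y₁ = 1#
  basis x₂ x₂ = 1#
  basis y₂ y₂ = 1#
  basis _  _  = 0#

  dot-basis : ∀ v p → dot v (basis p) ≡ v p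
  dot-basis v x₁ = solve 5 (λ o a b c d → (a :* o :+ b :* # 0) :+ (c :* # 0 :+ d :* # 0) := a :* o) refl 1# (v x₁) (v y₁) (v x₂) (v y₂) · *-identityʳ _
  dot-basis v y₁ = solve 5 (λ o a b c d → (a :* # 0 :+ b :* o) :+ (c :* # 0 :+ d :* # 0) := b :* o) refl 1# (v x₁) (v y₁) (v x₂) (v y₂) · *-identityʳ _
  dot-basis v x₂ = solve 5 (λ o a b c d → (a :* # 0 :+ b :* # 0) :+ (c :* o :+ d :* # 0) := c :* o) refl 1# (v x₁) (v y₁) (v x₂) (v y₂) · *-identityʳ _
  dot-basis v y₂ = solve 5 (λ o a b c d → (a :* # 0 :+ b :* # 0) :+ (c :* # 0 :+ d :* o) := d :* o) refl 1# (v x₁) (v y₁) (v x₂) (v y₂) · *-identityʳ _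

  form : Matr → Vect → Vect → Carrier
  form M u v = dot u (λ p → dot v (M p))

  Symmetric : Matr → Set
  Symmetric M = ∀ p q → M p q ≡ M q p

  form-sym : ∀ {M} → Symmetric M → ∀ u v → form M u v ≡ form M v u
  form-sym {M} sM u v = begin
    dot u (λ p → dot v (M p))
      ≡⟨ trans (dot-+ u (λ p → f x₁ p + f y₁ p) (λ p → f x₂ p + f y₂ p)) (cong₂ _+_ (dot-+ u (f x₁) (f y₁)) (dot-+ u (f x₂) (f y₂))) ⟩
    (dot u (f x₁) + dot u (f y₁)) + (dot u (f x₂) + dot u (f y₂))
      ≡⟨ cong₂ _+_ (cong₂ _+_ (g x₁) (g y₁)) (cong₂ _+_ (g x₂) (g y₂)) ⟩
    dot v (λ p → dot u (M p)) ∎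
    where
    open ≡-Reasoning
    f : Dir → Vect
    f q p = v q * M p q
    g : ∀ q → dot u (f q) ≡ v q * dot u (M q)
    g q = trans (dot-* u (v q) (λ p → M p q)) (cong (v q *_) (dot-cong u (λ p → sM p q)))

  form-lin : ∀ M u s v t w → form M u (s ⊙ v ⊕ t ⊙ w) ≡ s * form M u v + t * form M u w
  form-lin M u s v t w = trans (dot-cong u (λ p → trans (dot-comm (s ⊙ v ⊕ t ⊙ w) (M p)) (trans (dot-lin (M p) s v t w)
      (cong₂ _+_ (cong (s *_) (dot-comm (M p) v)) (cong (t *_) (dot-comm (M p) w))))))
    (dot-lin u s (λ p → dot v (M p)) t (λ p → dot w (M p)))

  form-basis : ∀ M u q → form M u (basis q) ≡ dot u (λ p → M p q)
  form-basis M u q = dot-cong u (λ p → trans (dot-comm (basis q) (M p)) (dot-basis (M p) q))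

  form-+ : ∀ M N u v → form (λ p q → M p q + N p q) u v ≡ form M u v + form N u v
  form-+ M N u v = trans (dot-cong u (λ p → dot-+ v (M p) (N p))) (dot-+ u (λ p → dot v (M p)) (λ p → dot v (N p)))

  form-square : ∀ {M} → Symmetric M → ∀ s u t v →
    form M (s ⊙ u ⊕ t ⊙ v) (s ⊙ u ⊕ t ⊙ v) ≡ (s * s) * form M u u + (s * t + s * t) * form M u v + (t * t) * form M v v
  form-square {M} sM s u t v = begin
    form M z z                                ≡⟨ form-lin M z s u t v ⟩
    s * form M z u + t * form M z v           ≡⟨ cong₂ (λ a b → s * a + t * b) (form-sym sM z u) (form-sym sM z v) ⟩
    s * form M u z + t * form M v z           ≡⟨ cong₂ (λ a b → s * a + t * b) (form-lin M u s u t v) (form-lin M v s u t v) ⟩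
    s * (s * uu + t * uv) + t * (s * form M v u + t * vv) ≡⟨ cong (λ a → s * (s * uu + t * uv) + t * (s * a + t * vv)) (form-sym sM v u) ⟩
    s * (s * uu + t * uv) + t * (s * uv + t * vv)
      ≡⟨ solve 5 (λ s t a b c → s :* (s :* a :+ t :* b) :+ t :* (s :* b :+ t :* c) := (s :* s) :* a :+ (s :* t :+ s :* t) :* b :+ (t :* t) :* c) refl s t uu uv vv ⟩
    (s * s) * uu + (s * t + s * t) * uv + (t * t) * vv ∎
    where
    open ≡-Reasoning
    z = s ⊙ u ⊕ t ⊙ v
    uu = form M u u
    uv = form M u v
    vv = form M v v

  -- At most one positive eigenvalue.
  Lorentzian : Matr → Set
  Lorentzian M = Σ Vect λ ρ → ∀ z → dot ρ z ≡ 0# → form M z z ≤ 0#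

  module _ {M : Matr} (sM : Symmetric M) where

    private q = form M

    kernel-vector : ∀ ρ u v → dot ρ (dot ρ v ⊙ u ⊕ (- dot ρ u) ⊙ v) ≡ 0#
    kernel-vector ρ u v = trans (dot-lin ρ (dot ρ v) u (- dot ρ u) v) (solve 2 (λ a b → a :* b :+ (:- b) :* a := # 0) refl (dot ρ v) (dot ρ u))

    -- The combination ρ(v) u - ρ(u) v lies in the kernel of ρ, so the form is at most zero there;
    -- multiplied by q v v, this inequality can be completed to a square. Here ρ(v) is nonzero,
    -- since otherwise q v v would be at most zero.
    reverse-cauchy-schwarz : Lorentzian M → ∀ u v → Pos (q v v) → q u u * q v v ≤ q u v * q u v
    reverse-cauchy-schwarz (ρ , neg) u v (0≤vv , vv≢0) = 0≤⇒≤ (cancel-0≤ (sq≥0 t , *-≢0 t≢0 t≢0) (subst (0# ≤_)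
        (solve 5 (λ s t a b c →
            (c :* s :- b :* t) :* (c :* s :- b :* t) :- c :* ((t :* t) :* a :+ (t :* (:- s) :+ t :* (:- s)) :* b :+ ((:- s) :* (:- s)) :* c)
            := (t :* t) :* (b :* b :- a :* c)) refl s t (q u u) (q u v) (q v v))
        (0≤+ (sq≥0 (q v v * s + - (q u v * t))) (≤0⇒0≤neg (≤-trans (*-monoˡ 0≤vv qz≤0) (≤-reflexive (zeroʳ _)))))))
      where
      s = dot ρ u
      t = dot ρ v
      t≢0 : t ≢ 0#
      t≢0 t≡0 = vv≢0 (≤-antisym (neg v t≡0) 0≤vv)
      qz≤0 : (t * t) * q u u + (t * - s + t * - s) * q u v + (- s * - s) * q v v ≤ 0#
      qz≤0 = subst (_≤ 0#) (form-square sM t u (- s) v) (neg (t ⊙ u ⊕ (- s) ⊙ v) (kernel-vector ρ u v))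

    -- For q v v > 0 this is the reversed Cauchy-Schwarz inequality. An isotropic v outside the
    -- kernel of ρ serves to move a multiple of u into that kernel without changing the value of the
    -- form. An isotropic v inside the kernel is orthogonal to all of it; as w is not orthogonal to
    -- v, this forces u into the kernel.
    negative-on-orthogonal : Lorentzian M → ∀ v → 0# ≤ q v v → ∀ w → q w v ≢ 0# → ∀ u → q u v ≡ 0# → q u u ≤ 0#
    negative-on-orthogonal lor@(ρ , neg) v 0≤vv w wv≢0 u uv≡0 with q v v ≟ 0#
    ... | no vv≢0 = cancel-≤ˡ (0≤vv , vv≢0) (subst₂ _≤_ (*-comm _ _) (trans (cong (λ a → a * a) uv≡0) (trans (zeroˡ _) (sym (zeroʳ _))))
                      (reverse-cauchy-schwarz lor u v (0≤vv , vv≢0)))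
    ... | yes vv≡0 with dot ρ v ≟ 0#
    ...   | no t≢0 = cancel-≤ˡ (sq≥0 t , *-≢0 t≢0 t≢0) (subst₂ _≤_ eq (sym (zeroʳ _)) (neg (t ⊙ u ⊕ s ⊙ v) (kernel-vector ρ u v)))
      where
      t = dot ρ v
      s = - dot ρ u
      eq : q (t ⊙ u ⊕ s ⊙ v) (t ⊙ u ⊕ s ⊙ v) ≡ (t * t) * q u u
      eq = trans (form-square sM t u s v) (trans (cong₂ (λ b c → (t * t) * q u u + (t * s + t * s) * b + (s * s) * c) uv≡0 vv≡0)
             (solve 3 (λ t s a → (t :* t) :* a :+ (t :* s :+ t :* s) :* # 0 :+ (s :* s) :* # 0 := (t :* t) :* a) refl t s (q u u)))
    -- Here z + c v stays in the kernel of ρ for every c, so q z v = 0.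
    ...   | yes ρv≡0 = neg u (no-zero-divisors (trans (*-comm _ _) ρu*wv≡0) wv≢0)
      where
      a = dot ρ u
      z = a ⊙ w ⊕ (- dot ρ w) ⊙ u
      A = q z z
      B = q z v
      B≡ : B ≡ a * q w v
      B≡ = trans (form-sym sM z v) (trans (form-lin M v a w (- dot ρ w) u)
             (trans (cong₂ (λ x y → a * x + - dot ρ w * y) (form-sym sM v w) (trans (form-sym sM v u) uv≡0))
               (solve 3 (λ a b c → a :* b :+ (:- c) :* # 0 := a :* b) refl a (q w v) (dot ρ w))))
      line : ∀ c → A + (c + c) * B ≤ 0#
      line c = subst (_≤ 0#)
        (trans (form-square sM 1# z c v) (trans (cong (λ x → (1# * 1#) * A + (1# * c + 1# * c) * B + (c * c) * x) vv≡0)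
          (trans (cong₂ (λ x y → x * A + (y + y) * B + (c * c) * 0#) (*-identityˡ 1#) (*-identityˡ c))
            (trans (solve 4 (λ o A c B → o :* A :+ (c :+ c) :* B :+ (c :* c) :* # 0 := o :* A :+ (c :+ c) :* B) refl 1# A c B)
              (cong (_+ (c + c) * B) (*-identityˡ A))))))
        (neg (1# ⊙ z ⊕ c ⊙ v) (trans (dot-lin ρ 1# z c v) (trans (cong₂ (λ x y → 1# * x + c * y) (kernel-vector ρ w u) ρv≡0)
           (solve 2 (λ o c → o :* # 0 :+ c :* # 0 := # 0) refl 1# c))))
      ρu*wv≡0 : a * q w v ≡ 0#
      ρu*wv≡0 with B ≟ 0#
      ... | yes B≡0 = trans (sym B≡) B≡0
      ... | no B≢0 = ⊥-elim (proj₂ 1-pos (≤-antisym (subst (_≤ 0#) value (line c)) 0≤1))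
        where
        2B = B + B
        2B≢0 : 2B ≢ 0#
        2B≢0 h = *-≢0 {ι 2} (proj₂ (ι-pos 1)) B≢0 (trans (solve 1 (λ b → (# 1 :+ (# 1 :+ # 0)) :* b := b :+ b) refl B) h)
        -- The function A + 2cB of c, nonpositive by `line`, takes the value 1 at this point.
        c = (1# + - A) * 2B ⁻¹
        value : A + (c + c) * B ≡ 1#
        value = trans (solve 4 (λ o A i B → A :+ ((o :- A) :* i :+ (o :- A) :* i) :* B := A :+ (o :- A) :* ((B :+ B) :* i)) refl 1# A (2B ⁻¹) B)
          (trans (cong (λ x → A + (1# + - A) * x) (⁻¹-inverse 2B 2B≢0))
            (trans (cong (A +_) (*-identityʳ _)) (solve 2 (λ o A → A :+ (o :- A) := o) refl 1# A)))

  Lorentzian-resp : ∀ {M N} → (∀ p q → M p q ≡ N p q) → Lorentzian M → Lorentzian N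
  Lorentzian-resp {M} {N} h (ρ , neg) = ρ , λ z ρz → subst (_≤ 0#) (dot-cong z (λ p → dot-cong z (h p))) (neg z ρz)

  -- Two Lorentzian forms with a common nonzero column are negative
  -- semidefinite on the hyperplane orthogonal to that column.
  Lorentzian-+ : ∀ {M N} → Symmetric M → Symmetric N → ∀ v w → (∀ p → M p v ≡ N p w) →
    0# ≤ M v v → 0# ≤ N w w → (∃ λ p → M p v ≢ 0#) →
    Lorentzian M → Lorentzian N → Lorentzian (λ p q → M p q + N p q)
  Lorentzian-+ {M} {N} sM sN v w col 0≤Mvv 0≤Nww (r , r≢0) lM lN = (λ p → M p v) , λ z ρz →
    subst (_≤ 0#) (sym (form-+ M N z z)) (subst (form M z z + form N z z ≤_) (+-identityˡ 0#) (+-mono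
      (neg sM lM v 0≤Mvv r≢0 z (trans (dot-comm z (λ p → M p v)) ρz))
      (neg sN lN w 0≤Nww (λ h → r≢0 (trans (col r) h)) z (trans (dot-cong z (λ p → sym (col p))) (trans (dot-comm z (λ p → M p v)) ρz)))))
    where
    neg : ∀ {K} → Symmetric K → Lorentzian K → ∀ v → 0# ≤ K v v → K r v ≢ 0# → ∀ z → dot z (λ p → K p v) ≡ 0# → form K z z ≤ 0#
    neg {K} sK lK v 0≤Kvv Krv≢0 z h = negative-on-orthogonal sK lK (basis v)
      (subst (0# ≤_) (sym (entry v)) 0≤Kvv) (basis r) (λ e → Krv≢0 (trans (sym (entry r)) e)) z (trans (form-basis K z v) h)
      where
      entry : ∀ p → form K (basis p) (basis v) ≡ K p v
      entry p = trans (form-basis K (basis p) v) (trans (dot-comm (basis p) (λ p → K p v)) (dot-basis (λ p → K p v) p))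

  -- Binomial coefficients

  binom : ℕ → ℕ → Carrier
  binom n k = ι (n C k)

  binom-pascal : ∀ n k → binom (suc n) (suc k) ≡ binom n k + binom n (suc k)
  binom-pascal n k = trans (cong ι (sym (nCk+nC[k+1]≡[n+1]C[k+1] n k))) (ι-+ (n C k) (n C suc k))

  binom-0 : ∀ n → binom n 0 ≡ 1#
  binom-0 n = ι-1

  binom-> : ∀ {n k} → n ℕ.< k → binom n k ≡ 0#
  binom-> n<k = cong ι (k>n⇒nCk≡0 n<k)

  binom-nonneg : ∀ n k → 0# ≤ binom n k
  binom-nonneg n k = 0≤ι (n C k)

  binom-pos : ∀ {n k} → k ℕ.≤ n → Pos (binom n k)
  binom-pos {n}     {zero}  _         = subst Pos (sym (binom-0 n)) 1-pos
  binom-pos {suc n} {suc k} (s≤s k≤n) = subst Pos (sym (binom-pascal n k)) (pos+ (binom-pos k≤n) (binom-nonneg n (suc k)))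

  -- The two identities alternate: with Pascal's rule, this one in row n gives `binom-absorb` from
  -- row n to row n + 1, which in turn gives this one in row n + 1.
  binom-next : ∀ n k → ι (suc k) * binom n (suc k) + ι k * binom n k ≡ ι n * binom n k
  binom-absorb : ∀ n k → ι (suc k) * binom (suc n) (suc k) ≡ ι (suc n) * binom n k

  binom-next zero k = trans (cong₂ (λ a b → ι (suc k) * a + b) (binom-> {0} {suc k} (s≤s z≤n)) (vanish k))
                        (solve 2 (λ a b → a :* # 0 :+ # 0 := # 0 :* b) refl (ι (suc k)) (binom 0 k))
    where
    vanish : ∀ k → ι k * binom 0 k ≡ 0#
    vanish zero    = zeroˡ _
    vanish (suc k) = trans (cong (ι (suc k) *_) (binom-> {0} {suc k} (s≤s z≤n))) (zeroʳ _)
  binom-next (suc n) zero = begin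
    ι 1 * binom (suc n) 1 + 0# * binom (suc n) 0   ≡⟨ cong (_+ 0# * binom (suc n) 0) (binom-absorb n 0) ⟩
    ι (suc n) * binom n 0 + 0# * binom (suc n) 0   ≡⟨ solve 3 (λ n b c → n :* b :+ # 0 :* c := n :* b) refl (ι (suc n)) (binom n 0) (binom (suc n) 0) ⟩
    ι (suc n) * binom (suc n) 0                    ∎
    where open ≡-Reasoning
  binom-next (suc n) (suc k) = begin
    ι (suc (suc k)) * binom (suc n) (suc (suc k)) + ι (suc k) * binom (suc n) (suc k)
      ≡⟨ cong₂ _+_ (binom-absorb n (suc k)) (binom-absorb n k) ⟩
    ι (suc n) * binom n (suc k) + ι (suc n) * binom n k
      ≡⟨ solve 3 (λ a b c → a :* b :+ a :* c := a :* (c :+ b)) refl (ι (suc n)) (binom n (suc k)) (binom n k) ⟩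
    ι (suc n) * (binom n k + binom n (suc k))
      ≡⟨ cong (ι (suc n) *_) (sym (binom-pascal n k)) ⟩
    ι (suc n) * binom (suc n) (suc k) ∎
    where open ≡-Reasoning

  binom-absorb n k = begin
    (1# + ι k) * binom (suc n) (suc k)                          ≡⟨ cong ((1# + ι k) *_) (binom-pascal n k) ⟩
    (1# + ι k) * (binom n k + binom n (suc k))                  ≡⟨ solve 4 (λ o k b c → (o :+ k) :* (b :+ c) := o :* b :+ ((o :+ k) :* c :+ k :* b)) refl 1# (ι k) (binom n k) (binom n (suc k)) ⟩
    1# * binom n k + (ι (suc k) * binom n (suc k) + ι k * binom n k) ≡⟨ cong (1# * binom n k +_) (binom-next n k) ⟩
    1# * binom n k + ι n * binom n k                            ≡⟨ sym (distribʳ _ _ _) ⟩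
    (1# + ι n) * binom n k                                      ∎
    where open ≡-Reasoning

  binom-shift : ∀ p k → ι (suc k) * binom (p ℕ.+ k) (suc k) ≡ ι p * binom (p ℕ.+ k) k
  binom-shift p k = begin
    ι (suc k) * b′                         ≡⟨ solve 3 (λ a k b → a := (a :+ k :* b) :- k :* b) refl (ι (suc k) * b′) (ι k) b ⟩
    (ι (suc k) * b′ + ι k * b) + - (ι k * b) ≡⟨ cong (_+ - (ι k * b)) (trans (binom-next (p ℕ.+ k) k) (cong (_* b) (ι-+ p k))) ⟩
    (ι p + ι k) * b + - (ι k * b)          ≡⟨ solve 3 (λ p k b → (p :+ k) :* b :- k :* b := p :* b) refl (ι p) (ι k) b ⟩
    ι p * b                                ∎
    where
    open ≡-Reasoning
    b = binom (p ℕ.+ k) k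
    b′ = binom (p ℕ.+ k) (suc k)

  -- Lorentzian criteria for Hessians in block form

  psd : ∀ {p s r} → 0# ≤ p → 0# ≤ r → s * s ≤ p * r → ∀ x y → 0# ≤ (p * (x * x) + (s + s) * (x * y)) + r * (y * y)
  psd {p} {s} {r} 0≤p 0≤r ss≤pr x y with p ≟ 0#
  ... | no p≢0 = cancel-0≤ (0≤p , p≢0) (subst (0# ≤_)
        (solve 5 (λ p s r x y → (p :* x :+ s :* y) :* (p :* x :+ s :* y) :+ (p :* r :- s :* s) :* (y :* y)
                  := p :* ((p :* (x :* x) :+ (s :+ s) :* (x :* y)) :+ r :* (y :* y))) refl p s r x y)
        (0≤+ (sq≥0 _) (0≤* (≤⇒0≤ ss≤pr) (sq≥0 y))))
  ... | yes p≡0 = subst (0# ≤_) (sym (trans (cong₂ (λ p s → (p * (x * x) + (s + s) * (x * y)) + r * (y * y)) p≡0 s≡0)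
                    (solve 3 (λ r x y → (# 0 :* (x :* x) :+ (# 0 :+ # 0) :* (x :* y)) :+ r :* (y :* y) := r :* (y :* y)) refl r x y))) (0≤* 0≤r (sq≥0 y))
    where s≡0 : s ≡ 0#
          s≡0 = sq≡0 (subst (s * s ≤_) (trans (cong (_* r) p≡0) (zeroˡ r)) ss≤pr)

  -- The Hessian of H(x₁,y₁) K₀₀ + DH(x₁,y₁) (K₁₀ x₂ + K₀₁ y₂) + D²H K(x₂,y₂)
  -- where D = ∂x + ∂y, H has Hessian (hxx, hxy, hyy), gradient of DH is
  -- (hx, hy) and D²H = σ.
  block : (hxx hxy hyy hx hy σ K₀₀ K₁₀ K₀₁ K₂₀ K₁₁ K₀₂ : Carrier) → Matr
  block hxx hxy hyy hx hy σ K₀₀ K₁₀ K₀₁ K₂₀ K₁₁ K₀₂ = λ where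
    x₁ x₁ → hxx * K₀₀
    x₁ y₁ → hxy * K₀₀
    y₁ x₁ → hxy * K₀₀
    y₁ y₁ → hyy * K₀₀
    x₁ x₂ → hx * K₁₀
    x₂ x₁ → hx * K₁₀
    x₁ y₂ → hx * K₀₁
    y₂ x₁ → hx * K₀₁
    y₁ x₂ → hy * K₁₀
    x₂ y₁ → hy * K₁₀
    y₁ y₂ → hy * K₀₁
    y₂ y₁ → hy * K₀₁
    x₂ x₂ → σ * K₂₀
    x₂ y₂ → σ * K₁₁
    y₂ x₂ → σ * K₁₁
    y₂ y₂ → σ * K₀₂

  quad : (a b c x y : Carrier) → Carrier
  quad a b c x y = (a * (x * x) + (b + b) * (x * y)) + c * (y * y)

  form-block : ∀ hxx hxy hyy hx hy σ K₀₀ K₁₀ K₀₁ K₂₀ K₁₁ K₀₂ z →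
    form (block hxx hxy hyy hx hy σ K₀₀ K₁₀ K₀₁ K₂₀ K₁₁ K₀₂) z z ≡
    (K₀₀ * quad hxx hxy hyy (z x₁) (z y₁) + ((hx * z x₁ + hy * z y₁) + (hx * z x₁ + hy * z y₁)) * (K₁₀ * z x₂ + K₀₁ * z y₂))
    + σ * quad K₂₀ K₁₁ K₀₂ (z x₂) (z y₂)
  form-block hxx hxy hyy hx hy σ K₀₀ K₁₀ K₀₁ K₂₀ K₁₁ K₀₂ z =
    solve 16 (λ hxx hxy hyy hx hy σ K₀₀ K₁₀ K₀₁ K₂₀ K₁₁ K₀₂ a b c d →
      let row = λ m n o p → (a :* m :+ b :* n) :+ (c :* o :+ d :* p)
          Q = λ p q r x y → (p :* (x :* x) :+ (q :+ q) :* (x :* y)) :+ r :* (y :* y)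
          l = hx :* a :+ hy :* b in
      (a :* row (hxx :* K₀₀) (hxy :* K₀₀) (hx :* K₁₀) (hx :* K₀₁) :+ b :* row (hxy :* K₀₀) (hyy :* K₀₀) (hy :* K₁₀) (hy :* K₀₁))
      :+ (c :* row (hx :* K₁₀) (hy :* K₁₀) (σ :* K₂₀) (σ :* K₁₁) :+ d :* row (hx :* K₀₁) (hy :* K₀₁) (σ :* K₁₁) (σ :* K₀₂))
      := (K₀₀ :* Q hxx hxy hyy a b :+ (l :+ l) :* (K₁₀ :* c :+ K₀₁ :* d)) :+ σ :* Q K₂₀ K₁₁ K₀₂ c d)
    refl hxx hxy hyy hx hy σ K₀₀ K₁₀ K₀₁ K₂₀ K₁₁ K₀₂ (z x₁) (z y₁) (z x₂) (z y₂)

  -- Let l be the pairing of (x₁, y₁) with (1, 1) under the Hessian of H, let k = K₁₀ x₂ + K₀₁ y₂,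
  -- and let Q be the form with entries K₂₀, K₁₁, K₀₂. A Gram determinant shows that σ times the
  -- form of H is l² - (h₁² - h₀h₂)(x₁ - y₁)². Hence K₀₀ σ times the whole form is (K₀₀ l + σ k)²
  -- minus K₀₀² (h₁² - h₀h₂)(x₁ - y₁)² minus σ² (k² - K₀₀ Q). The vector ρ represents K₀₀ l + σ k.
  block-Lorentzian : ∀ {h₀ h₁ h₂ K₀₀ K₁₀ K₀₁ K₂₀ K₁₁ K₀₂} → let σ = (h₀ + h₁) + (h₁ + h₂) in
    Pos K₀₀ → Pos σ → h₀ * h₂ ≤ h₁ * h₁ →
    (∀ x y → 0# ≤ quad (K₁₀ * K₁₀ + - (K₀₀ * K₂₀)) (K₁₀ * K₀₁ + - (K₀₀ * K₁₁)) (K₀₁ * K₀₁ + - (K₀₀ * K₀₂)) x y) →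
    Lorentzian (block h₂ h₁ h₀ (h₁ + h₂) (h₀ + h₁) σ K₀₀ K₁₀ K₀₁ K₂₀ K₁₁ K₀₂)
  block-Lorentzian {h₀} {h₁} {h₂} {K₀₀} {K₁₀} {K₀₁} {K₂₀} {K₁₁} {K₀₂} pK pσ lc nonneg = ρ , negative
    where
    σ = (h₀ + h₁) + (h₁ + h₂)
    ρ : Vect
    ρ x₁ = K₀₀ * (h₁ + h₂)
    ρ y₁ = K₀₀ * (h₀ + h₁)
    ρ x₂ = σ * K₁₀
    ρ y₂ = σ * K₀₁
    M = block h₂ h₁ h₀ (h₁ + h₂) (h₀ + h₁) σ K₀₀ K₁₀ K₀₁ K₂₀ K₁₁ K₀₂
    negative : ∀ z → dot ρ z ≡ 0# → form M z z ≤ 0#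
    negative z ρz≡0 = cancel-≤ˡ (pos* pK pσ) (by-diff
      (0≤+ (0≤* (sq≥0 σ) (nonneg (z x₂) (z y₂))) (0≤* (sq≥0 K₀₀) (0≤* (≤⇒0≤ lc) (sq≥0 (z x₁ + - z y₁)))))
      (trans (solve 13 (λ h₀ h₁ h₂ K₀₀ K₁₀ K₀₁ K₂₀ K₁₁ K₀₂ a b c d →
          let σ = (h₀ :+ h₁) :+ (h₁ :+ h₂)
              Q = λ p q r x y → (p :* (x :* x) :+ (q :+ q) :* (x :* y)) :+ r :* (y :* y)
              l = (h₁ :+ h₂) :* a :+ (h₀ :+ h₁) :* b
              ρz = (K₀₀ :* (h₁ :+ h₂) :* a :+ K₀₀ :* (h₀ :+ h₁) :* b) :+ (σ :* K₁₀ :* c :+ σ :* K₀₁ :* d) in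
          (σ :* σ) :* Q (K₁₀ :* K₁₀ :- K₀₀ :* K₂₀) (K₁₀ :* K₀₁ :- K₀₀ :* K₁₁) (K₀₁ :* K₀₁ :- K₀₀ :* K₀₂) c d
            :+ (K₀₀ :* K₀₀) :* ((h₁ :* h₁ :- h₀ :* h₂) :* ((a :- b) :* (a :- b)))
          := ρz :* ρz :- (K₀₀ :* σ) :* ((K₀₀ :* Q h₂ h₁ h₀ a b :+ (l :+ l) :* (K₁₀ :* c :+ K₀₁ :* d)) :+ σ :* Q K₂₀ K₁₁ K₀₂ c d))
        refl h₀ h₁ h₂ K₀₀ K₁₀ K₀₁ K₂₀ K₁₁ K₀₂ (z x₁) (z y₁) (z x₂) (z y₂))
      (cong₂ (λ r f → r + - ((K₀₀ * σ) * f)) (trans (cong (λ r → r * r) ρz≡0) (trans (zeroˡ 0#) (sym (zeroʳ (K₀₀ * σ)))))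
        (sym (form-block h₂ h₁ h₀ (h₁ + h₂) (h₀ + h₁) σ K₀₀ K₁₀ K₀₁ K₂₀ K₁₁ K₀₂ z)))))

  -- The form is 2 l k + σ Q with k = K₁₀ x₂ + K₀₁ y₂, which ρ represents. Where k = 0 the pair (x₂,
  -- y₂) is proportional to (-K₀₁, K₁₀), and the last hypothesis says that Q is nonpositive at that
  -- vector.
  block-Lorentzian-K₀₀=0 : ∀ {hx hy σ K₁₀ K₀₁ K₂₀ K₁₁ K₀₂} → Pos K₁₀ → 0# ≤ σ →
    K₂₀ * (K₀₁ * K₀₁) + K₀₂ * (K₁₀ * K₁₀) ≤ (K₁₁ + K₁₁) * (K₁₀ * K₀₁) →
    Lorentzian (block 0# 0# 0# hx hy σ 0# K₁₀ K₀₁ K₂₀ K₁₁ K₀₂)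
  block-Lorentzian-K₀₀=0 {hx} {hy} {σ} {K₁₀} {K₀₁} {K₂₀} {K₁₁} {K₀₂} pK 0≤σ disc = ρ , negative
    where
    ρ : Vect
    ρ x₁ = 0#
    ρ y₁ = 0#
    ρ x₂ = K₁₀
    ρ y₂ = K₀₁
    negative : ∀ z → dot ρ z ≡ 0# → form (block 0# 0# 0# hx hy σ 0# K₁₀ K₀₁ K₂₀ K₁₁ K₀₂) z z ≤ 0#
    negative z ρz≡0 = cancel-≤ˡ (pos* pK pK) (by-diff (0≤* 0≤σ (0≤* (≤⇒0≤ disc) (sq≥0 y)))
      (trans (solve 8 (λ σ K₁₀ K₀₁ K₂₀ K₁₁ K₀₂ x y →
          let Q = λ p q r x y → (p :* (x :* x) :+ (q :+ q) :* (x :* y)) :+ r :* (y :* y)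
              L = K₁₀ :* x :+ K₀₁ :* y in
          σ :* (((K₁₁ :+ K₁₁) :* (K₁₀ :* K₀₁) :- (K₂₀ :* (K₀₁ :* K₀₁) :+ K₀₂ :* (K₁₀ :* K₁₀))) :* (y :* y))
          := L :* (σ :* (K₂₀ :* (K₁₀ :* x :- K₀₁ :* y) :+ (K₁₁ :+ K₁₁) :* (K₁₀ :* y))) :- (K₁₀ :* K₁₀) :* (σ :* Q K₂₀ K₁₁ K₀₂ x y))
        refl σ K₁₀ K₀₁ K₂₀ K₁₁ K₀₂ x y)
      (trans (cong (λ L → L * (σ * (K₂₀ * (K₁₀ * x + - (K₀₁ * y)) + (K₁₁ + K₁₁) * (K₁₀ * y))) + - ((K₁₀ * K₁₀) * (σ * quad K₂₀ K₁₁ K₀₂ x y))) L≡0)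
       (cong₂ (λ r f → r + - ((K₁₀ * K₁₀) * f)) (trans (zeroˡ _) (sym (zeroʳ (K₁₀ * K₁₀)))) (sym form≡)))))
      where
      x = z x₂
      y = z y₂
      L≡0 : K₁₀ * x + K₀₁ * y ≡ 0#
      L≡0 = trans (solve 6 (λ K₁₀ K₀₁ a b x y → K₁₀ :* x :+ K₀₁ :* y := (# 0 :* a :+ # 0 :* b) :+ (K₁₀ :* x :+ K₀₁ :* y)) refl K₁₀ K₀₁ (z x₁) (z y₁) x y) ρz≡0
      form≡ : form (block 0# 0# 0# hx hy σ 0# K₁₀ K₀₁ K₂₀ K₁₁ K₀₂) z z ≡ σ * quad K₂₀ K₁₁ K₀₂ x y
      form≡ = trans (form-block 0# 0# 0# hx hy σ 0# K₁₀ K₀₁ K₂₀ K₁₁ K₀₂ z)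
        (trans (cong (λ L → (0# * quad 0# 0# 0# (z x₁) (z y₁) + ((hx * z x₁ + hy * z y₁) + (hx * z x₁ + hy * z y₁)) * L) + σ * quad K₂₀ K₁₁ K₀₂ x y) L≡0)
          (solve 3 (λ q l r → (# 0 :* q :+ l :* # 0) :+ r := r) refl (quad 0# 0# 0# (z x₁) (z y₁)) ((hx * z x₁ + hy * z y₁) + (hx * z x₁ + hy * z y₁)) (σ * quad K₂₀ K₁₁ K₀₂ x y)))

  -- Only the binary form σ Q is left, and K₂₀ Q is the square of K₂₀ x₂ + K₁₁ y₂, which ρ
  -- represents, minus a nonnegative multiple of y₂².
  block-Lorentzian-K₀₀=K₁₀=K₀₁=0 : ∀ {σ K₂₀ K₁₁ K₀₂} → Pos K₂₀ → 0# ≤ σ → K₂₀ * K₀₂ ≤ K₁₁ * K₁₁ →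
    Lorentzian (block 0# 0# 0# 0# 0# σ 0# 0# 0# K₂₀ K₁₁ K₀₂)
  block-Lorentzian-K₀₀=K₁₀=K₀₁=0 {σ} {K₂₀} {K₁₁} {K₀₂} pK 0≤σ disc = ρ , negative
    where
    ρ : Vect
    ρ x₁ = 0#
    ρ y₁ = 0#
    ρ x₂ = K₂₀
    ρ y₂ = K₁₁
    negative : ∀ z → dot ρ z ≡ 0# → form (block 0# 0# 0# 0# 0# σ 0# 0# 0# K₂₀ K₁₁ K₀₂) z z ≤ 0#
    negative z ρz≡0 = cancel-≤ˡ pK (by-diff (0≤* 0≤σ (0≤* (≤⇒0≤ disc) (sq≥0 (z y₂))))
      (trans (solve 8 (λ σ K₂₀ K₁₁ K₀₂ a b x y →
          let Q = λ p q r x y → (p :* (x :* x) :+ (q :+ q) :* (x :* y)) :+ r :* (y :* y)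
              L = (# 0 :* a :+ # 0 :* b) :+ (K₂₀ :* x :+ K₁₁ :* y)
              l = # 0 :* a :+ # 0 :* b in
          σ :* ((K₁₁ :* K₁₁ :- K₂₀ :* K₀₂) :* (y :* y))
          := σ :* (L :* L) :- K₂₀ :* ((# 0 :* Q (# 0) (# 0) (# 0) a b :+ (l :+ l) :* (# 0 :* x :+ # 0 :* y)) :+ σ :* Q K₂₀ K₁₁ K₀₂ x y))
        refl σ K₂₀ K₁₁ K₀₂ (z x₁) (z y₁) (z x₂) (z y₂))
      (cong₂ (λ r f → r + - (K₂₀ * f))
        (trans (cong (λ L → σ * (L * L)) ρz≡0) (solve 2 (λ σ k → σ :* (# 0 :* # 0) := k :* # 0) refl σ K₂₀))
        (sym (form-block 0# 0# 0# 0# 0# σ 0# 0# 0# K₂₀ K₁₁ K₀₂ z)))))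

  -- fPμ² - (f+1)(P-1)ν² for P = p + 1, μ = ν + 1, f = ν + Q.
  weight : (ν p Q : Carrier) → Carrier
  weight ν p Q = ((ν + Q) * (1# + p)) * ((1# + ν) * (1# + ν)) + - ((ν * ν) * ((1# + (ν + Q)) * p))

  -- The four ratios are those of neighbouring binomials. They give fPμ² (A₀B₀)(A₂B₂) = ν² (f + 1) p
  -- (A₁B₁)², so b₀b₂ ≤ b₁² leaves the share `weight` of the square. The last hypothesis carries the
  -- factor p because for p = 0 the index belonging to b₂ may fall off the sequence.
  weighted-square : ∀ {ν p Q A₀ B₀ A₁ B₁ A₂ B₂ b₀ b₁ b₂} → let μ = 1# + ν ; P = 1# + p ; f = ν + Q in
    0# ≤ ν → 0# ≤ Q →
    ν * A₁ ≡ f * A₀ → ν * B₁ ≡ P * B₀ → μ * A₂ ≡ (1# + f) * A₁ → μ * B₂ ≡ p * B₁ →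
    p * (b₀ * b₂) ≤ p * (b₁ * b₁) →
    ((A₁ * B₁ * b₁) * (A₁ * B₁ * b₁)) * weight ν p Q
      ≤ ((f * P) * (μ * μ)) * ((A₁ * B₁ * b₁) * (A₁ * B₁ * b₁) + - ((A₀ * B₀ * b₀) * (A₂ * B₂ * b₂)))
  weighted-square {ν} {p} {Q} {A₀} {B₀} {A₁} {B₁} {A₂} {B₂} {b₀} {b₁} {b₂} 0≤ν 0≤Q eA₁ eB₁ eA₂ eB₂ le = by-diff
      (0≤* (0≤* (sq≥0 (ν * U)) (0≤+ 0≤1 (0≤+ 0≤ν 0≤Q))) (≤⇒0≤ le))
      (trans (solve 7 (λ ν p f U b r m → let P = # 1 :+ p ; X = (ν :* ν) :* ((# 1 :+ f) :* p) in
                ((ν :* U) :* (ν :* U)) :* (# 1 :+ f) :* (p :* (b :* b) :- p :* r)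
                := ((f :* P) :* m :* ((U :* b) :* (U :* b)) :- X :* (U :* U) :* r) :- ((U :* b) :* (U :* b)) :* ((f :* P) :* m :- X))
               refl ν p f U b₁ (b₀ * b₂) (μ * μ))
      (trans (cong (λ X → ((f * P) * (μ * μ) * ((U * b₁) * (U * b₁)) + - X) + - (((U * b₁) * (U * b₁)) * weight ν p Q)) scaled)
        (solve 4 (λ c s k e → (c :* s :- c :* k) :- e := c :* (s :- k) :- e)
          refl ((f * P) * (μ * μ)) ((U * b₁) * (U * b₁)) ((A₀ * B₀ * b₀) * (A₂ * B₂ * b₂)) (((U * b₁) * (U * b₁)) * weight ν p Q))))
    where
    μ = 1# + ν
    P = 1# + p
    f = ν + Q
    U = A₁ * B₁
    scaled : (ν * ν) * ((1# + f) * p) * (U * U) * (b₀ * b₂) ≡ ((f * P) * (μ * μ)) * ((A₀ * B₀ * b₀) * (A₂ * B₂ * b₂))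
    scaled = begin
      (ν * ν) * ((1# + f) * p) * (U * U) * (b₀ * b₂)
        ≡⟨ solve 7 (λ ν g p a₁ b₁ b₀ b₂ → (ν :* ν) :* (g :* p) :* ((a₁ :* b₁) :* (a₁ :* b₁)) :* (b₀ :* b₂) := ((ν :* a₁) :* (ν :* b₁)) :* ((g :* a₁) :* (p :* b₁)) :* (b₀ :* b₂)) refl ν (1# + f) p A₁ B₁ b₀ b₂ ⟩
      ((ν * A₁) * (ν * B₁)) * (((1# + f) * A₁) * (p * B₁)) * (b₀ * b₂)
        ≡⟨ cong₂ (λ x y → x * y * (b₀ * b₂)) (cong₂ _*_ eA₁ eB₁) (cong₂ _*_ (sym eA₂) (sym eB₂)) ⟩
      ((f * A₀) * (P * B₀)) * ((μ * A₂) * (μ * B₂)) * (b₀ * b₂)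
        ≡⟨ solve 9 (λ f P μ a₀ b₀ a₂ b₂ x y → ((f :* a₀) :* (P :* b₀)) :* ((μ :* a₂) :* (μ :* b₂)) :* (x :* y) := ((f :* P) :* (μ :* μ)) :* ((a₀ :* b₀ :* x) :* (a₂ :* b₂ :* y))) refl f P μ A₀ B₀ A₂ B₂ b₀ b₂ ⟩
      ((f * P) * (μ * μ)) * ((A₀ * B₀ * b₀) * (A₂ * B₂ * b₂)) ∎
      where open ≡-Reasoning

  weight-nonneg : ∀ {ν p Q} → 0# ≤ ν → 0# ≤ p → 0# ≤ Q → 0# ≤ weight ν p Q
  weight-nonneg {ν} {p} {Q} 0≤ν 0≤p 0≤Q = subst (0# ≤_)
    (solve 3 (λ ν p Q → let P = # 1 :+ p ; f = ν :+ Q ; μ = # 1 :+ ν in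
       P :* (ν :* μ :+ Q :* (ν :+ μ)) :+ (μ :+ Q) :* (ν :* ν)
       := (f :* P) :* (μ :* μ) :- (ν :* ν) :* ((# 1 :+ f) :* p)) refl ν p Q)
    (0≤+ (0≤* (0≤+ 0≤1 0≤p) (0≤+ (0≤* 0≤ν 0≤μ) (0≤* 0≤Q (0≤+ 0≤ν 0≤μ)))) (0≤* (0≤+ 0≤μ 0≤Q) (sq≥0 ν)))
    where 0≤μ = 0≤+ 0≤1 0≤ν

  -- The determinant condition of the reduced form after β has been estimated away, so that only
  -- binomial parameters remain. The difference of the sides is ν² times a sum of evidently
  -- nonnegative terms.
  weight-product : ∀ {ν p q} → let μ = 1# + ν ; P = 1# + p ; Q = 1# + q ; ω = μ * μ + - (ν * ν) in
    0# ≤ ν → 0# ≤ p → 0# ≤ q → (((ν + Q) * P) * ((ν + P) * Q)) * (ω * ω) ≤ weight ν p Q * weight ν q P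
  weight-product {ν} {p} {q} 0≤ν 0≤p 0≤q = by-diff
      (0≤* (sq≥0 ν) (0≤+ (0≤+ (0≤* (0≤* (0≤+ 0≤ν 0≤μ) 0≤μ) (0≤+ (0≤* 0≤ν (0≤+ 0≤P 0≤Q)) (0≤+ (0≤* 0≤P 0≤Q) (0≤* 0≤P 0≤Q))))
        (0≤* (sq≥0 ν) (sq≥0 (1# + ν)))) (0≤* (0≤* 0≤ν 0≤μ) (sq≥0 (p + - q)))))
      (solve 3 (λ ν p q → let P = # 1 :+ p ; Q = # 1 :+ q ; f = ν :+ Q ; g = ν :+ P ; μ = # 1 :+ ν ; ω = μ :* μ :- ν :* ν in
         (ν :* ν) :* (((ν :+ μ) :* μ :* (ν :* (P :+ Q) :+ (P :* Q :+ P :* Q)) :+ (ν :* ν) :* (μ :* μ)) :+ (ν :* μ) :* ((p :- q) :* (p :- q)))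
         := ((f :* P) :* (μ :* μ) :- (ν :* ν) :* ((# 1 :+ f) :* p)) :* ((g :* Q) :* (μ :* μ) :- (ν :* ν) :* ((# 1 :+ g) :* q))
            :- ((f :* P) :* (g :* Q)) :* (ω :* ω)) refl ν p q)
    where
    0≤μ = 0≤+ 0≤1 0≤ν
    0≤P = 0≤+ 0≤1 0≤p
    0≤Q = 0≤+ 0≤1 0≤q

  module _ {ν P Q A₀ B₀ A₁ B₁ A₁′ B₁′ A₁₁ B₁₁ b₀ b₁ b₁′ b₁₁ : Carrier} where
    private
      μ = 1# + ν
      ω = μ * μ + - (ν * ν)
      K₁₀ = A₁ * B₁′ * b₁
      K₀₁ = A₁′ * B₁ * b₁′
      s = K₁₀ * K₀₁ + - ((A₀ * B₀ * b₀) * (A₁₁ * B₁₁ * b₁₁))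
      Z = (A₁ * B₁′) * (A₁′ * B₁)
      gap = b₀ * b₁₁ + - (b₁ * b₁′)

    module _ (eA : ν * A₁′ ≡ Q * A₀) (eB : ν * B₁′ ≡ P * B₀) (eA′ : μ * A₁₁ ≡ Q * A₁) (eB′ : μ * B₁₁ ≡ P * B₁) where

      -- `s` is the mixed entry of the reduced form. The ratios of binomials turn μ² A₀B₀A₁₁B₁₁ into
      -- ν² Z, so that bounds on `gap` become bounds on `s`.
      cross-scaled : (μ * μ) * s ≡ Z * (ω * (b₁ * b₁′)) + - (Z * ((ν * ν) * gap))
      cross-scaled = begin
        (μ * μ) * s
          ≡⟨ solve 9 (λ μ K₁₀ K₀₁ A₀ B₀ b₀ A₁₁ B₁₁ b₁₁ → (μ :* μ) :* (K₁₀ :* K₀₁ :- (A₀ :* B₀ :* b₀) :* (A₁₁ :* B₁₁ :* b₁₁))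
               := (μ :* μ) :* (K₁₀ :* K₀₁) :- ((A₀ :* B₀) :* ((μ :* A₁₁) :* (μ :* B₁₁))) :* (b₀ :* b₁₁)) refl μ K₁₀ K₀₁ A₀ B₀ b₀ A₁₁ B₁₁ b₁₁ ⟩
        (μ * μ) * (K₁₀ * K₀₁) + - (((A₀ * B₀) * ((μ * A₁₁) * (μ * B₁₁))) * (b₀ * b₁₁))
          ≡⟨ cong₂ (λ x y → (μ * μ) * (K₁₀ * K₀₁) + - (((A₀ * B₀) * (x * y)) * (b₀ * b₁₁))) eA′ eB′ ⟩
        (μ * μ) * (K₁₀ * K₀₁) + - (((A₀ * B₀) * ((Q * A₁) * (P * B₁))) * (b₀ * b₁₁))
          ≡⟨ solve 9 (λ k A₀ B₀ A₁ B₁ P Q b m → m :* k :- ((A₀ :* B₀) :* ((Q :* A₁) :* (P :* B₁))) :* b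
               := m :* k :- ((Q :* A₀) :* (P :* B₀) :* (A₁ :* B₁)) :* b) refl (K₁₀ * K₀₁) A₀ B₀ A₁ B₁ P Q (b₀ * b₁₁) (μ * μ) ⟩
        (μ * μ) * (K₁₀ * K₀₁) + - (((Q * A₀) * (P * B₀) * (A₁ * B₁)) * (b₀ * b₁₁))
          ≡⟨ cong₂ (λ x y → (μ * μ) * (K₁₀ * K₀₁) + - ((x * y * (A₁ * B₁)) * (b₀ * b₁₁))) (sym eA) (sym eB) ⟩
        (μ * μ) * (K₁₀ * K₀₁) + - (((ν * A₁′) * (ν * B₁′) * (A₁ * B₁)) * (b₀ * b₁₁))
          ≡⟨ solve 9 (λ m ν A₁ B₁ A₁′ B₁′ b₁ b₁′ b → let Z = (A₁ :* B₁′) :* (A₁′ :* B₁) in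
                m :* ((A₁ :* B₁′ :* b₁) :* (A₁′ :* B₁ :* b₁′)) :- ((ν :* A₁′) :* (ν :* B₁′) :* (A₁ :* B₁)) :* b
                := Z :* ((m :- ν :* ν) :* (b₁ :* b₁′)) :- Z :* ((ν :* ν) :* (b :- b₁ :* b₁′))) refl (μ * μ) ν A₁ B₁ A₁′ B₁′ b₁ b₁′ (b₀ * b₁₁) ⟩
        Z * (ω * (b₁ * b₁′)) + - (Z * ((ν * ν) * gap)) ∎
        where open ≡-Reasoning

      cross-upper : 0# ≤ Z → b₁ * b₁′ ≤ b₀ * b₁₁ → (μ * μ) * s ≤ (K₁₀ * K₀₁) * ω
      cross-upper 0≤Z le = by-diff (0≤* 0≤Z (0≤* (sq≥0 ν) (≤⇒0≤ le)))
        (trans (solve 4 (λ Z b ω g → g := (Z :* b) :* ω :- (Z :* (ω :* b) :- g)) refl Z (b₁ * b₁′) ω (Z * ((ν * ν) * gap)))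
          (cong₂ (λ x y → x * ω + - y)
            (solve 6 (λ A₁ B₁ A₁′ B₁′ b₁ b₁′ → (A₁ :* B₁′) :* (A₁′ :* B₁) :* (b₁ :* b₁′) := (A₁ :* B₁′ :* b₁) :* (A₁′ :* B₁ :* b₁′)) refl A₁ B₁ A₁′ B₁′ b₁ b₁′)
            (sym cross-scaled)))

      cross-nonneg : Pos μ → 0# ≤ ν → 0# ≤ Z → 0# ≤ b₁ * b₁′ → ν * gap ≤ b₁ * b₁′ → 0# ≤ s
      -- Since μ = ν + 1, the factor ω = μ² - ν² equals ν + μ; the part ν of it outweighs the term
      -- with `gap`.
      cross-nonneg pμ 0≤ν 0≤Z 0≤bb le = cancel-0≤ (pos* pμ pμ) (subst (0# ≤_)
        (trans (solve 4 (λ Z ν b g → let μ = # 1 :+ ν in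
            Z :* (ν :* (b :- ν :* g) :+ μ :* b) := Z :* ((μ :* μ :- ν :* ν) :* b) :- Z :* ((ν :* ν) :* g)) refl Z ν (b₁ * b₁′) gap)
          (sym cross-scaled))
        (0≤* 0≤Z (0≤+ (0≤* 0≤ν (≤⇒0≤ le)) (0≤* (proj₁ pμ) 0≤bb))))

  -- The polynomial f and its Hessians

  -- f (s ∸ e), but 0# when s < e.
  above : ℕ → ℕ → (ℕ → Carrier) → Carrier
  above zero    s       f = f s
  above (suc e) zero    f = 0#
  above (suc e) (suc s) f = above e s f

  above-+ : ∀ e n f → above e (e ℕ.+ n) f ≡ f n
  above-+ zero    n f = refl
  above-+ (suc e) n f = above-+ e n f

  above-< : ∀ {e s} f → s ℕ.< e → above e s f ≡ 0#
  above-< {suc e} {zero}  f _         = refl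
  above-< {suc e} {suc s} f (s≤s s<e) = above-< f s<e

  Family : Set
  Family = ℕ → ℕ → ℕ → Carrier

  -- On coefficients in the divided power basis a derivative merely shifts an exponent. The exponent
  -- of y₁ is not recorded, so the derivative along y₁ leaves the array as it is and only lowers the
  -- implicit total degree.
  at : Dir → Family → Family
  at x₁ g i u w = g (suc i) u w
  at y₁ g i u w = g i u w
  at x₂ g i u w = g i (suc u) w
  at y₂ g i u w = g i u (suc w)

  hessian : Family → ℕ → ℕ → ℕ → Matr
  hessian g i u w p q = at p (at q g) i u w

  -- Up to the constant e!, the divided power coefficient at x₂ᵘ y₂ʷ of (x₂y₂)ⁿ/n!² DⁿG.
  -- Multiplication by x₂ⁿ/n! brings in C(u, n), similarly for y₂, and Dⁿ acts on β as (1 + E)ⁿ.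
  -- Since u + w = e + n by degree, the index e ∸ w is u - n.
  κ : ℕ → (ℕ → Carrier) → ℕ → ℕ → ℕ → Carrier
  κ e β u w n = binom u n * binom w n * pascal n β (e ℕ.∸ w)

  module _ (e : ℕ) (α β : ℕ → Carrier) where

    -- The coefficients (in the divided power basis) of
    -- Σₙ (x₂y₂)ⁿ/n!² DⁿH(x₁,y₁) DⁿG(x₂,y₂), D = ∂x + ∂y, where α and β are the
    -- normalised coefficients of H and G; the exponent of y₁ is implicit.
    coef : Family
    coef i u w = above e (u ℕ.+ w) (λ n → pascal n α i * κ e β u w n)

    coef-≡ : ∀ i {u w n} → u ℕ.+ w ≡ e ℕ.+ n → coef i u w ≡ pascal n α i * κ e β u w n
    coef-≡ i {u} {w} {n} eq = trans (cong (λ s → above e s (λ n → pascal n α i * κ e β u w n)) eq) (above-+ e n _)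

    coef-< : ∀ i {u w} → u ℕ.+ w ℕ.< e → coef i u w ≡ 0#
    coef-< i = above-< _

  +suc : ∀ {s} e n → s ≡ e ℕ.+ n → suc s ≡ e ℕ.+ suc n
  +suc e n eq = trans (cong suc eq) (sym (+-suc e n))

  -- Semidefiniteness of the reduced form

  module _ {n Q : ℕ} where

    binom-absorb₁ : ι (suc n) * binom (suc (Q ℕ.+ n)) (suc n) ≡ (ι (suc n) + ι Q) * binom (Q ℕ.+ n) n
    binom-absorb₁ = trans (binom-absorb (Q ℕ.+ n) n) (cong (_* binom (Q ℕ.+ n) n)
      (trans (cong (1# +_) (ι-+ Q n)) (solve 2 (λ q n → # 1 :+ (q :+ n) := (# 1 :+ n) :+ q) refl (ι Q) (ι n))))

    binom-absorb₂ : ι (suc (suc n)) * binom (suc (suc (Q ℕ.+ n))) (suc (suc n)) ≡ (1# + (ι (suc n) + ι Q)) * binom (suc (Q ℕ.+ n)) (suc n)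
    binom-absorb₂ = trans (binom-absorb (suc (Q ℕ.+ n)) (suc n)) (cong (_* binom (suc (Q ℕ.+ n)) (suc n))
      (trans (cong (λ x → 1# + (1# + x)) (ι-+ Q n)) (solve 2 (λ q n → # 1 :+ (# 1 :+ (q :+ n)) := # 1 :+ ((# 1 :+ n) :+ q)) refl (ι Q) (ι n))))

    binom-shift₁ : ι (suc (suc n)) * binom (suc (Q ℕ.+ n)) (suc (suc n)) ≡ ι Q * binom (suc (Q ℕ.+ n)) (suc n)
    binom-shift₁ = subst (λ m → ι (suc (suc n)) * binom m (suc (suc n)) ≡ ι Q * binom m (suc n)) (+-suc Q n) (binom-shift Q (suc n))

  module _ {β : ℕ → Carrier} (lc : LC β) (0≤β : ∀ i → 0# ≤ β i) where

    private
      b : ℕ → ℕ → Carrier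
      b n = pascal n β

    -- If a, b, c are consecutive in row n, the next two rows contain a + b, b + c and a + 2b + c.
    -- In this lemma and the two after it the difference of the sides is the same b² - ac, and
    -- `pascal-gap≤` bounds that quantity from above.
    pascal-logconcaveʳ : ∀ n Q → b n Q * b (suc (suc n)) Q ≤ b (suc n) Q * b (suc n) Q
    pascal-logconcaveʳ n Q = by-diff (≤⇒0≤ (pascal-LC n lc 1 (n≤1+n Q)))
      (solve 3 (λ a b c → b :* b :- a :* c := (a :+ b) :* (a :+ b) :- a :* ((a :+ b) :+ (b :+ c))) refl (b n Q) (b n (suc Q)) (b n (suc (suc Q))))

    pascal-logconcaveˡ : ∀ n Q → b n (suc (suc Q)) * b (suc (suc n)) Q ≤ b (suc n) (suc Q) * b (suc n) (suc Q)
    pascal-logconcaveˡ n Q = by-diff (≤⇒0≤ (pascal-LC n lc 1 (n≤1+n Q)))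
      (solve 3 (λ a b c → b :* b :- a :* c := (b :+ c) :* (b :+ c) :- c :* ((a :+ b) :+ (b :+ c))) refl (b n Q) (b n (suc Q)) (b n (suc (suc Q))))

    pascal-gap≥0 : ∀ n Q → b (suc n) (suc Q) * b (suc n) Q ≤ b n (suc Q) * b (suc (suc n)) Q
    pascal-gap≥0 n Q = by-diff (≤⇒0≤ (pascal-LC n lc 1 (n≤1+n Q)))
      (solve 3 (λ a b c → b :* b :- a :* c := b :* ((a :+ b) :+ (b :+ c)) :- (b :+ c) :* (a :+ b)) refl (b n Q) (b n (suc Q)) (b n (suc (suc Q))))

    pascal-gap≤ : ∀ n Q → ι (suc n) * (b n (suc Q) * b (suc (suc n)) Q + - (b (suc n) (suc Q) * b (suc n) Q)) ≤ b (suc n) (suc Q) * b (suc n) Q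
    pascal-gap≤ n Q = subst₂ _≤_
      (cong (ι (suc n) *_) (solve 3 (λ a b c → b :* b :- a :* c := b :* ((a :+ b) :+ (b :+ c)) :- (b :+ c) :* (a :+ b)) refl (b n Q) (b n (suc Q)) (b n (suc (suc Q)))))
      (*-comm _ _) (pascal-newton n 0≤β Q)

    module _ (n P Q : ℕ) where
      private
        e = Q ℕ.+ (P ℕ.+ n)
        u = Q ℕ.+ n
        w = P ℕ.+ n
        ν = ι (suc n)
        μ = ι (suc (suc n))
        k = κ e β
        K₀₀ = k u w n
        K₁₀ = k (suc u) w (suc n)
        K₀₁ = k u (suc w) (suc n)
        K₂₀ = k (suc (suc u)) w (suc (suc n))
        K₁₁ = k (suc u) (suc w) (suc (suc n))
        K₀₂ = k u (suc (suc w)) (suc (suc n))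
        p = K₁₀ * K₁₀ + - (K₀₀ * K₂₀)
        s = K₁₀ * K₀₁ + - (K₀₀ * K₁₁)
        r = K₀₁ * K₀₁ + - (K₀₀ * K₀₂)

      diagonal-x : ∀ {P′} → P ≡ suc P′ → (K₁₀ * K₁₀) * weight ν (ι P′) (ι Q) ≤ (((ν + ι Q) * ι P) * (μ * μ)) * p
      diagonal-x {P′} refl = weighted-square {B₀ = binom w n} {B₂ = binom w (suc (suc n))} {b₀ = b n (e ℕ.∸ w)} {b₂ = b (suc (suc n)) (e ℕ.∸ w)} (0≤ι (suc n)) (0≤ι Q)
        (binom-absorb₁ {n} {Q}) (binom-shift P n) (binom-absorb₂ {n} {Q}) (binom-shift₁ {n} {P′})
        (*-monoˡ (0≤ι P′) (pascal-logconcaveʳ n (e ℕ.∸ w)))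

      diagonal-y : ∀ {Q′} → Q ≡ suc Q′ → (K₀₁ * K₀₁) * weight ν (ι Q′) (ι P) ≤ (((ν + ι P) * ι Q) * (μ * μ)) * r
      diagonal-y {Q′} refl = subst₂ (λ x y → (x * x) * weight ν (ι Q′) (ι P) ≤ (((ν + ι P) * ι Q) * (μ * μ)) * (x * x + - y))
        (cong (_* b (suc n) (e ℕ.∸ suc w)) (*-comm _ _))
        (cong₂ _*_ (cong (_* b n (e ℕ.∸ w)) (*-comm _ _)) (cong (_* b (suc (suc n)) (e ℕ.∸ suc (suc w))) (*-comm _ _)))
        (weighted-square {B₀ = binom u n} {B₂ = binom u (suc (suc n))} {b₀ = b n (e ℕ.∸ w)} {b₂ = b (suc (suc n)) (e ℕ.∸ suc (suc w))} (0≤ι (suc n)) (0≤ι P)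
          (binom-absorb₁ {n} {P}) (binom-shift Q n) (binom-absorb₂ {n} {P}) (binom-shift₁ {n} {Q′}) (le Q′))
        where
        le : ∀ Q′ → let e = suc Q′ ℕ.+ w in
          ι Q′ * (b n (e ℕ.∸ w) * b (suc (suc n)) (e ℕ.∸ suc (suc w))) ≤ ι Q′ * (b (suc n) (e ℕ.∸ suc w) * b (suc n) (e ℕ.∸ suc w))
        -- For Q = 1 the index e ∸ (w + 2) is truncated, and log-concavity says nothing about that
        -- entry; the factor ι 0 makes both sides zero.
        le zero = ≤-reflexive (trans (zeroˡ _) (sym (zeroˡ _)))
        le (suc Q″) rewrite m+n∸n≡m (suc (suc Q″)) w | m+n∸n≡m (suc Q″) w | m+n∸n≡m Q″ w =
          *-monoˡ (0≤ι (suc Q″)) (pascal-logconcaveˡ n Q″)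

      private
        0≤K² : ∀ x {c} → 0# ≤ c → 0# ≤ (x * x) * c
        0≤K² x 0≤c = 0≤* (sq≥0 x) 0≤c

        pμ : Pos μ
        pμ = ι-pos (suc n)

        pfactor : ∀ P Q {P′} → P ≡ suc P′ → Pos (((ν + ι Q) * ι P) * (μ * μ))
        pfactor P Q {P′} refl = pos* (pos* (pos+ (ι-pos n) (0≤ι Q)) (ι-pos P′)) (pos* pμ pμ)

      diagonal-x≥0 : ∀ {P′} → P ≡ suc P′ → 0# ≤ p
      diagonal-x≥0 {P′} eq = cancel-0≤ (pfactor P Q eq) (≤-trans (0≤K² K₁₀ (weight-nonneg (0≤ι (suc n)) (0≤ι P′) (0≤ι Q))) (diagonal-x eq))

      diagonal-y≥0 : ∀ {Q′} → Q ≡ suc Q′ → 0# ≤ r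
      diagonal-y≥0 {Q′} eq = cancel-0≤ (pfactor Q P eq) (≤-trans (0≤K² K₀₁ (weight-nonneg (0≤ι (suc n)) (0≤ι Q′) (0≤ι P))) (diagonal-y eq))

      -- Log-concavity bounds μ² s above by K₁₀ K₀₁ ω. By `pascal-newton`, through `pascal-gap≤`, s
      -- is nonnegative, so this bound may be squared. The diagonal entries are bounded below by
      -- their weights times K₁₀² and K₀₁², and `weight-product` compares the results.
      off-diagonal : ∀ {P′ Q′} → P ≡ suc P′ → Q ≡ suc Q′ → s * s ≤ p * r
      off-diagonal {P′} {Q′} refl refl = cancel-≤ˡ (pos* (pfactor P Q refl) (pfactor Q P refl))
        (subst₂ _≤_
          (solve 4 (λ F G m s → (F :* G) :* ((m :* s) :* (m :* s)) := ((F :* m) :* (G :* m)) :* (s :* s)) refl F G (μ * μ) s)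
          (solve 4 (λ x y p r → (x :* p) :* (y :* r) := (x :* y) :* (p :* r)) refl (F * (μ * μ)) (G * (μ * μ)) p r)
          (≤-trans (*-monoˡ 0≤FG (*-mono 0≤μμs 0≤up up up))
          (≤-trans (≤-trans (≤-reflexive (solve 4 (λ c x y o → c :* (((x :* y) :* o) :* ((x :* y) :* o)) := ((x :* x) :* (y :* y)) :* (c :* (o :* o))) refl (F * G) K₁₀ K₀₁ ω))
                      (*-monoˡ (0≤* (sq≥0 K₁₀) (sq≥0 K₀₁)) (weight-product (0≤ι (suc n)) (0≤ι P′) (0≤ι Q′))))
          (≤-trans (≤-reflexive (solve 4 (λ x y v w → (x :* y) :* (v :* w) := (x :* v) :* (y :* w)) refl (K₁₀ * K₁₀) (K₀₁ * K₀₁) wx wy))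
                   (*-mono (0≤K² K₁₀ 0≤wx) (≤-trans (0≤K² K₀₁ 0≤wy) (diagonal-y refl)) (diagonal-x refl) (diagonal-y refl))))))
        where
        F = (ν + ι Q) * ι P
        G = (ν + ι P) * ι Q
        ω = μ * μ + - (ν * ν)
        wx = weight ν (ι P′) (ι Q)
        wy = weight ν (ι Q′) (ι P)
        0≤ν = 0≤ι (suc n)
        0≤wx = weight-nonneg 0≤ν (0≤ι P′) (0≤ι Q)
        0≤wy = weight-nonneg 0≤ν (0≤ι Q′) (0≤ι P)
        0≤FG = 0≤* (0≤* (0≤+ 0≤ν (0≤ι Q)) (0≤ι P)) (0≤* (0≤+ 0≤ν (0≤ι P)) (0≤ι Q))
        0≤b : ∀ m i → 0# ≤ b m i
        0≤b m i = pascal-nonneg m 0≤β i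
        0≤Z = 0≤* (0≤* (binom-nonneg (suc u) (suc n)) (binom-nonneg w (suc n))) (0≤* (binom-nonneg u (suc n)) (binom-nonneg (suc w) (suc n)))
        up : (μ * μ) * s ≤ (K₁₀ * K₀₁) * ω
        up = cross-upper (binom-shift Q n) (binom-shift P n) (binom-shift₁ {n} {Q}) (binom-shift₁ {n} {P}) 0≤Z
          (subst₂ (λ i j → b (suc n) i * b (suc n) j ≤ b n i * b (suc (suc n)) j) (sym (m+n∸n≡m Q w)) (sym (m+n∸n≡m Q′ w)) (pascal-gap≥0 n Q′))
        0≤s : 0# ≤ s
        0≤s = cross-nonneg (binom-shift Q n) (binom-shift P n) (binom-shift₁ {n} {Q}) (binom-shift₁ {n} {P}) pμ 0≤ν 0≤Z (0≤* (0≤b (suc n) (e ℕ.∸ w)) (0≤b (suc n) (e ℕ.∸ suc w)))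
          (subst₂ (λ i j → ν * (b n i * b (suc (suc n)) j + - (b (suc n) i * b (suc n) j)) ≤ b (suc n) i * b (suc n) j) (sym (m+n∸n≡m Q w)) (sym (m+n∸n≡m Q′ w)) (pascal-gap≤ n Q′))
        0≤μμs = 0≤* (sq≥0 μ) 0≤s
        0≤up = ≤-trans 0≤μμs up

  κ-vanishˡ : ∀ e β u w {n} → u ℕ.< n → κ e β u w n ≡ 0#
  κ-vanishˡ e β u w {n} lt = trans (cong (λ x → x * binom w n * pascal n β (e ℕ.∸ w)) (binom-> lt))
    (solve 2 (λ x y → # 0 :* x :* y := # 0) refl (binom w n) (pascal n β (e ℕ.∸ w)))

  κ-vanishʳ : ∀ e β u w {n} → w ℕ.< n → κ e β u w n ≡ 0#
  κ-vanishʳ e β u w {n} lt = trans (cong (λ x → binom u n * x * pascal n β (e ℕ.∸ w)) (binom-> lt))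
    (solve 2 (λ x y → x :* # 0 :* y := # 0) refl (binom u n) (pascal n β (e ℕ.∸ w)))

  private
    0-0* : ∀ {a b c d} → a ≡ 0# → d ≡ 0# → a * b + - (c * d) ≡ 0#
    0-0* {b = b} {c = c} refl refl = solve 2 (λ b c → # 0 :* b :- c :* # 0 := # 0) refl b c

  -- P = e - u and Q = e - w are the distances to the edges of the support. On an edge a vanishing
  -- binomial kills s and one diagonal entry, so that the determinant has to be estimated in the
  -- interior only.
  κ-psd : ∀ {β} → LC β → (∀ i → 0# ≤ β i) → ∀ n P Q →
    let k = κ (Q ℕ.+ (P ℕ.+ n)) β ; u = Q ℕ.+ n ; w = P ℕ.+ n
        K₀₀ = k u w n ; K₁₀ = k (suc u) w (suc n) ; K₀₁ = k u (suc w) (suc n)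
        K₂₀ = k (suc (suc u)) w (suc (suc n)) ; K₁₁ = k (suc u) (suc w) (suc (suc n)) ; K₀₂ = k u (suc (suc w)) (suc (suc n)) in
    ∀ x y → 0# ≤ quad (K₁₀ * K₁₀ + - (K₀₀ * K₂₀)) (K₁₀ * K₀₁ + - (K₀₀ * K₁₁)) (K₀₁ * K₀₁ + - (K₀₀ * K₀₂)) x y
  κ-psd {β} lc 0≤β n P Q = psd (0≤p P Q) (0≤r P Q) (ss≤pr P Q)
    where
    module _ (P Q : ℕ) where
      e = Q ℕ.+ (P ℕ.+ n)
      u = Q ℕ.+ n
      w = P ℕ.+ n
      K₀₀ = κ e β u w n
      K₁₀ = κ e β (suc u) w (suc n)
      K₀₁ = κ e β u (suc w) (suc n)
      K₂₀ = κ e β (suc (suc u)) w (suc (suc n))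
      K₁₁ = κ e β (suc u) (suc w) (suc (suc n))
      K₀₂ = κ e β u (suc (suc w)) (suc (suc n))
      p = K₁₀ * K₁₀ + - (K₀₀ * K₂₀)
      s = K₁₀ * K₀₁ + - (K₀₀ * K₁₁)
      r = K₀₁ * K₀₁ + - (K₀₀ * K₀₂)
    lt₁ = n<1+n n
    lt₂ = m≤n⇒m≤1+n lt₁
    0≤p : ∀ P Q → 0# ≤ p P Q
    0≤p zero    Q = ≤-reflexive (sym (0-0* {c = K₀₀ 0 Q} (κ-vanishʳ (e 0 Q) β (suc (u 0 Q)) n lt₁) (κ-vanishʳ (e 0 Q) β (suc (suc (u 0 Q))) n lt₂)))
    0≤p (suc P) Q = diagonal-x≥0 lc 0≤β n (suc P) Q refl
    0≤r : ∀ P Q → 0# ≤ r P Q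
    0≤r P zero    = ≤-reflexive (sym (0-0* {c = K₀₀ P 0} (κ-vanishˡ (e P 0) β n (suc (w P 0)) lt₁) (κ-vanishˡ (e P 0) β n (suc (suc (w P 0))) lt₂)))
    0≤r P (suc Q) = diagonal-y≥0 lc 0≤β n P (suc Q) refl
    s≡0⇒ : ∀ P Q → s P Q ≡ 0# → s P Q * s P Q ≤ p P Q * r P Q
    s≡0⇒ P Q s≡0 = subst (_≤ p P Q * r P Q) (sym (trans (cong (λ x → x * x) s≡0) (zeroˡ 0#))) (0≤* (0≤p P Q) (0≤r P Q))
    ss≤pr : ∀ P Q → s P Q * s P Q ≤ p P Q * r P Q
    ss≤pr zero    Q       = s≡0⇒ 0 Q (0-0* {c = K₀₀ 0 Q} (κ-vanishʳ (e 0 Q) β (suc (u 0 Q)) n lt₁) (κ-vanishʳ (e 0 Q) β (suc (u 0 Q)) (suc n) (s≤s lt₁)))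
    ss≤pr (suc P) zero    = s≡0⇒ (suc P) 0 (trans (cong (_+ - (K₀₀ (suc P) 0 * K₁₁ (suc P) 0)) (*-comm (K₁₀ (suc P) 0) (K₀₁ (suc P) 0)))
      (0-0* {c = K₀₀ (suc P) 0} (κ-vanishˡ (e (suc P) 0) β n (suc (w (suc P) 0)) lt₁) (κ-vanishˡ (e (suc P) 0) β (suc n) (suc (w (suc P) 0)) (s≤s lt₁))))
    ss≤pr (suc P) (suc Q) = off-diagonal lc 0≤β n (suc P) (suc Q) refl refl

  Lorentzian-zero : ∀ {M} → (∀ p q → M p q ≡ 0#) → Lorentzian M
  Lorentzian-zero {M} M≡0 = (λ _ → 0#) , λ z _ → ≤-reflexive
    (trans (dot-cong z (λ p → trans (dot-cong z (M≡0 p)) (z·0 z))) (z·0 z))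
    where
    z·0 : ∀ z → dot z (λ _ → 0#) ≡ 0#
    z·0 z = solve 4 (λ a b c d → (a :* # 0 :+ b :* # 0) :+ (c :* # 0 :+ d :* # 0) := # 0) refl (z x₁) (z y₁) (z x₂) (z y₂)

  at-rect : ∀ p g i u w → ∃ λ i′ → ∃ λ u′ → ∃ λ w′ →
    at p g i u w ≡ g i′ u′ w′ × u ℕ.≤ u′ × w ℕ.≤ w′ × u′ ℕ.+ w′ ℕ.≤ suc (u ℕ.+ w)
  at-rect x₁ g i u w = suc i , u , w , refl , ℕₚ.≤-refl , ℕₚ.≤-refl , n≤1+n _
  at-rect y₁ g i u w = i , u , w , refl , ℕₚ.≤-refl , ℕₚ.≤-refl , n≤1+n _
  at-rect x₂ g i u w = i , suc u , w , refl , n≤1+n u , ℕₚ.≤-refl , ℕₚ.≤-refl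
  at-rect y₂ g i u w = i , u , suc w , refl , ℕₚ.≤-refl , n≤1+n w , ℕₚ.≤-reflexive (+-suc u w)

  hessian-zero : ∀ g i u w → (∀ i′ u′ w′ → u ℕ.≤ u′ → w ℕ.≤ w′ → u′ ℕ.+ w′ ℕ.≤ suc (suc (u ℕ.+ w)) → g i′ u′ w′ ≡ 0#) →
    ∀ p q → hessian g i u w p q ≡ 0#
  hessian-zero g i u w h p q with at-rect p (at q g) i u w
  ... | i′ , u′ , w′ , eq , u≤ , w≤ , s≤ with at-rect q g i′ u′ w′
  ...   | i″ , u″ , w″ , eq′ , u≤′ , w≤′ , s≤′ = trans eq (trans eq′
          (h i″ u″ w″ (ℕₚ.≤-trans u≤ u≤′) (ℕₚ.≤-trans w≤ w≤′) (ℕₚ.≤-trans s≤′ (s≤s s≤))))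

  module _ (e : ℕ) (α β : ℕ → Carrier) where

    -- For u > e the order n = u + w - e exceeds w, and the factor C(w, n) of `κ` vanishes.
    coef-vanish-u : ∀ i {u w} → e ℕ.< u → coef e α β i u w ≡ 0#
    coef-vanish-u i {u} {w} e<u = trans (coef-≡ e α β i {u} {w} {t ℕ.+ w} eq)
      (trans (cong (pascal (t ℕ.+ w) α i *_) (κ-vanishʳ e β u w (m<n+m w (m<n⇒0<n∸m e<u)))) (zeroʳ _))
      where
      t = u ℕ.∸ e
      eq : u ℕ.+ w ≡ e ℕ.+ (t ℕ.+ w)
      eq = trans (cong (ℕ._+ w) (sym (m+[n∸m]≡n (<⇒≤ e<u)))) (ℕₚ.+-assoc e t w)

    coef-vanish-w : ∀ i {u w} → e ℕ.< w → coef e α β i u w ≡ 0#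
    coef-vanish-w i {u} {w} e<w = trans (coef-≡ e α β i {u} {w} {t ℕ.+ u} eq)
      (trans (cong (pascal (t ℕ.+ u) α i *_) (κ-vanishˡ e β u w (m<n+m u (m<n⇒0<n∸m e<w)))) (zeroʳ _))
      where
      t = w ℕ.∸ e
      eq : u ℕ.+ w ≡ e ℕ.+ (t ℕ.+ u)
      eq = trans (ℕₚ.+-comm u w) (trans (cong (ℕ._+ u) (sym (m+[n∸m]≡n (<⇒≤ e<w)))) (ℕₚ.+-assoc e t u))

  block-hessian : ∀ g i u w {K₀₀ K₁₀ K₀₁ K₂₀ K₁₁ K₀₂} (h₀ h₁ h₂ : ℕ → Carrier) →
    (∀ j → h₀ j * K₀₀ ≡ g j u w) → (∀ j → h₁ j * K₁₀ ≡ g j (suc u) w) → (∀ j → h₁ j * K₀₁ ≡ g j u (suc w)) →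
    h₂ i * K₂₀ ≡ g i (2 ℕ.+ u) w → h₂ i * K₁₁ ≡ g i (suc u) (suc w) → h₂ i * K₀₂ ≡ g i u (2 ℕ.+ w) →
    ∀ p q → block (h₀ (2 ℕ.+ i)) (h₀ (suc i)) (h₀ i) (h₁ (suc i)) (h₁ i) (h₂ i) K₀₀ K₁₀ K₀₁ K₂₀ K₁₁ K₀₂ p q ≡ hessian g i u w p q
  block-hessian g i u w h₀ h₁ h₂ e₀₀ e₁₀ e₀₁ e₂₀ e₁₁ e₀₂ = λ where
    x₁ x₁ → e₀₀ (2 ℕ.+ i)
    x₁ y₁ → e₀₀ (suc i)
    y₁ x₁ → e₀₀ (suc i)
    y₁ y₁ → e₀₀ i
    x₁ x₂ → e₁₀ (suc i)
    x₂ x₁ → e₁₀ (suc i)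
    x₁ y₂ → e₀₁ (suc i)
    y₂ x₁ → e₀₁ (suc i)
    y₁ x₂ → e₁₀ i
    x₂ y₁ → e₁₀ i
    y₁ y₂ → e₀₁ i
    y₂ y₁ → e₀₁ i
    x₂ x₂ → e₂₀
    x₂ y₂ → e₁₁
    y₂ x₂ → e₁₁
    y₂ y₂ → e₀₂

  -- The discriminant for u + w = e - 1: U = u, W = w, and x, b₀, b₁, b₂ are β at u - 1, u, u + 1, u
  -- + 2. The last hypothesis carries the factor U because for u = 0 there is no entry at u - 1.
  base-discriminant : ∀ {U W x b₀ b₁ b₂} → 0# ≤ U → 0# ≤ W → 0# ≤ b₀ → 0# ≤ b₁ →
    b₀ * b₂ ≤ b₁ * b₁ → U * (x * b₁) ≤ U * (b₀ * b₀) →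
    ((1# + (1# + U)) * W * (b₁ + b₂)) * (b₀ * b₀) + (U * (1# + (1# + W)) * (x + b₀)) * (b₁ * b₁)
    ≤ ((1# + U) * (1# + W) * (b₀ + b₁) + (1# + U) * (1# + W) * (b₀ + b₁)) * (b₁ * b₀)
  base-discriminant {U} {W} {x} {b₀} {b₁} {b₂} 0≤U 0≤W 0≤b₀ 0≤b₁ le₁ le₂ = by-diff
    (0≤+ (0≤+ (0≤* (0≤* (0≤* (0≤+ 0≤1 (0≤+ 0≤1 0≤U)) 0≤W) 0≤b₀) (≤⇒0≤ le₁))
              (0≤* (0≤* (0≤+ 0≤1 (0≤+ 0≤1 0≤W)) 0≤b₁) (≤⇒0≤ le₂)))
         (0≤* (0≤+ 0≤1 0≤1) (0≤* (0≤* 0≤b₀ 0≤b₁) (0≤+ 0≤b₀ 0≤b₁))))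
    (solve 6 (λ U W x b₀ b₁ b₂ → let U₁ = # 1 :+ U ; W₁ = # 1 :+ W ; U₂ = # 1 :+ U₁ ; W₂ = # 1 :+ W₁ in
       (U₂ :* W :* b₀ :* (b₁ :* b₁ :- b₀ :* b₂) :+ W₂ :* b₁ :* (U :* (b₀ :* b₀) :- U :* (x :* b₁)))
         :+ (# 1 :+ # 1) :* (b₀ :* b₁ :* (b₀ :+ b₁))
       := (U₁ :* W₁ :* (b₀ :+ b₁) :+ U₁ :* W₁ :* (b₀ :+ b₁)) :* (b₁ :* b₀)
          :- ((U₂ :* W :* (b₁ :+ b₂)) :* (b₀ :* b₀) :+ (U :* W₂ :* (x :+ b₀)) :* (b₁ :* b₁)))
      refl U W x b₀ b₁ b₂)

  binom-1 : ∀ n → binom n 1 ≡ ι n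
  binom-1 n = cong ι (nC1≡n n)

  κ-0 : ∀ e β u w {j} → e ℕ.∸ w ≡ j → κ e β u w 0 ≡ β j
  κ-0 e β u w refl = trans (cong₂ (λ x y → x * y * β (e ℕ.∸ w)) (binom-0 u) (binom-0 w)) (solve 1 (λ x → # 1 :* # 1 :* x := x) refl (β (e ℕ.∸ w)))

  κ-1 : ∀ e β u w {j} → e ℕ.∸ w ≡ j → κ e β u w 1 ≡ ι u * ι w * (β j + β (suc j))
  κ-1 e β u w refl = cong₂ (λ x y → x * y * pascal 1 β (e ℕ.∸ w)) (binom-1 u) (binom-1 w)

  module _ {α β : ℕ → Carrier} (pα : ∀ i → Pos (α i)) (pβ : ∀ i → Pos (β i)) (lcα : LC α) (lcβ : LC β) where

    private
      0≤β : ∀ i → 0# ≤ β i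
      0≤β i = proj₁ (pβ i)
      a = λ n → pascal n α

    -- The Hessian is nonzero only for u + w - e = n ≥ 0, -1 and -2.
    base≥0 : ∀ i n P Q → let e = Q ℕ.+ (P ℕ.+ n) in Lorentzian (hessian (coef e α β) i (Q ℕ.+ n) (P ℕ.+ n))
    base≥0 i n P Q = Lorentzian-resp
      (block-hessian (coef e α β) i u w (a n) (a (suc n)) (a (2 ℕ.+ n))
        (λ j → sym (coef-≡ e α β j {u} {w} eq))
        (λ j → sym (coef-≡ e α β j {suc u} {w} (+suc e n eq)))
        (λ j → sym (coef-≡ e α β j {u} {suc w} (trans (+-suc u w) (+suc e n eq))))
        (sym (coef-≡ e α β i {2 ℕ.+ u} {w} (+suc e (suc n) (+suc e n eq))))
        (sym (coef-≡ e α β i {suc u} {suc w} (+suc e (suc n) (trans (+-suc u w) (+suc e n eq)))))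
        (sym (coef-≡ e α β i {u} {2 ℕ.+ w} (trans (+-suc u (suc w)) (+suc e (suc n) (trans (+-suc u w) (+suc e n eq)))))))
      (block-Lorentzian
        (pos* (pos* (binom-pos (m≤n+m n Q)) (binom-pos (m≤n+m n P))) (pascal-pos n pβ (e ℕ.∸ w)))
        (pascal-pos (2 ℕ.+ n) pα i) (pascal-LC n lcα 1 (n≤1+n i)) (κ-psd lcβ 0≤β n P Q))
      where
      e = Q ℕ.+ (P ℕ.+ n)
      u = Q ℕ.+ n
      w = P ℕ.+ n
      eq : u ℕ.+ w ≡ e ℕ.+ n
      eq = trans (ℕₚ.+-assoc Q n w) (trans (cong (Q ℕ.+_) (ℕₚ.+-comm n w)) (sym (ℕₚ.+-assoc Q w n)))

    base-1 : ∀ i u w → Lorentzian (hessian (coef (suc (u ℕ.+ w)) α β) i u w)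
    base-1 i u w = Lorentzian-resp
      (block-hessian (coef e α β) i u w (λ _ → 0#) (a 0) (a 1)
        (λ j → trans (zeroˡ 0#) (sym (coef-< e α β j {u} {w} ℕₚ.≤-refl)))
        (λ j → sym (coef-≡ e α β j {suc u} {w} eq))
        (λ j → sym (coef-≡ e α β j {u} {suc w} (trans (+-suc u w) eq)))
        (sym (coef-≡ e α β i {2 ℕ.+ u} {w} (+suc e 0 eq)))
        (sym (coef-≡ e α β i {suc u} {suc w} (+suc e 0 (trans (+-suc u w) eq))))
        (sym (coef-≡ e α β i {u} {2 ℕ.+ w} (trans (+-suc u (suc w)) (+suc e 0 (trans (+-suc u w) eq))))))
      (block-Lorentzian-K₀₀=0 (subst Pos (sym K₁₀) (pβ (suc u))) (proj₁ (pascal-pos 1 pα i))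
        (subst₂ _≤_
          (sym (cong₂ _+_ (cong₂ (λ x y → x * (y * y)) K₂₀ K₀₁) (cong (λ y → κ e β u (2 ℕ.+ w) 1 * (y * y)) K₁₀)))
          (sym (cong₂ (λ x y → (x + x) * y) K₁₁ (cong₂ _*_ K₁₀ K₀₁)))
          (disc u refl)))
      where
      e = suc (u ℕ.+ w)
      eq : suc (u ℕ.+ w) ≡ e ℕ.+ 0
      eq = sym (ℕₚ.+-identityʳ e)
      K₁₀ = κ-0 e β (suc u) w (m+n∸n≡m (suc u) w)
      K₀₁ = κ-0 e β u (suc w) (m+n∸n≡m u w)
      K₂₀ = κ-1 e β (2 ℕ.+ u) w (m+n∸n≡m (suc u) w)
      K₁₁ = κ-1 e β (suc u) (suc w) (m+n∸n≡m u w)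
      Goal : ℕ → Carrier → Set
      Goal u K₀₂ = (ι (2 ℕ.+ u) * ι w * (β (suc u) + β (2 ℕ.+ u))) * (β u * β u) + K₀₂ * (β (suc u) * β (suc u))
        ≤ (ι (suc u) * ι (suc w) * (β u + β (suc u)) + ι (suc u) * ι (suc w) * (β u + β (suc u))) * (β (suc u) * β u)
      disc : ∀ v → u ≡ v → Goal u (κ e β u (2 ℕ.+ w) 1)
      disc zero refl = subst (Goal 0)
        (trans (cong (_* (0# + β 0)) (zeroˡ (ι (2 ℕ.+ w)))) (trans (zeroˡ _) (sym (κ-vanishˡ e β 0 (2 ℕ.+ w) {1} (s≤s z≤n)))))
        (base-discriminant {x = 0#} ≤-refl (0≤ι w) (0≤β 0) (0≤β 1) (lcβ 1 z≤n) (≤-reflexive (trans (zeroˡ _) (sym (zeroˡ _)))))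
      disc (suc v) refl = subst (Goal (suc v))
        (sym (κ-1 e β (suc v) (2 ℕ.+ w) (m+n∸n≡m v w)))
        (base-discriminant {x = β v} (0≤ι (suc v)) (0≤ι w) (0≤β (suc v)) (0≤β (2 ℕ.+ v)) (lcβ 1 (n≤1+n (suc v)))
          (*-monoˡ (0≤ι (suc v)) (lcβ 1 (n≤1+n v))))

    base-2 : ∀ i u w → Lorentzian (hessian (coef (2 ℕ.+ (u ℕ.+ w)) α β) i u w)
    base-2 i u w = Lorentzian-resp
      (block-hessian (coef e α β) i u w (λ _ → 0#) (λ _ → 0#) (a 0)
        (λ j → trans (zeroˡ 0#) (sym (coef-< e α β j {u} {w} (n≤1+n _))))
        (λ j → trans (zeroˡ 0#) (sym (coef-< e α β j {suc u} {w} ℕₚ.≤-refl)))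
        (λ j → trans (zeroˡ 0#) (sym (coef-< e α β j {u} {suc w} (ℕₚ.≤-reflexive (cong suc (+-suc u w))))))
        (sym (coef-≡ e α β i {2 ℕ.+ u} {w} eq))
        (sym (coef-≡ e α β i {suc u} {suc w} (trans (cong suc (+-suc u w)) eq)))
        (sym (coef-≡ e α β i {u} {2 ℕ.+ w} (trans (+-suc u (suc w)) (trans (cong suc (+-suc u w)) eq)))))
      (block-Lorentzian-K₀₀=K₁₀=K₀₁=0 (subst Pos (sym K₂₀) (pβ (2 ℕ.+ u))) (proj₁ (pα i))
        (subst₂ _≤_ (sym (trans (cong₂ _*_ K₂₀ K₀₂) (*-comm _ _))) (sym (cong₂ _*_ K₁₁ K₁₁)) (lcβ 1 (n≤1+n u))))
      where
      e = 2 ℕ.+ (u ℕ.+ w)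
      eq : 2 ℕ.+ (u ℕ.+ w) ≡ e ℕ.+ 0
      eq = sym (ℕₚ.+-identityʳ e)
      K₂₀ = κ-0 e β (2 ℕ.+ u) w (m+n∸n≡m (2 ℕ.+ u) w)
      K₁₁ = κ-0 e β (suc u) (suc w) (m+n∸n≡m (suc u) w)
      K₀₂ = κ-0 e β u (2 ℕ.+ w) (m+n∸n≡m u w)

    coef-Lorentzian : ∀ e i u w → Lorentzian (hessian (coef e α β) i u w)
    coef-Lorentzian e i u w with <-cmp (2 ℕ.+ (u ℕ.+ w)) e
    ... | tri< lt _ _ = Lorentzian-zero (hessian-zero (coef e α β) i u w λ i′ u′ w′ _ _ s≤ → coef-< e α β i′ {u′} {w′} (≤-<-trans s≤ lt))
    ... | tri≈ _ refl _ = base-2 i u w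
    ... | tri> _ _ (s≤s e≤1+s) with m≤n⇒m<n∨m≡n e≤1+s
    ...   | inj₂ refl = base-1 i u w
    ...   | inj₁ (s≤s e≤s) with u ℕ.≤? e | w ℕ.≤? e
    ...     | no u≰e | _ = Lorentzian-zero (hessian-zero (coef e α β) i u w λ i′ u′ w′ u≤ _ _ → coef-vanish-u e α β i′ {u′} {w′} (<-≤-trans (≰⇒> u≰e) u≤))
    ...     | yes _ | no w≰e = Lorentzian-zero (hessian-zero (coef e α β) i u w λ i′ u′ w′ _ w≤ _ → coef-vanish-w e α β i′ {u′} {w′} (<-≤-trans (≰⇒> w≰e) w≤))
    -- Here the subtractions defining n, P and Q are exact, so e, u and w can be rewritten as the
    -- sums that `base≥0` expects.
    ...     | yes u≤e | yes w≤e = reindex e≡ u≡ w≡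
      where
      n = (u ℕ.+ w) ℕ.∸ e
      P = e ℕ.∸ u
      Q = e ℕ.∸ w
      u+w≡e+n : u ℕ.+ w ≡ e ℕ.+ n
      u+w≡e+n = sym (m+[n∸m]≡n e≤s)
      w≡ : w ≡ P ℕ.+ n
      w≡ = +-cancelˡ-≡ u w (P ℕ.+ n) (trans u+w≡e+n (trans (cong (ℕ._+ n) (sym (m+[n∸m]≡n u≤e))) (ℕₚ.+-assoc u P n)))
      u≡ : u ≡ Q ℕ.+ n
      u≡ = +-cancelˡ-≡ w u (Q ℕ.+ n) (trans (ℕₚ.+-comm w u) (trans u+w≡e+n (trans (cong (ℕ._+ n) (sym (m+[n∸m]≡n w≤e))) (ℕₚ.+-assoc w Q n))))
      e≡ : e ≡ Q ℕ.+ (P ℕ.+ n)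
      e≡ = trans (sym (m∸n+n≡m w≤e)) (cong (Q ℕ.+_) w≡)
      reindex : ∀ {e u w} → e ≡ Q ℕ.+ (P ℕ.+ n) → u ≡ Q ℕ.+ n → w ≡ P ℕ.+ n → Lorentzian (hessian (coef e α β) i u w)
      reindex refl refl refl = base≥0 i n P Q

  -- Directional derivatives

  at-comm : ∀ p q g → at p (at q g) ≡ at q (at p g)
  at-comm x₁ x₁ g = refl
  at-comm x₁ y₁ g = refl
  at-comm x₁ x₂ g = refl
  at-comm x₁ y₂ g = refl
  at-comm y₁ x₁ g = refl
  at-comm y₁ y₁ g = refl
  at-comm y₁ x₂ g = refl
  at-comm y₁ y₂ g = refl
  at-comm x₂ x₁ g = refl
  at-comm x₂ y₁ g = refl
  at-comm x₂ x₂ g = refl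
  at-comm x₂ y₂ g = refl
  at-comm y₂ x₁ g = refl
  at-comm y₂ y₁ g = refl
  at-comm y₂ x₂ g = refl
  at-comm y₂ y₂ g = refl

  hessian-sym : ∀ g i u w → Symmetric (hessian g i u w)
  hessian-sym g i u w p q = cong (λ f → f i u w) (at-comm p q g)

  data Axis : Set where
    X Y : Axis

  left right : Axis → Dir
  left X = x₁
  left Y = y₁
  right X = x₂
  right Y = y₂

  -- The derivative along x₁ + x₂ or y₁ + y₂.
  ∂ : Axis → Family → Family
  ∂ A g i u w = at (left A) g i u w + at (right A) g i u w

  at-∂ : ∀ p A g i u w → at p (∂ A g) i u w ≡ ∂ A (at p g) i u w
  at-∂ p A g i u w = trans (at-+ p (at (left A) g) (at (right A) g)) (cong₂ (λ f h → f i u w + h i u w) (at-comm p (left A) g) (at-comm p (right A) g))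
    where
    at-+ : ∀ p (f h : Family) → at p (λ i u w → f i u w + h i u w) i u w ≡ at p f i u w + at p h i u w
    at-+ x₁ f h = refl
    at-+ y₁ f h = refl
    at-+ x₂ f h = refl
    at-+ y₂ f h = refl

  at-cong : ∀ p {f h : Family} → (∀ i u w → f i u w ≡ h i u w) → ∀ i u w → at p f i u w ≡ at p h i u w
  at-cong x₁ e i u w = e (suc i) u w
  at-cong y₁ e i u w = e i u w
  at-cong x₂ e i u w = e i (suc u) w
  at-cong y₂ e i u w = e i u (suc w)

  at-≥0 : ∀ p {g : Family} → (∀ i u w → 0# ≤ g i u w) → ∀ i u w → 0# ≤ at p g i u w
  at-≥0 x₁ h i u w = h (suc i) u w
  at-≥0 y₁ h i u w = h i u w
  at-≥0 x₂ h i u w = h i (suc u) w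
  at-≥0 y₂ h i u w = h i u (suc w)

  hessian-∂ : ∀ A g i u w p q → hessian (at (left A) g) i u w p q + hessian (at (right A) g) i u w p q ≡ hessian (∂ A g) i u w p q
  hessian-∂ A g i u w p q = sym (trans (at-cong p (at-∂ q A g) i u w) (trans (at-∂ p A (at q g) i u w)
    (cong₂ _+_ (move (left A)) (move (right A)))))
    where
    move : ∀ r → at r (at p (at q g)) i u w ≡ at p (at q (at r g)) i u w
    move r = trans (cong (λ f → f i u w) (at-comm r p (at q g))) (cong (λ f → at p f i u w) (at-comm r q g))

  -- `Lorentzian-+` requires the shared column to be nonzero. At the edge of the support it may
  -- vanish; the other two alternatives say that then one summand is zero and the sum is the other.
  ∂-Lorentzian : ∀ A g i u w → (∀ i u w → 0# ≤ g i u w) →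
    Lorentzian (hessian (at (left A) g) i u w) → Lorentzian (hessian (at (right A) g) i u w) →
    ((∃ λ p → hessian (at (left A) g) i u w p (right A) ≢ 0#)
      ⊎ (∀ p q → hessian (at (left A) g) i u w p q ≡ 0#) ⊎ (∀ p q → hessian (at (right A) g) i u w p q ≡ 0#)) →
    Lorentzian (hessian (∂ A g) i u w)
  ∂-Lorentzian A g i u w 0≤g lM lN alt = Lorentzian-resp (hessian-∂ A g i u w) (sum alt)
    where
    M = hessian (at (left A) g) i u w
    N = hessian (at (right A) g) i u w
    sum : _ → Lorentzian (λ p q → M p q + N p q)
    sum (inj₁ nonzero) = Lorentzian-+ (hessian-sym _ i u w) (hessian-sym _ i u w) (right A) (left A)
      (λ p → cong (λ f → at p f i u w) (at-comm (right A) (left A) g))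
      (at-≥0 (right A) (at-≥0 (right A) (at-≥0 (left A) 0≤g)) i u w)
      (at-≥0 (left A) (at-≥0 (left A) (at-≥0 (right A) 0≤g)) i u w) nonzero lM lN
    sum (inj₂ (inj₁ M≡0)) = Lorentzian-resp (λ p q → sym (trans (cong (_+ N p q) (M≡0 p q)) (+-identityˡ _))) lN
    sum (inj₂ (inj₂ N≡0)) = Lorentzian-resp (λ p q → sym (trans (cong (M p q +_) (N≡0 p q)) (+-identityʳ _))) lM

  -- t derivatives have been taken; the support is then
  -- { u ≤ e, w ≤ e, e ≤ t + u + w }.
  record Good (e t : ℕ) (g : Family) : Set where
    field
      nonneg  : ∀ i u w → 0# ≤ g i u w
      support : ∀ i {u w} → u ℕ.≤ e → w ℕ.≤ e → e ℕ.≤ t ℕ.+ (u ℕ.+ w) → Pos (g i u w)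
      zero-u  : ∀ i {u w} → e ℕ.< u → g i u w ≡ 0#
      zero-w  : ∀ i {u w} → e ℕ.< w → g i u w ≡ 0#
      zero-t  : ∀ i {u w} → t ℕ.+ (u ℕ.+ w) ℕ.< e → g i u w ≡ 0#
      lorentzian : ∀ i u w → Lorentzian (hessian g i u w)

  private
    0+0 : ∀ {a b} → a ≡ 0# → b ≡ 0# → a + b ≡ 0#
    0+0 p q = trans (cong₂ _+_ p q) (+-identityˡ 0#)

    ≤+ : ∀ t {a} → a ℕ.≤ t ℕ.+ a
    ≤+ t {a} = m≤n+m a t

  module _ {e t g} (good : Good e t g) where
    open Good good

    Lorentzian-at : ∀ p i u w → Lorentzian (hessian (at p g) i u w)
    Lorentzian-at p i u w = Lorentzian-resp (λ q r → sym (trans (cong (λ f → at q f i u w) (at-comm r p g)) (cong (λ f → f i u w) (at-comm q p (at r g))))) (shifted p)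
      where
      shifted : ∀ p → Lorentzian (λ q r → at p (at q (at r g)) i u w)
      shifted x₁ = lorentzian (suc i) u w
      shifted y₁ = lorentzian i u w
      shifted x₂ = lorentzian i (suc u) w
      shifted y₂ = lorentzian i u (suc w)

    private
      t+suc : ∀ s → t ℕ.+ suc s ≡ suc (t ℕ.+ s)
      t+suc s = +-suc t s

      support-X : ∀ i {u w} → u ℕ.≤ e → w ℕ.≤ e → e ℕ.≤ suc (t ℕ.+ (u ℕ.+ w)) → Pos (∂ X g i u w)
      support-X i {u} {w} u≤e w≤e e≤ with e ℕ.≤? t ℕ.+ (u ℕ.+ w)
      ... | yes e≤′ = pos+ (support (suc i) u≤e w≤e e≤′) (nonneg i (suc u) w)
      ... | no e≰ = +pos (nonneg (suc i) u w) (support i (ℕₚ.≤-trans (s≤s (ℕₚ.≤-trans (m≤m+n u w) (≤+ t))) (≰⇒> e≰)) w≤e (ℕₚ.≤-trans e≤ (ℕₚ.≤-reflexive (sym (t+suc (u ℕ.+ w))))))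

      support-Y : ∀ i {u w} → u ℕ.≤ e → w ℕ.≤ e → e ℕ.≤ suc (t ℕ.+ (u ℕ.+ w)) → Pos (∂ Y g i u w)
      support-Y i {u} {w} u≤e w≤e e≤ with e ℕ.≤? t ℕ.+ (u ℕ.+ w)
      ... | yes e≤′ = pos+ (support i u≤e w≤e e≤′) (nonneg i u (suc w))
      ... | no e≰ = +pos (nonneg i u w) (support i u≤e (ℕₚ.≤-trans (s≤s (ℕₚ.≤-trans (m≤n+m w u) (≤+ t))) (≰⇒> e≰))
                      (ℕₚ.≤-trans e≤ (ℕₚ.≤-reflexive (sym (trans (cong (t ℕ.+_) (+-suc u w)) (t+suc (u ℕ.+ w)))))))

      -- If t + u + w + 1 reaches e, the entry of the shared column in row y₁ lies in the support.
      -- If it falls short by exactly one, a further derivative along x₂ reaches the support, and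
      -- the shortfall itself implies u + 2 ≤ e. If it falls short by more, no second derivative of
      -- ∂x₁ g reaches it.
      alternative-X : ∀ i u w →
        (∃ λ p → hessian (at x₁ g) i u w p x₂ ≢ 0#) ⊎ (∀ p q → hessian (at x₁ g) i u w p q ≡ 0#) ⊎ (∀ p q → hessian (at x₂ g) i u w p q ≡ 0#)
      alternative-X i u w with suc u ℕ.≤? e | w ℕ.≤? e | e ℕ.≤? t ℕ.+ suc (u ℕ.+ w) | e ℕ.≤? t ℕ.+ suc (suc (u ℕ.+ w))
      ... | no ≰ | _ | _ | _ = inj₂ (inj₂ (hessian-zero (at x₂ g) i u w λ i′ u′ w′ u≤ _ _ → zero-u i′ (<-≤-trans (≰⇒> ≰) (s≤s u≤))))
      ... | yes _ | no ≰ | _ | _ = inj₂ (inj₁ (hessian-zero (at x₁ g) i u w λ i′ u′ w′ _ w≤ _ → zero-w (suc i′) (<-≤-trans (≰⇒> ≰) w≤)))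
      ... | yes u<e | yes w≤e | yes e≤ | _ = inj₁ (y₁ , proj₂ (support (suc i) u<e w≤e e≤))
      ... | yes u<e | yes w≤e | no ≰ | yes e≤ = inj₁ (x₂ , proj₂ (support (suc i) (ℕₚ.≤-trans (s≤s (ℕₚ.≤-trans (s≤s (m≤m+n u w)) (≤+ t))) (≰⇒> ≰)) w≤e e≤))
      ... | yes _ | yes _ | no _ | no ≰ = inj₂ (inj₁ (hessian-zero (at x₁ g) i u w λ i′ u′ w′ _ _ s≤ → zero-t (suc i′) (≤-<-trans (+-monoʳ-≤ t s≤) (≰⇒> ≰))))

      alternative-Y : ∀ i u w →
        (∃ λ p → hessian (at y₁ g) i u w p y₂ ≢ 0#) ⊎ (∀ p q → hessian (at y₁ g) i u w p q ≡ 0#) ⊎ (∀ p q → hessian (at y₂ g) i u w p q ≡ 0#)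
      alternative-Y i u w with suc w ℕ.≤? e | u ℕ.≤? e | e ℕ.≤? t ℕ.+ (u ℕ.+ suc w) | e ℕ.≤? t ℕ.+ (u ℕ.+ suc (suc w))
      ... | no ≰ | _ | _ | _ = inj₂ (inj₂ (hessian-zero (at y₂ g) i u w λ i′ u′ w′ _ w≤ _ → zero-w i′ (<-≤-trans (≰⇒> ≰) (s≤s w≤))))
      ... | yes _ | no ≰ | _ | _ = inj₂ (inj₁ (hessian-zero (at y₁ g) i u w λ i′ u′ w′ u≤ _ _ → zero-u i′ (<-≤-trans (≰⇒> ≰) u≤)))
      ... | yes w<e | yes u≤e | yes e≤ | _ = inj₁ (y₁ , proj₂ (support i u≤e w<e e≤))
      ... | yes w<e | yes u≤e | no ≰ | yes e≤ = inj₁ (y₂ , proj₂ (support i u≤e (ℕₚ.≤-trans (s≤s (ℕₚ.≤-trans (m≤n+m (suc w) u) (≤+ t))) (≰⇒> ≰)) e≤))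
      ... | yes _ | yes _ | no _ | no ≰ = inj₂ (inj₁ (hessian-zero (at y₁ g) i u w λ i′ u′ w′ _ _ s≤ → zero-t i′
              (≤-<-trans (+-monoʳ-≤ t (ℕₚ.≤-trans s≤ (ℕₚ.≤-reflexive (sym (trans (+-suc u (suc w)) (cong suc (+-suc u w))))))) (≰⇒> ≰))))

    ∂-Good : ∀ A → Good e (suc t) (∂ A g)
    ∂-Good X = record
      { nonneg = λ i u w → 0≤+ (nonneg (suc i) u w) (nonneg i (suc u) w)
      ; support = support-X
      ; zero-u = λ i e<u → 0+0 (zero-u (suc i) e<u) (zero-u i (m≤n⇒m≤1+n e<u))
      ; zero-w = λ i e<w → 0+0 (zero-w (suc i) e<w) (zero-w i e<w)
      ; zero-t = λ i {u} {w} lt → 0+0 (zero-t (suc i) (ℕₚ.≤-trans (n≤1+n _) lt)) (zero-t i (subst (ℕ._< e) (sym (t+suc (u ℕ.+ w))) lt))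
      ; lorentzian = λ i u w → ∂-Lorentzian X g i u w nonneg (Lorentzian-at x₁ i u w) (Lorentzian-at x₂ i u w) (alternative-X i u w)
      }
    ∂-Good Y = record
      { nonneg = λ i u w → 0≤+ (nonneg i u w) (nonneg i u (suc w))
      ; support = support-Y
      ; zero-u = λ i e<u → 0+0 (zero-u i e<u) (zero-u i e<u)
      ; zero-w = λ i e<w → 0+0 (zero-w i e<w) (zero-w i (m≤n⇒m≤1+n e<w))
      ; zero-t = λ i {u} {w} lt → 0+0 (zero-t i (ℕₚ.≤-trans (n≤1+n _) lt)) (zero-t i (subst (ℕ._< e) (sym (trans (cong (t ℕ.+_) (+-suc u w)) (t+suc (u ℕ.+ w)))) lt))
      ; lorentzian = λ i u w → ∂-Lorentzian Y g i u w nonneg (Lorentzian-at y₁ i u w) (Lorentzian-at y₂ i u w) (alternative-Y i u w)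
      }

  ∂^ : ℕ → ℕ → Family → Family
  ∂^ zero    zero    g = g
  ∂^ zero    (suc b) g = ∂ Y (∂^ zero b g)
  ∂^ (suc a) b       g = ∂ X (∂^ a b g)

  ∂^-Good : ∀ {e g} a b → Good e 0 g → Good e (a ℕ.+ b) (∂^ a b g)
  ∂^-Good zero    zero    good = good
  ∂^-Good zero    (suc b) good = ∂-Good (∂^-Good zero b good) Y
  ∂^-Good (suc a) b       good = ∂-Good (∂^-Good a b good) X

  ∂^-Y : ∀ a b g i u w → ∂^ a (suc b) g i u w ≡ ∂ Y (∂^ a b g) i u w
  ∂^-Y zero    b g i u w = refl
  ∂^-Y (suc a) b g i u w = trans (cong₂ _+_ (∂^-Y a b g (suc i) u w) (∂^-Y a b g i (suc u) w))
    (solve 4 (λ p q r s → (p :+ q) :+ (r :+ s) := (p :+ r) :+ (q :+ s)) refl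
      (∂^ a b g (suc i) u w) (∂^ a b g (suc i) u (suc w)) (∂^ a b g i (suc u) w) (∂^ a b g i (suc u) (suc w)))

  ∂^-logconcave : ∀ {e g} → Good e 0 g → ∀ a b i u w →
    ∂^ (2 ℕ.+ a) b g i u w * ∂^ a (2 ℕ.+ b) g i u w ≤ ∂^ (suc a) (suc b) g i u w * ∂^ (suc a) (suc b) g i u w
  ∂^-logconcave {e} {g} good a b i u w = subst₂ _≤_ (cong₂ _*_ XX YY) (cong₂ _*_ XY XY) le
    where
    f = ∂^ a b g
    H = hessian f i u w
    open Good (∂^-Good a b good)
    vX vY : Vect
    vX x₁ = 1#
    vX y₁ = 0#
    vX x₂ = 1#
    vX y₂ = 0#
    vY x₁ = 0#
    vY y₁ = 1#
    vY x₂ = 0#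
    vY y₂ = 1#
    sel : ∀ a b c d → (1# * a + 0# * b) + (1# * c + 0# * d) ≡ a + c
    sel = solve 4 (λ a b c d → (# 1 :* a :+ # 0 :* b) :+ (# 1 :* c :+ # 0 :* d) := a :+ c) refl
    sel′ : ∀ a b c d → (0# * a + 1# * b) + (0# * c + 1# * d) ≡ b + d
    sel′ = solve 4 (λ a b c d → (# 0 :* a :+ # 1 :* b) :+ (# 0 :* c :+ # 1 :* d) := b :+ d) refl
    XX : form H vX vX ≡ ∂^ (2 ℕ.+ a) b g i u w
    XX = trans (sel _ _ _ _) (cong₂ _+_ (sel _ _ _ _) (sel _ _ _ _))
    XY : form H vX vY ≡ ∂^ (suc a) (suc b) g i u w
    XY = trans (sel _ _ _ _) (trans (cong₂ _+_ (sel′ _ _ _ _) (sel′ _ _ _ _)) (sym (cong₂ _+_ (∂^-Y a b g (suc i) u w) (∂^-Y a b g i (suc u) w))))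
    YY : form H vY vY ≡ ∂^ a (2 ℕ.+ b) g i u w
    YY = trans (sel′ _ _ _ _) (trans (cong₂ _+_ (sel′ _ _ _ _) (sel′ _ _ _ _))
      (sym (trans (∂^-Y a (suc b) g i u w) (cong₂ _+_ (∂^-Y a b g i u w) (∂^-Y a b g i u (suc w))))))
    0≤YY : 0# ≤ form H vY vY
    0≤YY = subst (0# ≤_) (sym (trans (sel′ _ _ _ _) (cong₂ _+_ (sel′ _ _ _ _) (sel′ _ _ _ _))))
      (0≤+ (0≤+ (nonneg i u w) (nonneg i u (suc w))) (0≤+ (nonneg i u (suc w)) (nonneg i u (suc (suc w)))))
    le : form H vX vX * form H vY vY ≤ form H vX vY * form H vX vY
    le with form H vY vY ≟ 0#
    ... | yes YY≡0 = subst (_≤ form H vX vY * form H vX vY) (sym (trans (cong (form H vX vX *_) YY≡0) (zeroʳ _))) (sq≥0 (form H vX vY))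
    ... | no YY≢0 = reverse-cauchy-schwarz (hessian-sym f i u w) (lorentzian i u w) vX vY (0≤YY , YY≢0)

  coef-Good : ∀ {α β} → (∀ i → Pos (α i)) → (∀ i → Pos (β i)) → LC α → LC β → ∀ e → Good e 0 (coef e α β)
  coef-Good {α} {β} pα pβ lcα lcβ e = record
    { nonneg = nonneg
    ; support = support
    ; zero-u = λ i {u} {w} → coef-vanish-u e α β i {u} {w}
    ; zero-w = λ i {u} {w} → coef-vanish-w e α β i {u} {w}
    ; zero-t = λ i {u} {w} → coef-< e α β i {u} {w}
    ; lorentzian = coef-Lorentzian pα pβ lcα lcβ e
    }
    where
    0≤κ : ∀ u w n → 0# ≤ κ e β u w n
    0≤κ u w n = 0≤* (0≤* (binom-nonneg u n) (binom-nonneg w n)) (proj₁ (pascal-pos n pβ (e ℕ.∸ w)))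
    nonneg : ∀ i u w → 0# ≤ coef e α β i u w
    nonneg i u w with e ℕ.≤? u ℕ.+ w
    ... | yes e≤ = subst (0# ≤_) (sym (coef-≡ e α β i {u} {w} (sym (m+[n∸m]≡n e≤)))) (0≤* (proj₁ (pascal-pos ((u ℕ.+ w) ℕ.∸ e) pα i)) (0≤κ u w ((u ℕ.+ w) ℕ.∸ e)))
    ... | no e≰ = subst (0# ≤_) (sym (coef-< e α β i {u} {w} (≰⇒> e≰))) ≤-refl
    support : ∀ i {u w} → u ℕ.≤ e → w ℕ.≤ e → e ℕ.≤ u ℕ.+ w → Pos (coef e α β i u w)
    support i {u} {w} u≤e w≤e e≤ = subst Pos (sym (coef-≡ e α β i {u} {w} (sym (m+[n∸m]≡n e≤))))
      (pos* (pascal-pos n pα i) (pos* (pos* (binom-pos n≤u) (binom-pos n≤w)) (pascal-pos n pβ (e ℕ.∸ w))))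
      where
      n = (u ℕ.+ w) ℕ.∸ e
      n≤u : n ℕ.≤ u
      n≤u = m≤n+o⇒m∸n≤o (u ℕ.+ w) e (subst (u ℕ.+ w ℕ.≤_) (ℕₚ.+-comm u e) (+-monoʳ-≤ u w≤e))
      n≤w : n ℕ.≤ w
      n≤w = m≤n+o⇒m∸n≤o (u ℕ.+ w) e (ℕₚ.+-monoˡ-≤ w u≤e)

  -- Perturbation to positive sequences

  Bounded : (Carrier → Carrier) → Set
  Bounded ψ = ∃ λ K → ∀ ε → 0# ≤ ε → ε ≤ 1# → (- K ≤ ψ ε) × (ψ ε ≤ K)

  bounded-const : ∀ c → Bounded (λ _ → c)
  bounded-const c with total 0# c
  ... | inj₁ 0≤c = c , λ _ _ _ → ≤-trans (neg≤0 0≤c) 0≤c , ≤-refl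
  ... | inj₂ c≤0 = - c , λ _ _ _ → ≤-reflexive (solve 1 (λ c → :- (:- c) := c) refl c) , ≤-trans c≤0 (≤0⇒0≤neg c≤0)

  bounded-id : Bounded (λ ε → ε)
  bounded-id = 1# , λ ε 0≤ε ε≤1 → ≤-trans (neg≤0 0≤1) 0≤ε , ε≤1

  bounded-+ : ∀ {φ ψ} → Bounded φ → Bounded ψ → Bounded (λ ε → φ ε + ψ ε)
  bounded-+ (K , h) (L , k) = K + L , λ ε p q →
    subst (_≤ _) (solve 2 (λ a b → (:- a) :+ (:- b) := :- (a :+ b)) refl K L) (+-mono (proj₁ (h ε p q)) (proj₁ (k ε p q))) ,
    +-mono (proj₂ (h ε p q)) (proj₂ (k ε p q))

  -- (K - x)(L - y) + (K + x)(L + y) = 2(KL + xy) is nonnegative, and likewise with the sign of y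
  -- changed; this avoids absolute values.
  bounded-* : ∀ {φ ψ} → Bounded φ → Bounded ψ → Bounded (λ ε → φ ε * ψ ε)
  bounded-* {φ} {ψ} (K , h) (L , k) = K * L , λ ε p q → let x = φ ε ; y = ψ ε ; (h₁ , h₂) = h ε p q ; (k₁ , k₂) = k ε p q in
    halve (by-diff (0≤+ (0≤* (≤⇒0≤ h₂) (≤⇒0≤ k₂)) (0≤* (≤⇒0≤ h₁) (≤⇒0≤ k₁)))
      (solve 4 (λ K L x y → (K :- x) :* (L :- y) :+ (x :- (:- K)) :* (y :- (:- L)) := (x :* y :+ x :* y) :- ((:- (K :* L)) :+ (:- (K :* L)))) refl K L x y)) ,
    halve (by-diff (0≤+ (0≤* (≤⇒0≤ h₂) (≤⇒0≤ k₁)) (0≤* (≤⇒0≤ h₁) (≤⇒0≤ k₂)))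
      (solve 4 (λ K L x y → (K :- x) :* (y :- (:- L)) :+ (x :- (:- K)) :* (L :- y) := (K :* L :+ K :* L) :- (x :* y :+ x :* y)) refl K L x y))
    where
    halve : ∀ {a b} → a + a ≤ b + b → a ≤ b
    halve {a} {b} le = cancel-≤ˡ (pos+ 1-pos 0≤1) (subst₂ _≤_ (double a) (double b) le)
      where
      double : ∀ a → a + a ≡ (1# + 1#) * a
      double = solve 1 (λ a → a :+ a := (# 1 :+ # 1) :* a) refl

  -- φ ε → c as ε → 0⁺, at linear speed.
  infix 4 _⟶_
  _⟶_ : (Carrier → Carrier) → Carrier → Set
  φ ⟶ c = Σ (Carrier → Carrier) λ ψ → Bounded ψ × (∀ ε → φ ε ≡ c + ε * ψ ε)

  ⟶-const : ∀ c → (λ _ → c) ⟶ c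
  ⟶-const c = (λ _ → 0#) , bounded-const 0# , solve 2 (λ c ε → c := c :+ ε :* # 0) refl c

  ⟶-id : (λ ε → ε) ⟶ 0#
  ⟶-id = (λ _ → 1#) , bounded-const 1# , solve 1 (λ ε → ε := # 0 :+ ε :* # 1) refl

  ⟶-+ : ∀ {φ ψ c d} → φ ⟶ c → ψ ⟶ d → (λ ε → φ ε + ψ ε) ⟶ c + d
  ⟶-+ {c = c} {d} (φ′ , bφ , eφ) (ψ′ , bψ , eψ) = _ , bounded-+ bφ bψ , λ ε → trans (cong₂ _+_ (eφ ε) (eψ ε))
    (solve 5 (λ c d ε x y → (c :+ ε :* x) :+ (d :+ ε :* y) := (c :+ d) :+ ε :* (x :+ y)) refl c d ε (φ′ ε) (ψ′ ε))

  ⟶-* : ∀ {φ ψ c d} → φ ⟶ c → ψ ⟶ d → (λ ε → φ ε * ψ ε) ⟶ c * d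
  ⟶-* {c = c} {d} (φ′ , bφ , eφ) (ψ′ , bψ , eψ) = _ ,
    bounded-+ (bounded-+ (bounded-* (bounded-const c) bψ) (bounded-* bφ (bounded-const d))) (bounded-* bounded-id (bounded-* bφ bψ)) ,
    λ ε → trans (cong₂ _*_ (eφ ε) (eψ ε))
    (solve 5 (λ c d ε x y → (c :+ ε :* x) :* (d :+ ε :* y) := c :* d :+ ε :* ((c :* y :+ x :* d) :+ ε :* (x :* y))) refl c d ε (φ′ ε) (ψ′ ε))

  ⟶-≥0 : ∀ {φ c} → φ ⟶ c → (∀ ε → Pos ε → ε ≤ 1# → 0# ≤ φ ε) → 0# ≤ c
  ⟶-≥0 {φ} {c} (ψ , (K , b) , eq) 0≤φ with total 0# c
  ... | inj₁ 0≤c = 0≤c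
  ... | inj₂ c≤0 with c ≟ 0#
  ...   | yes c≡0 = ≤-reflexive (sym c≡0)
  ...   | no c≢0 = ⊥-elim (*-≢0 c≢0 (proj₂ p1-c) (≤-antisym (subst (_≤ 0#) (*-comm _ _) (subst (_ ≤_) (zeroʳ _) (*-monoˡ (proj₁ p1-c) c≤0))) contra))
    where
    0≤K : 0# ≤ K
    0≤K with total 0# K
    ... | inj₁ p = p
    ... | inj₂ p = ≤-trans (≤0⇒0≤neg p) (≤-trans (proj₁ (b 0# ≤-refl 0≤1)) (proj₂ (b 0# ≤-refl 0≤1)))
    p-c : Pos (- c)
    p-c = ≤0⇒0≤neg c≤0 , λ h → c≢0 (trans (solve 1 (λ c → c := :- (:- c)) refl c) (trans (cong -_ h) (solve 0 (:- # 0 := # 0) refl)))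
    p1-c : Pos (1# + - c)
    p1-c = pos+ 1-pos (proj₁ p-c)
    -- ε = -c / (K + 1 - c) makes c + ε K negative.
    D = K + (1# + - c)
    pD : Pos D
    pD = +pos 0≤K p1-c
    ε = - c * D ⁻¹
    εD : D * ε ≡ - c
    εD = trans (solve 3 (λ D c i → D :* (c :* i) := c :* (D :* i)) refl D (- c) (D ⁻¹)) (trans (cong (- c *_) (⁻¹-inverse D (proj₂ pD))) (*-identityʳ _))
    0≤ε : 0# ≤ ε
    0≤ε = 0≤* (proj₁ p-c) (inv-nonneg (proj₁ pD))
    ε≤1 : ε ≤ 1#
    ε≤1 = cancel-≤ˡ pD (subst₂ _≤_ (sym εD) (sym (*-identityʳ D)) (by-diff (0≤+ 0≤K 0≤1) (solve 2 (λ K c → K :+ # 1 := (K :+ (# 1 :- c)) :- (:- c)) refl K c)))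
    pε : Pos ε
    pε = 0≤ε , λ h → proj₂ p-c (trans (sym εD) (trans (cong (D *_) h) (zeroʳ D)))
    contra : 0# ≤ c * (1# + - c)
    contra = subst (0# ≤_)
      (trans (solve 4 (λ D c ε K → D :* (c :+ ε :* K) := c :* D :+ (D :* ε) :* K) refl D c ε K)
        (trans (cong (λ x → c * D + x * K) εD) (solve 2 (λ c K → c :* (K :+ (# 1 :- c)) :+ (:- c) :* K := c :* (# 1 :- c)) refl c K)))
      (0≤* (proj₁ pD) (≤-trans (0≤φ ε pε ε≤1) (subst (_≤ c + ε * K) (sym (eq ε)) (+-mono ≤-refl (*-monoˡ 0≤ε (proj₂ (b ε 0≤ε ε≤1)))))))

  ⟶-mono : ∀ {φ ψ c d} → φ ⟶ c → ψ ⟶ d → (∀ ε → Pos ε → ε ≤ 1# → φ ε ≤ ψ ε) → c ≤ d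
  ⟶-mono {c = c} {d} hφ hψ le = by-diff
    (⟶-≥0 (⟶-+ hψ (⟶-* (⟶-const (- 1#)) hφ)) λ ε p q → subst (0# ≤_) (minus _ _) (≤⇒0≤ (le ε p q)))
    (sym (minus d c))
    where
    minus : ∀ x y → x + - y ≡ x + - 1# * y
    minus = solve 2 (λ x y → x :- y := x :+ (:- # 1) :* y) refl

  -- The operator (1 + εE)ˢ. It carries a positive entry at s down to index 0, from where
  -- `geometric` spreads it to all larger indices; both operations preserve log-concavity.
  smear : Carrier → ℕ → (ℕ → Carrier) → (ℕ → Carrier)
  smear ε zero    x i = x i
  smear ε (suc s) x i = smear ε s x i + ε * smear ε s x (suc i)

  smear-nonneg : ∀ {ε x} → 0# ≤ ε → (∀ i → 0# ≤ x i) → ∀ s i → 0# ≤ smear ε s x i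
  smear-nonneg 0≤ε 0≤x zero    i = 0≤x i
  smear-nonneg 0≤ε 0≤x (suc s) i = 0≤+ (smear-nonneg 0≤ε 0≤x s i) (0≤* 0≤ε (smear-nonneg 0≤ε 0≤x s (suc i)))

  smear-LC : ∀ {ε x} → 0# ≤ ε → LC x → ∀ s → LC (smear ε s x)
  smear-LC 0≤ε lc zero    = lc
  smear-LC 0≤ε lc (suc s) = LC-+shift _ 0≤ε (smear-LC 0≤ε lc s)

  smear-pos : ∀ {ε x} → Pos ε → (∀ i → 0# ≤ x i) → ∀ s i → Pos (x (s ℕ.+ i)) → Pos (smear ε s x i)
  smear-pos pε 0≤x zero    i p = p
  smear-pos {x = x} pε 0≤x (suc s) i p = +pos (smear-nonneg (proj₁ pε) 0≤x s i)
    (pos* pε (smear-pos pε 0≤x s (suc i) (subst (λ j → Pos (x j)) (sym (+-suc s i)) p)))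

  -- Log-concave and positive on all of ℕ as soon as ε > 0 and xₛ > 0.
  perturb : ℕ → (ℕ → Carrier) → Carrier → (ℕ → Carrier)
  perturb s x ε = geometric ε (smear ε s x)

  perturb-pos : ∀ {s x} → (∀ i → 0# ≤ x i) → Pos (x s) → ∀ ε → Pos ε → ∀ i → Pos (perturb s x ε i)
  perturb-pos {s} {x} 0≤x p ε pε = geometric-pos pε (smear-nonneg (proj₁ pε) 0≤x s)
    (smear-pos pε 0≤x s 0 (subst (λ j → Pos (x j)) (sym (ℕₚ.+-identityʳ s)) p))

  perturb-LC : ∀ {s x} → (∀ i → 0# ≤ x i) → LC x → ∀ ε → 0# ≤ ε → LC (perturb s x ε)
  perturb-LC {s} 0≤x lc ε 0≤ε = geometric-LC 0≤ε (smear-nonneg 0≤ε 0≤x s) (smear-LC 0≤ε lc s)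

  private
    ⟶-+ε* : ∀ {φ ψ c d} → φ ⟶ c → ψ ⟶ d → (λ ε → φ ε + ε * ψ ε) ⟶ c
    ⟶-+ε* {φ} {ψ} {c} {d} hφ hψ = subst ((λ ε → φ ε + ε * ψ ε) ⟶_) (solve 2 (λ c d → c :+ # 0 :* d := c) refl c d) (⟶-+ hφ (⟶-* ⟶-id hψ))

  smear-⟶ : ∀ s x i → (λ ε → smear ε s x i) ⟶ x i
  smear-⟶ zero    x i = ⟶-const (x i)
  smear-⟶ (suc s) x i = ⟶-+ε* (smear-⟶ s x i) (smear-⟶ s x (suc i))

  perturb-⟶ : ∀ s x i → (λ ε → perturb s x ε i) ⟶ x i
  perturb-⟶ s x zero    = smear-⟶ s x 0
  perturb-⟶ s x (suc i) = ⟶-+ε* (smear-⟶ s x (suc i)) (perturb-⟶ s x i)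

  pascal-⟶ : ∀ {ξ : Carrier → ℕ → Carrier} {x : ℕ → Carrier} → (∀ i → (λ ε → ξ ε i) ⟶ x i) → ∀ n i → (λ ε → pascal n (ξ ε) i) ⟶ pascal n x i
  pascal-⟶         h zero    i = h i
  pascal-⟶ {ξ} {x} h (suc n) i = ⟶-+ (pascal-⟶ {ξ} {x} h n i) (pascal-⟶ {ξ} {x} h n (suc i))

  above-⟶ : ∀ {F : Carrier → ℕ → Carrier} {f : ℕ → Carrier} → (∀ n → (λ ε → F ε n) ⟶ f n) → ∀ e s → (λ ε → above e s (F ε)) ⟶ above e s f
  above-⟶         h zero    s       = h s
  above-⟶         h (suc e) zero    = ⟶-const 0#
  above-⟶ {F} {f} h (suc e) (suc s) = above-⟶ {F} {f} h e s

  ∂^-⟶ : ∀ {F : Carrier → Family} {g : Family} → (∀ i u w → (λ ε → F ε i u w) ⟶ g i u w) → ∀ a b i u w → (λ ε → ∂^ a b (F ε) i u w) ⟶ ∂^ a b g i u w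
  ∂^-⟶         h zero    zero    i u w = h i u w
  ∂^-⟶ {F} {g} h zero    (suc b) i u w = ⟶-+ (∂^-⟶ {F} {g} h zero b i u w) (∂^-⟶ {F} {g} h zero b i u (suc w))
  ∂^-⟶ {F} {g} h (suc a) b       i u w = ⟶-+ (∂^-⟶ {F} {g} h a b (suc i) u w) (∂^-⟶ {F} {g} h a b i (suc u) w)

  coef-⟶ : ∀ {ξ η : Carrier → ℕ → Carrier} {x y : ℕ → Carrier} → (∀ i → (λ ε → ξ ε i) ⟶ x i) → (∀ i → (λ ε → η ε i) ⟶ y i) →
    ∀ e i u w → (λ ε → coef e (ξ ε) (η ε) i u w) ⟶ coef e x y i u w
  coef-⟶ {ξ} {η} {x} {y} hx hy e i u w = above-⟶ {λ ε n → pascal n (ξ ε) i * κ e (η ε) u w n} {λ n → pascal n x i * κ e y u w n}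
    (λ n → ⟶-* (pascal-⟶ {ξ} {x} hx n i) (⟶-* (⟶-const (binom u n * binom w n)) (pascal-⟶ {η} {y} hy n (e ℕ.∸ w)))) e (u ℕ.+ w)

  -- The value at the origin of (∂x₁ + ∂x₂)ᵃ (∂y₁ + ∂y₂)ᵇ f. For a + b = d + e this is, up to the
  -- constant d! e!, a! b! times the coefficient of xᵃ yᵇ in f(x,y,x,y).
  mixed : ℕ → (α β : ℕ → Carrier) → ℕ → ℕ → Carrier
  mixed e α β a b = ∂^ a b (coef e α β) 0 0 0

  mixed-logconcave : ∀ {e α β} → (∀ i → 0# ≤ α i) → (∀ i → 0# ≤ β i) → LC α → LC β →
    (∃ λ s → α s ≢ 0#) → (∃ λ s → β s ≢ 0#) →
    ∀ a b → mixed e α β (2 ℕ.+ a) b * mixed e α β a (2 ℕ.+ b) ≤ mixed e α β (suc a) (suc b) * mixed e α β (suc a) (suc b)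
  mixed-logconcave {e} {α} {β} 0≤α 0≤β lcα lcβ (s , αs) (r , βr) a b =
    ⟶-mono (⟶-* (lim (2 ℕ.+ a) b) (lim a (2 ℕ.+ b))) (⟶-* (lim (suc a) (suc b)) (lim (suc a) (suc b)))
      λ ε pε _ → ∂^-logconcave (coef-Good (perturb-pos {s} 0≤α (0≤α s , αs) ε pε) (perturb-pos {r} 0≤β (0≤β r , βr) ε pε)
        (perturb-LC {s} 0≤α lcα ε (proj₁ pε)) (perturb-LC {r} 0≤β lcβ ε (proj₁ pε)) e) a b 0 0 0
    where
    lim : ∀ a b → (λ ε → mixed e (perturb s α ε) (perturb r β ε) a b) ⟶ mixed e α β a b
    lim a b = ∂^-⟶ {λ ε → coef e (perturb s α ε) (perturb r β ε)} {coef e α β}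
      (coef-⟶ {perturb s α} {perturb r β} {α} {β} (perturb-⟶ s α) (perturb-⟶ r β) e) a b 0 0 0

  -- Finite sums

  ∑ : ℕ → (ℕ → Carrier) → Carrier
  ∑ = sumTo R

  ∑-cong : ∀ n {f g : ℕ → Carrier} → (∀ i → i ℕ.< n → f i ≡ g i) → ∑ n f ≡ ∑ n g
  ∑-cong zero    h = refl
  ∑-cong (suc n) h = cong₂ _+_ (∑-cong n (λ i i<n → h i (m≤n⇒m≤1+n i<n))) (h n ℕₚ.≤-refl)

  ∑-+ : ∀ n f g → ∑ n (λ i → f i + g i) ≡ ∑ n f + ∑ n g
  ∑-+ zero    f g = sym (+-identityˡ 0#)
  ∑-+ (suc n) f g = cong (_+ (f n + g n)) (∑-+ n f g)
    · solve 4 (λ a b c d → (a :+ b) :+ (c :+ d) := (a :+ c) :+ (b :+ d)) refl (∑ n f) (∑ n g) (f n) (g n)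

  ∑-* : ∀ n c f → ∑ n (λ i → c * f i) ≡ c * ∑ n f
  ∑-* zero    c f = sym (zeroʳ c)
  ∑-* (suc n) c f = cong (_+ c * f n) (∑-* n c f) · sym (distribˡ c (∑ n f) (f n))

  ∑-zero : ∀ n {f : ℕ → Carrier} → (∀ i → i ℕ.< n → f i ≡ 0#) → ∑ n f ≡ 0#
  ∑-zero zero    h = refl
  ∑-zero (suc n) h = cong₂ _+_ (∑-zero n (λ i i<n → h i (m≤n⇒m≤1+n i<n))) (h n ℕₚ.≤-refl) · +-identityˡ 0#

  ∑-head : ∀ n f → ∑ (suc n) f ≡ f 0 + ∑ n (λ i → f (suc i))
  ∑-head zero    f = +-comm 0# (f 0)
  ∑-head (suc n) f = cong (_+ f (suc n)) (∑-head n f) · +-assoc (f 0) (∑ n (λ i → f (suc i))) (f (suc n))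

  ∑-nonneg : ∀ n {f : ℕ → Carrier} → (∀ i → 0# ≤ f i) → 0# ≤ ∑ n f
  ∑-nonneg zero    h = ≤-refl
  ∑-nonneg (suc n) h = 0≤+ (∑-nonneg n h) (h n)

  ∑-pos : ∀ n {f : ℕ → Carrier} → (∀ i → 0# ≤ f i) → ∀ {i} → i ℕ.< n → Pos (f i) → Pos (∑ n f)
  ∑-pos (suc n) h {i} (s≤s i≤n) p with m≤n⇒m<n∨m≡n i≤n
  ... | inj₁ i<n  = pos+ (∑-pos n h i<n p) (h n)
  ... | inj₂ refl = +pos (∑-nonneg n h) p

  -- The sum over s + r = n with both indices at hand, so that convolutions need no truncated
  -- subtraction.
  splitSum : ℕ → (ℕ → ℕ → Carrier) → Carrier
  splitSum zero    F = F 0 0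
  splitSum (suc n) F = F 0 (suc n) + splitSum n (λ s r → F (suc s) r)

  splitSum-cong : ∀ n {F G : ℕ → ℕ → Carrier} → (∀ s r → s ℕ.+ r ≡ n → F s r ≡ G s r) → splitSum n F ≡ splitSum n G
  splitSum-cong zero    h = h 0 0 refl
  splitSum-cong (suc n) h = cong₂ _+_ (h 0 (suc n) refl) (splitSum-cong n (λ s r e → h (suc s) r (cong suc e)))

  splitSum-last : ∀ n (F : ℕ → ℕ → Carrier) → splitSum (suc n) F ≡ splitSum n (λ s r → F s (suc r)) + F (suc n) 0
  splitSum-last zero    F = refl
  splitSum-last (suc n) F = cong (F 0 (suc (suc n)) +_) (splitSum-last n (λ s r → F (suc s) r)) · sym (+-assoc _ _ _)

  splitSum-+ : ∀ n (F G : ℕ → ℕ → Carrier) → splitSum n (λ s r → F s r + G s r) ≡ splitSum n F + splitSum n G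
  splitSum-+ zero    F G = refl
  splitSum-+ (suc n) F G = cong ((F 0 (suc n) + G 0 (suc n)) +_) (splitSum-+ n _ _)
    · solve 4 (λ a b c d → (a :+ b) :+ (c :+ d) := (a :+ c) :+ (b :+ d)) refl (F 0 (suc n)) (G 0 (suc n)) _ _

  splitSum-* : ∀ n c (F : ℕ → ℕ → Carrier) → splitSum n (λ s r → c * F s r) ≡ c * splitSum n F
  splitSum-* zero    c F = refl
  splitSum-* (suc n) c F = cong (c * F 0 (suc n) +_) (splitSum-* n c _) · sym (distribˡ c _ _)

  splitSum-∑ : ∀ n m (F : ℕ → ℕ → ℕ → Carrier) → splitSum n (λ s r → ∑ m (F s r)) ≡ ∑ m (λ i → splitSum n (λ s r → F s r i))
  splitSum-∑ zero    m F = refl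
  splitSum-∑ (suc n) m F = cong (∑ m (F 0 (suc n)) +_) (splitSum-∑ n m (λ s r → F (suc s) r)) · sym (∑-+ m _ _)

  -- One step of the binomial theorem for two commuting shifts: Pascal's rule splits the weights,
  -- and the surplus term has weight C(n, n + 1) = 0.
  splitSum-binom : ∀ n (F : ℕ → ℕ → Carrier) → splitSum (suc n) (λ s r → binom (suc n) s * F s r)
    ≡ splitSum n (λ s r → binom n s * F (suc s) r) + splitSum n (λ s r → binom n s * F s (suc r))
  splitSum-binom n F = begin
    binom (suc n) 0 * F 0 (suc n) + splitSum n (λ s r → binom (suc n) (suc s) * F (suc s) r)
      ≡⟨ cong (binom (suc n) 0 * F 0 (suc n) +_) (splitSum-cong n (λ s r _ → cong (_* F (suc s) r) (binom-pascal n s) · distribʳ (F (suc s) r) (binom n s) (binom n (suc s))) · splitSum-+ n _ _) ⟩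
    binom n 0 * F 0 (suc n) + (A + splitSum n (λ s r → binom n (suc s) * F (suc s) r))
      ≡⟨ solve 3 (λ a b c → a :+ (b :+ c) := b :+ (a :+ c)) refl (binom n 0 * F 0 (suc n)) A _ ⟩
    A + splitSum (suc n) (λ s r → binom n s * F s r)
      ≡⟨ cong (A +_) (splitSum-last n (λ s r → binom n s * F s r)) ⟩
    A + (splitSum n (λ s r → binom n s * F s (suc r)) + binom n (suc n) * F (suc n) 0)
      ≡⟨ cong (A +_) (cong (splitSum n (λ s r → binom n s * F s (suc r)) +_) (cong (_* F (suc n) 0) (binom-> (n<1+n n)) · zeroˡ _) · +-identityʳ _) ⟩
    A + splitSum n (λ s r → binom n s * F s (suc r)) ∎
    where
    open ≡-Reasoning
    A = splitSum n (λ s r → binom n s * F (suc s) r)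

  ∂^0-splitSum : ∀ b g i u w → ∂^ 0 b g i u w ≡ splitSum b (λ j r → binom b j * g i u (r ℕ.+ w))
  ∂^0-splitSum zero    g i u w = sym (cong (_* g i u w) (binom-0 0) · *-identityˡ _)
  ∂^0-splitSum (suc b) g i u w = cong₂ _+_ (∂^0-splitSum b g i u w)
      (∂^0-splitSum b g i u (suc w) · splitSum-cong b (λ j r _ → cong (λ v → binom b j * g i u v) (+-suc r w)))
    · sym (splitSum-binom b (λ j r → g i u (r ℕ.+ w)))

  ∂^-splitSum : ∀ a b g i u w → ∂^ a b g i u w ≡ splitSum a (λ s r → binom a s * splitSum b (λ j v → binom b j * g (s ℕ.+ i) (r ℕ.+ u) (v ℕ.+ w)))
  ∂^-splitSum zero    b g i u w = ∂^0-splitSum b g i u w · sym (cong (_* splitSum b (λ j v → binom b j * g i u (v ℕ.+ w))) (binom-0 0) · *-identityˡ _)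
  ∂^-splitSum (suc a) b g i u w = cong₂ _+_
      (∂^-splitSum a b g (suc i) u w · splitSum-cong a (λ s r _ → cong (λ k → binom a s * splitSum b (λ j v → binom b j * g k (r ℕ.+ u) (v ℕ.+ w))) (+-suc s i)))
      (∂^-splitSum a b g i (suc u) w · splitSum-cong a (λ s r _ → cong (λ k → binom a s * splitSum b (λ j v → binom b j * g (s ℕ.+ i) k (v ℕ.+ w))) (+-suc r u)))
    · sym (splitSum-binom a (λ s r → splitSum b (λ j v → binom b j * g (s ℕ.+ i) (r ℕ.+ u) (v ℕ.+ w))))

  -- Multiplication by xʲ: f (k ∸ j), but 0# when k < j.
  sh : ℕ → (ℕ → Carrier) → (ℕ → Carrier)
  sh zero    f k       = f k
  sh (suc j) f zero    = 0#
  sh (suc j) f (suc k) = sh j f k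

  sh-+ : ∀ j f k → sh j f (j ℕ.+ k) ≡ f k
  sh-+ zero    f k = refl
  sh-+ (suc j) f k = sh-+ j f k

  sh-< : ∀ {j k} f → k ℕ.< j → sh j f k ≡ 0#
  sh-< {suc j} {zero}  f _         = refl
  sh-< {suc j} {suc k} f (s≤s k<j) = sh-< f k<j

  sh-cong : ∀ j {f g : ℕ → Carrier} → (∀ k → f k ≡ g k) → ∀ k → sh j f k ≡ sh j g k
  sh-cong zero    h k       = h k
  sh-cong (suc j) h zero    = refl
  sh-cong (suc j) h (suc k) = sh-cong j h k

  sh-nonneg : ∀ j {f : ℕ → Carrier} → (∀ k → 0# ≤ f k) → ∀ k → 0# ≤ sh j f k
  sh-nonneg zero    h k       = h k
  sh-nonneg (suc j) h zero    = ≤-refl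
  sh-nonneg (suc j) h (suc k) = sh-nonneg j h k

  -- `sh j (binom n)` lists the coefficients of xʲ (1 + x)ⁿ, here multiplied by 1 + x.
  sh-binom-suc : ∀ j n k → sh j (binom (suc n)) k ≡ sh j (binom n) k + sh (suc j) (binom n) k
  sh-binom-suc zero    n zero    = sym (+-identityʳ _)
  sh-binom-suc zero    n (suc k) = binom-pascal n k · +-comm _ _
  sh-binom-suc (suc j) n zero    = sym (+-identityʳ 0#)
  sh-binom-suc (suc j) n (suc k) = sh-binom-suc j n k

  vandermonde : ∀ p q k → splitSum k (λ i u → binom p i * binom q u) ≡ binom (p ℕ.+ q) k
  vandermonde zero q zero = cong (_* binom q 0) (binom-0 0) · *-identityˡ _
  vandermonde zero q (suc k) = cong₂ _+_ (cong (_* binom q (suc k)) (binom-0 0) · *-identityˡ _)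
      (splitSum-cong k (λ i u _ → cong (_* binom q u) (binom-> {0} {suc i} (s≤s z≤n)) · zeroˡ _ · sym (zeroˡ 0#)) · splitSum-* k 0# (λ _ _ → 0#) · zeroˡ _)
    · +-identityʳ _
  vandermonde (suc p) q zero = cong₂ _*_ (binom-0 (suc p)) (binom-0 q) · *-identityˡ 1# · sym (binom-0 (suc p ℕ.+ q))
  vandermonde (suc p) q (suc k) = begin
    binom (suc p) 0 * binom q (suc k) + splitSum k (λ i u → binom (suc p) (suc i) * binom q u)
      ≡⟨ cong (binom p 0 * binom q (suc k) +_) (splitSum-cong k (λ i u _ → cong (_* binom q u) (binom-pascal p i) · distribʳ (binom q u) (binom p i) (binom p (suc i))) · splitSum-+ k _ _) ⟩
    binom p 0 * binom q (suc k) + (splitSum k (λ i u → binom p i * binom q u) + splitSum k (λ i u → binom p (suc i) * binom q u))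
      ≡⟨ solve 3 (λ a b c → a :+ (b :+ c) := b :+ (a :+ c)) refl (binom p 0 * binom q (suc k)) (splitSum k (λ i u → binom p i * binom q u)) _ ⟩
    splitSum k (λ i u → binom p i * binom q u) + splitSum (suc k) (λ i u → binom p i * binom q u)
      ≡⟨ cong₂ _+_ (vandermonde p q k) (vandermonde p q (suc k)) ⟩
    binom (p ℕ.+ q) k + binom (p ℕ.+ q) (suc k)
      ≡⟨ sym (binom-pascal (p ℕ.+ q) k) ⟩
    binom (suc (p ℕ.+ q)) (suc k) ∎
    where open ≡-Reasoning

  vandermonde-sh : ∀ p j q k → splitSum k (λ i u → binom p i * sh j (binom q) u) ≡ sh j (binom (p ℕ.+ q)) k
  vandermonde-sh p zero    q k       = vandermonde p q k
  vandermonde-sh p (suc j) q zero    = zeroʳ _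
  vandermonde-sh p (suc j) q (suc k) = splitSum-last k (λ i u → binom p i * sh (suc j) (binom q) u)
    · cong₂ _+_ (vandermonde-sh p j q k) (zeroʳ _) · +-identityʳ _

  -- Factorials and the symmetry of binomials

  fact : ℕ → Carrier
  fact zero    = 1#
  fact (suc n) = ι (suc n) * fact n

  fact-pos : ∀ n → Pos (fact n)
  fact-pos zero    = 1-pos
  fact-pos (suc n) = pos* (ι-pos n) (fact-pos n)

  binom-fact : ∀ a b → binom (a ℕ.+ b) a * (fact a * fact b) ≡ fact (a ℕ.+ b)
  binom-fact zero    b = cong (_* (1# * fact b)) (binom-0 b) · solve 1 (λ f → # 1 :* (# 1 :* f) := f) refl (fact b)
  binom-fact (suc a) b = begin
    binom (suc (a ℕ.+ b)) (suc a) * ((ι (suc a) * fact a) * fact b)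
      ≡⟨ solve 4 (λ c n f g → c :* ((n :* f) :* g) := (n :* c) :* (f :* g)) refl (binom (suc (a ℕ.+ b)) (suc a)) (ι (suc a)) (fact a) (fact b) ⟩
    (ι (suc a) * binom (suc (a ℕ.+ b)) (suc a)) * (fact a * fact b)
      ≡⟨ cong (_* (fact a * fact b)) (binom-absorb (a ℕ.+ b) a) ⟩
    (ι (suc (a ℕ.+ b)) * binom (a ℕ.+ b) a) * (fact a * fact b)
      ≡⟨ *-assoc _ _ _ ⟩
    ι (suc (a ℕ.+ b)) * (binom (a ℕ.+ b) a * (fact a * fact b))
      ≡⟨ cong (ι (suc (a ℕ.+ b)) *_) (binom-fact a b) ⟩
    ι (suc (a ℕ.+ b)) * fact (a ℕ.+ b) ∎
    where open ≡-Reasoning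

  binom-sym : ∀ a b → binom (a ℕ.+ b) a ≡ binom (a ℕ.+ b) b
  binom-sym a b = cancel-≡ˡ (proj₂ (pos* (fact-pos a) (fact-pos b)))
    (*-comm _ _ · binom-fact a b · cong fact (ℕₚ.+-comm a b) · sym (binom-fact b a)
      · cong₂ _*_ (cong (λ n → binom n b) (ℕₚ.+-comm b a)) (*-comm (fact b) (fact a)) · *-comm _ _)

  -- (1 + x)ᴺ is palindromic, so reversing xⁱ (1 + x)ᴺ in degree i + N + j gives xʲ (1 + x)ᴺ.
  sh-binom-reflect : ∀ i N j {k k′} → k ℕ.+ k′ ≡ i ℕ.+ (N ℕ.+ j) → sh i (binom N) k ≡ sh j (binom N) k′
  sh-binom-reflect i N j {k} {k′} eq with k ℕ.<? i
  ... | yes k<i = sh-< (binom N) k<i · sym (cong (sh j (binom N)) k′≡ · sh-+ j (binom N) _ · binom-> N<)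
    where
    t = i ℕ.∸ k
    k′≡ : k′ ≡ j ℕ.+ (t ℕ.+ N)
    k′≡ = +-cancelˡ-≡ k k′ (j ℕ.+ (t ℕ.+ N)) (eq · cong (ℕ._+ (N ℕ.+ j)) (sym (m+[n∸m]≡n (<⇒≤ k<i))) · ℕₚ.+-assoc k t _
            · cong (k ℕ.+_) (sym (ℕₚ.+-assoc t N j) · ℕₚ.+-comm (t ℕ.+ N) j))
    N< : N ℕ.< t ℕ.+ N
    N< = m<n+m N (m<n⇒0<n∸m k<i)
  ... | no k≮i = cong (sh i (binom N)) (sym k≡) · sh-+ i (binom N) r · split
    where
    r = k ℕ.∸ i
    k≡ : i ℕ.+ r ≡ k
    k≡ = m+[n∸m]≡n (≮⇒≥ k≮i)
    rk′ : r ℕ.+ k′ ≡ N ℕ.+ j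
    rk′ = +-cancelˡ-≡ i _ _ (sym (ℕₚ.+-assoc i r k′) · cong (ℕ._+ k′) k≡ · eq)
    split : binom N r ≡ sh j (binom N) k′
    split with r ℕ.≤? N
    ... | no r≰N = binom-> (≰⇒> r≰N) · sym (sh-< (binom N) (+-cancelˡ-< N k′ j (<-≤-trans (+-monoˡ-< k′ (≰⇒> r≰N)) (ℕₚ.≤-reflexive rk′))))
    ... | yes r≤N = cong (λ m → binom m r) (sym N≡) · binom-sym r s · cong (λ m → binom m s) N≡ · sym (cong (sh j (binom N)) k′≡ · sh-+ j (binom N) s)
      where
      s = N ℕ.∸ r
      N≡ : r ℕ.+ s ≡ N
      N≡ = m+[n∸m]≡n r≤N
      k′≡ : k′ ≡ j ℕ.+ s
      k′≡ = +-cancelˡ-≡ r _ _ (rk′ · cong (ℕ._+ j) (sym N≡) · ℕₚ.+-assoc r s j · cong (r ℕ.+_) (ℕₚ.+-comm s j))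

  -- Products of the polynomials C(x + i′, i + i′)

  -- Partial summation divides the generating function by 1 - x; hence `S^ D` divides by (1 - x)ᴰ
  -- and commutes with `sh`.
  S : (ℕ → Carrier) → (ℕ → Carrier)
  S f zero    = f 0
  S f (suc n) = S f n + f (suc n)

  S^ : ℕ → (ℕ → Carrier) → (ℕ → Carrier)
  S^ zero    f = f
  S^ (suc D) f = S (S^ D f)

  S-cong : ∀ {f g : ℕ → Carrier} → (∀ n → f n ≡ g n) → ∀ n → S f n ≡ S g n
  S-cong h zero    = h 0
  S-cong h (suc n) = cong₂ _+_ (S-cong h n) (h (suc n))

  S^-cong : ∀ D {f g : ℕ → Carrier} → (∀ n → f n ≡ g n) → ∀ n → S^ D f n ≡ S^ D g n
  S^-cong zero    h = h
  S^-cong (suc D) h = S-cong (S^-cong D h)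

  S-+ : ∀ (f g : ℕ → Carrier) n → S (λ k → f k + g k) n ≡ S f n + S g n
  S-+ f g zero    = refl
  S-+ f g (suc n) = cong (_+ (f (suc n) + g (suc n))) (S-+ f g n)
    · solve 4 (λ a b c d → (a :+ b) :+ (c :+ d) := (a :+ c) :+ (b :+ d)) refl (S f n) (S g n) (f (suc n)) (g (suc n))

  S^-+ : ∀ D (f g : ℕ → Carrier) n → S^ D (λ k → f k + g k) n ≡ S^ D f n + S^ D g n
  S^-+ zero    f g n = refl
  S^-+ (suc D) f g n = S-cong (S^-+ D f g) n · S-+ (S^ D f) (S^ D g) n

  S-* : ∀ c (f : ℕ → Carrier) n → S (λ k → c * f k) n ≡ c * S f n
  S-* c f zero    = refl
  S-* c f (suc n) = cong (_+ c * f (suc n)) (S-* c f n) · sym (distribˡ c _ _)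

  S^-* : ∀ D c (f : ℕ → Carrier) n → S^ D (λ k → c * f k) n ≡ c * S^ D f n
  S^-* zero    c f n = refl
  S^-* (suc D) c f n = S-cong (S^-* D c f) n · S-* c (S^ D f) n

  S-0 : ∀ n → S (λ _ → 0#) n ≡ 0#
  S-0 zero    = refl
  S-0 (suc n) = cong (_+ 0#) (S-0 n) · +-identityʳ 0#

  S^-0 : ∀ D n → S^ D (λ _ → 0#) n ≡ 0#
  S^-0 zero    n = refl
  S^-0 (suc D) n = S-cong (S^-0 D) n · S-0 n

  S^-∑ : ∀ D m (c : ℕ → Carrier) (F : ℕ → ℕ → Carrier) n → S^ D (λ k → ∑ m (λ i → c i * F i k)) n ≡ ∑ m (λ i → c i * S^ D (F i) n)
  S^-∑ D zero    c F n = S^-0 D n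
  S^-∑ D (suc m) c F n = S^-+ D (λ k → ∑ m (λ i → c i * F i k)) (λ k → c m * F m k) n · cong₂ _+_ (S^-∑ D m c F n) (S^-* D (c m) (F m) n)

  S-sh₁ : ∀ (f : ℕ → Carrier) n → S (sh 1 f) n ≡ sh 1 (S f) n
  S-sh₁ f zero          = refl
  S-sh₁ f (suc zero)    = +-identityˡ (f 0)
  S-sh₁ f (suc (suc n)) = cong (_+ f (suc n)) (S-sh₁ f (suc n))

  S^-sh₁ : ∀ D (f : ℕ → Carrier) n → S^ D (sh 1 f) n ≡ sh 1 (S^ D f) n
  S^-sh₁ zero    f n = refl
  S^-sh₁ (suc D) f n = S-cong (S^-sh₁ D f) n · S-sh₁ (S^ D f) n

  sh-suc : ∀ j (f : ℕ → Carrier) n → sh (suc j) f n ≡ sh 1 (sh j f) n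
  sh-suc j f zero    = refl
  sh-suc j f (suc n) = refl

  S^-sh : ∀ D j (f : ℕ → Carrier) n → S^ D (sh j f) n ≡ sh j (S^ D f) n
  S^-sh D zero    f n = refl
  S^-sh D (suc j) f n = S^-cong D (sh-suc j f) n · S^-sh₁ D (sh j f) n · sh-cong 1 (S^-sh D j f) n · sym (sh-suc j (S^ D f) n)

  S-unique : ∀ {f g : ℕ → Carrier} → f 0 ≡ g 0 → (∀ n → f (suc n) ≡ f n + g (suc n)) → ∀ n → f n ≡ S g n
  S-unique e₀ e zero    = e₀
  S-unique {f} {g} e₀ e (suc n) = e n · cong (_+ g (suc n)) (S-unique {f} {g} e₀ e n)

  -- The polynomial C(x + i′, i + i′), which corresponds to xⁱ under 𝒲 in degree i + i′.
  B : ℕ → ℕ → ℕ → Carrier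
  B i i′ n = binom (n ℕ.+ i′) (i ℕ.+ i′)

  B-step : ∀ i i′ n → B i (suc i′) (suc n) ≡ B i (suc i′) n + B i i′ (suc n)
  B-step i i′ n = cong (binom (suc (n ℕ.+ suc i′))) (+-suc i i′) · binom-pascal (n ℕ.+ suc i′) (i ℕ.+ i′) · +-comm _ _
    · cong₂ _+_ (cong (binom (n ℕ.+ suc i′)) (sym (+-suc i i′))) (cong (λ m → binom m (i ℕ.+ i′)) (+-suc n i′))

  binom-n : ∀ n → binom n n ≡ 1#
  binom-n n = cong ι (nCn≡1 n) · ι-1

  B-start : ∀ i i′ → B i (suc i′) 0 ≡ B i i′ 0
  B-start zero    i′ = binom-n (suc i′) · sym (binom-n i′)
  B-start (suc i) i′ = binom-> (s≤s (m≤n+m (suc i′) i)) · sym (binom-> (s≤s (m≤n+m i′ i)))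

  B-shift : ∀ i i′ n → B (suc i) i′ (suc n) ≡ B i (suc i′) n
  B-shift i i′ n = sym (cong₂ binom (+-suc n i′) (+-suc i i′))

  B-shift-0 : ∀ i i′ → B (suc i) i′ 0 ≡ 0#
  B-shift-0 i i′ = binom-> (s≤s (m≤n+m i′ i))

  B-00 : ∀ n → B 0 0 n ≡ 1#
  B-00 n = binom-0 (n ℕ.+ 0)

  S-B : ∀ i i′ n → S (B i i′) n ≡ B i (suc i′) n
  S-B i i′ n = sym (S-unique {B i (suc i′)} (B-start i i′) (B-step i i′) n)

  δ : ℕ → ℕ → Carrier
  δ i = sh i (binom 0)

  -- This is the expansion of xⁱ / (1 - x)^(i + i′ + 1): the binomial series for the exponent i = 0,
  -- then a shift by i.
  S^-δ : ∀ i i′ n → S^ (suc (i ℕ.+ i′)) (δ i) n ≡ B i i′ n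
  S^-δ i i′ n = S^-sh (suc (i ℕ.+ i′)) i (binom 0) n · sh-cong i (ones (i ℕ.+ i′)) n · shifted i i′ n
    where
    ones : ∀ D n → S^ (suc D) (binom 0) n ≡ B 0 D n
    ones zero    n = sym (S-unique {λ _ → 1#} (sym (binom-0 0)) (λ n → sym (cong (1# +_) (binom-> {0} {suc n} (s≤s z≤n)) · +-identityʳ 1#)) n) · sym (B-00 n)
    ones (suc D) n = S-cong (ones D) n · S-B 0 D n
    shifted : ∀ i i′ n → sh i (B 0 (i ℕ.+ i′)) n ≡ B i i′ n
    shifted zero    i′ n       = refl
    shifted (suc i) i′ zero    = sym (B-shift-0 i i′)
    shifted (suc i) i′ (suc n) = cong (λ m → sh i (B 0 m) n) (sym (+-suc i i′)) · shifted i (suc i′) n · sym (B-shift i i′ n)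

  -- Both sides are (n + j)! / (i! j! (n - i)!) for i ≤ n and zero otherwise.
  trinomial : ∀ i j n → binom n i * binom (n ℕ.+ j) j ≡ binom (i ℕ.+ j) i * binom (n ℕ.+ j) (i ℕ.+ j)
  trinomial i j n with n ℕ.<? i
  ... | yes n<i = cong (_* binom (n ℕ.+ j) j) (binom-> n<i) · zeroˡ _ · sym (cong (binom (i ℕ.+ j) i *_) (binom-> (+-monoˡ-< j n<i)) · zeroʳ _)
  ... | no n≮i = subst (λ n → binom n i * binom (n ℕ.+ j) j ≡ binom (i ℕ.+ j) i * binom (n ℕ.+ j) (i ℕ.+ j)) (m+[n∸m]≡n (≮⇒≥ n≮i)) (main (n ℕ.∸ i))
    where
    main : ∀ l → binom (i ℕ.+ l) i * binom (i ℕ.+ l ℕ.+ j) j ≡ binom (i ℕ.+ j) i * binom (i ℕ.+ l ℕ.+ j) (i ℕ.+ j)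
    main l = cancel-≡ˡ (proj₂ (pos* (fact-pos i) (pos* (fact-pos l) (fact-pos j)))) (begin
      (fact i * (fact l * fact j)) * (binom (i ℕ.+ l) i * binom N j)
        ≡⟨ solve 5 (λ i l j a b → (i :* (l :* j)) :* (a :* b) := b :* (j :* (a :* (i :* l)))) refl (fact i) (fact l) (fact j) _ _ ⟩
      binom N j * (fact j * (binom (i ℕ.+ l) i * (fact i * fact l)))
        ≡⟨ cong₂ (λ m x → binom m j * (fact j * x)) (ℕₚ.+-comm (i ℕ.+ l) j) (binom-fact i l) ⟩
      binom (j ℕ.+ (i ℕ.+ l)) j * (fact j * fact (i ℕ.+ l))
        ≡⟨ binom-fact j (i ℕ.+ l) ⟩
      fact (j ℕ.+ (i ℕ.+ l))
        ≡⟨ cong fact N≡ ⟩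
      fact (i ℕ.+ j ℕ.+ l)
        ≡⟨ sym (binom-fact (i ℕ.+ j) l) ⟩
      binom (i ℕ.+ j ℕ.+ l) (i ℕ.+ j) * (fact (i ℕ.+ j) * fact l)
        ≡⟨ cong₂ (λ m x → binom m (i ℕ.+ j) * (x * fact l)) (sym N≡ · ℕₚ.+-comm j (i ℕ.+ l)) (sym (binom-fact i j)) ⟩
      binom N (i ℕ.+ j) * ((binom (i ℕ.+ j) i * (fact i * fact j)) * fact l)
        ≡⟨ solve 5 (λ i l j a b → b :* ((a :* (i :* j)) :* l) := (i :* (l :* j)) :* (a :* b)) refl (fact i) (fact l) (fact j) _ _ ⟩
      (fact i * (fact l * fact j)) * (binom (i ℕ.+ j) i * binom N (i ℕ.+ j)) ∎)
      where
      open ≡-Reasoning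
      N = i ℕ.+ l ℕ.+ j
      N≡ : j ℕ.+ (i ℕ.+ l) ≡ i ℕ.+ j ℕ.+ l
      N≡ = sym (ℕₚ.+-assoc j i l) · cong (ℕ._+ l) (ℕₚ.+-comm j i)

  -- The coefficients of the product of the monomials x^i₀ (degree i₀ + i₁)
  -- and x^j₀ (degree j₀ + j₁).
  M : ℕ → ℕ → ℕ → ℕ → ℕ → Carrier
  M i₀ i₁ j₀ j₁ k = sh j₀ (binom (i₀ ℕ.+ j₁)) k * sh i₀ (binom (i₁ ℕ.+ j₀)) k

  M-swap : ∀ i₀ i₁ j₀ j₁ k → M i₀ i₁ j₀ j₁ k ≡ M j₀ j₁ i₀ i₁ k
  M-swap i₀ i₁ j₀ j₁ k = *-comm _ _ · cong₂ (λ m n → sh i₀ (binom m) k * sh j₀ (binom n) k) (ℕₚ.+-comm i₁ j₀) (ℕₚ.+-comm i₀ j₁)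

  M-step : ∀ i₀ i₁ j₀ j₁ k → M i₀ (suc i₁) j₀ (suc j₁) k ≡ M i₀ i₁ j₀ (suc j₁) k + M (suc i₀) i₁ j₀ j₁ k
  M-step i₀ i₁ j₀ j₁ k = cong (sh j₀ (binom (i₀ ℕ.+ suc j₁)) k *_) (sh-binom-suc i₀ (i₁ ℕ.+ j₀) k) · distribˡ _ _ _
    · cong (M i₀ i₁ j₀ (suc j₁) k +_) (cong (λ m → sh j₀ (binom m) k * sh (suc i₀) (binom (i₁ ℕ.+ j₀)) k) (+-suc i₀ j₁))

  M-shift : ∀ i₀ i₁ j₀ j₁ k → M (suc i₀) i₁ (suc j₀) j₁ k ≡ sh 1 (M i₀ (suc i₁) j₀ (suc j₁)) k
  M-shift i₀ i₁ j₀ j₁ zero    = zeroˡ 0#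
  M-shift i₀ i₁ j₀ j₁ (suc k) = cong₂ (λ m n → sh j₀ (binom m) k * sh i₀ (binom n) k) (sym (+-suc i₀ j₁)) (+-suc i₁ j₀)

  δ-support : ∀ (f : ℕ → Carrier) i k → f k * δ i k ≡ f i * δ i k
  δ-support f i k with <-cmp k i
  ... | tri< k<i _ _ = cong (f k *_) (sh-< (binom 0) k<i) · zeroʳ _ · sym (cong (f i *_) (sh-< (binom 0) k<i) · zeroʳ _)
  ... | tri≈ _ refl _ = refl
  ... | tri> _ _ i<k = cong (f k *_) δ≡0 · zeroʳ _ · sym (cong (f i *_) δ≡0 · zeroʳ _)
    where
    δ≡0 : δ i k ≡ 0#
    δ≡0 = cong (δ i) (sym (m+[n∸m]≡n (<⇒≤ i<k))) · sh-+ i (binom 0) (k ℕ.∸ i) · binom-> (m<n⇒0<n∸m i<k)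

  product-corner₁ : ∀ j₀ j₁ n → B 0 0 n * B j₀ j₁ n ≡ S^ (suc (j₀ ℕ.+ j₁)) (M 0 0 j₀ j₁) n
  product-corner₁ j₀ j₁ n = cong (_* B j₀ j₁ n) (B-00 n) · *-identityˡ _ · sym (S^-δ j₀ j₁ n) · S^-cong (suc (j₀ ℕ.+ j₁)) (λ k → sym (M≡δ k)) n
    where
    M≡δ : ∀ k → M 0 0 j₀ j₁ k ≡ δ j₀ k
    M≡δ k with k ℕ.<? j₀
    ... | yes k<j₀ = cong (_* binom j₀ k) (sh-< (binom j₁) k<j₀) · zeroˡ _ · sym (sh-< (binom 0) k<j₀)
    ... | no k≮j₀ = subst (λ k → M 0 0 j₀ j₁ k ≡ δ j₀ k) (m+[n∸m]≡n (≮⇒≥ k≮j₀)) (beyond (k ℕ.∸ j₀))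
      where
      beyond : ∀ r → M 0 0 j₀ j₁ (j₀ ℕ.+ r) ≡ δ j₀ (j₀ ℕ.+ r)
      beyond zero    = cong₂ _*_ (sh-+ j₀ (binom j₁) 0 · binom-0 j₁) (cong (binom j₀) (ℕₚ.+-identityʳ j₀) · binom-n j₀) · *-identityˡ 1# · sym (sh-+ j₀ (binom 0) 0 · binom-0 0)
      beyond (suc r) = cong (sh j₀ (binom j₁) (j₀ ℕ.+ suc r) *_) (binom-> (m<m+n j₀ (s≤s z≤n))) · zeroʳ _ · sym (sh-+ j₀ (binom 0) (suc r) · binom-> {0} {suc r} (s≤s z≤n))

  product-corner₂ : ∀ i₀ j₁ n → B i₀ 0 n * B 0 j₁ n ≡ S^ (suc (i₀ ℕ.+ j₁)) (M i₀ 0 0 j₁) n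
  product-corner₂ i₀ j₁ n = cong₂ (λ a b → binom a b * B 0 j₁ n) (ℕₚ.+-identityʳ n) (ℕₚ.+-identityʳ i₀) · trinomial i₀ j₁ n
    · cong (binom (i₀ ℕ.+ j₁) i₀ *_) (sym (S^-δ i₀ j₁ n)) · sym (S^-* (suc (i₀ ℕ.+ j₁)) (binom (i₀ ℕ.+ j₁) i₀) (δ i₀) n)
    · S^-cong (suc (i₀ ℕ.+ j₁)) (λ k → sym (δ-support (binom (i₀ ℕ.+ j₁)) i₀ k)) n

  -- Induction on the total degree t. If i₁ and j₁ are positive, both sides obey the same recursion
  -- (`product-step`). If i₀ and j₀ are positive, both generating functions have a factor x, and
  -- removing it raises i₁ and j₁, which leads to the first case. In the remaining corners one of
  -- i₀, j₀ and one of i₁, j₁ is zero, and the product is a multiple of a single basis polynomial.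
  product-S^ : ∀ t i₀ i₁ j₀ j₁ → i₀ ℕ.+ i₁ ℕ.+ (j₀ ℕ.+ j₁) ≡ t → ∀ n → B i₀ i₁ n * B j₀ j₁ n ≡ S^ (suc t) (M i₀ i₁ j₀ j₁) n
  product-step : ∀ t i₀ i₁ j₀ j₁ → i₀ ℕ.+ suc i₁ ℕ.+ (j₀ ℕ.+ suc j₁) ≡ t → ∀ n →
    B i₀ (suc i₁) n * B j₀ (suc j₁) n ≡ S^ (suc t) (M i₀ (suc i₁) j₀ (suc j₁)) n

  product-step zero i₀ i₁ j₀ j₁ eq n with m+n≡0⇒n≡0 i₀ (m+n≡0⇒m≡0 (i₀ ℕ.+ suc i₁) eq)
  ... | ()
  product-step (suc t) i₀ i₁ j₀ j₁ eq n =
      S-unique {f} {g} start next n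
    · S-cong (λ k → cong₂ _+_ (product-S^ t i₀ i₁ j₀ (suc j₁) eq₁ k) (product-S^ t (suc i₀) i₁ j₀ j₁ eq₂ k)) n
    · S-cong (λ k → sym (S^-+ (suc t) (M i₀ i₁ j₀ (suc j₁)) (M (suc i₀) i₁ j₀ j₁) k)) n
    · sym (S^-cong (suc (suc t)) (M-step i₀ i₁ j₀ j₁) n)
    where
    f g : ℕ → Carrier
    f n = B i₀ (suc i₁) n * B j₀ (suc j₁) n
    -- The backward difference of f by a discrete Leibniz rule; in its second term `B-shift` has
    -- brought the factor at n - 1 back to n. `M-step` is the same recursion for the coefficients.
    g n = B i₀ i₁ n * B j₀ (suc j₁) n + B (suc i₀) i₁ n * B j₀ j₁ n
    eq₁ : i₀ ℕ.+ i₁ ℕ.+ (j₀ ℕ.+ suc j₁) ≡ t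
    eq₁ = suc-injective (sym (cong (ℕ._+ (j₀ ℕ.+ suc j₁)) (+-suc i₀ i₁)) · eq)
    eq₂ : suc i₀ ℕ.+ i₁ ℕ.+ (j₀ ℕ.+ j₁) ≡ t
    eq₂ = sym (+-suc (i₀ ℕ.+ i₁) (j₀ ℕ.+ j₁)) · cong (i₀ ℕ.+ i₁ ℕ.+_) (sym (+-suc j₀ j₁)) · eq₁
    start : f 0 ≡ g 0
    start = cong (_* B j₀ (suc j₁) 0) (B-start i₀ i₁) · sym (cong (B i₀ i₁ 0 * B j₀ (suc j₁) 0 +_) (cong (_* B j₀ j₁ 0) (B-shift-0 i₀ i₁) · zeroˡ _) · +-identityʳ _)
    next : ∀ n → f (suc n) ≡ f n + g (suc n)
    next n = begin
      B i₀ (suc i₁) (suc n) * B j₀ (suc j₁) (suc n)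
        ≡⟨ cong₂ _*_ (B-step i₀ i₁ n) (B-step j₀ j₁ n) ⟩
      (a + b) * (c + d)
        ≡⟨ solve 4 (λ a b c d → (a :+ b) :* (c :+ d) := a :* c :+ (b :* (c :+ d) :+ a :* d)) refl a b c d ⟩
      a * c + (b * (c + d) + a * d)
        ≡⟨ cong₂ (λ x y → a * c + (b * x + y * d)) (sym (B-step j₀ j₁ n)) (sym (B-shift i₀ i₁ n)) ⟩
      f n + g (suc n) ∎
      where
      open ≡-Reasoning
      a = B i₀ (suc i₁) n
      b = B i₀ i₁ (suc n)
      c = B j₀ (suc j₁) n
      d = B j₀ j₁ (suc n)

  product-S^ t i₀ (suc i₁) j₀ (suc j₁) eq n = product-step t i₀ i₁ j₀ j₁ eq n
  product-S^ t (suc i₀) i₁ (suc j₀) j₁ eq n = shifted n · sym (S^-cong (suc t) (M-shift i₀ i₁ j₀ j₁) n · S^-sh₁ (suc t) (M i₀ (suc i₁) j₀ (suc j₁)) n)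
    where
    shifted : ∀ n → B (suc i₀) i₁ n * B (suc j₀) j₁ n ≡ sh 1 (S^ (suc t) (M i₀ (suc i₁) j₀ (suc j₁))) n
    shifted zero    = cong (_* B (suc j₀) j₁ 0) (B-shift-0 i₀ i₁) · zeroˡ _
    shifted (suc n) = cong₂ _*_ (B-shift i₀ i₁ n) (B-shift j₀ j₁ n)
      · product-step t i₀ i₁ j₀ j₁ (cong₂ ℕ._+_ (+-suc i₀ i₁) (+-suc j₀ j₁) · eq) n
  product-S^ t zero zero j₀ j₁ refl n = product-corner₁ j₀ j₁ n
  product-S^ t i₀ zero zero j₁ refl n = product-corner₂ i₀ j₁ n · cong (λ m → S^ (suc (m ℕ.+ j₁)) (M i₀ 0 0 j₁) n) (sym (ℕₚ.+-identityʳ i₀))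
  product-S^ t i₀ i₁ zero zero refl n = *-comm _ _ · product-corner₁ i₀ i₁ n
    · S^-cong (suc (i₀ ℕ.+ i₁)) (M-swap 0 0 i₀ i₁) n · cong (λ m → S^ (suc m) (M i₀ i₁ 0 0) n) (sym (ℕₚ.+-identityʳ (i₀ ℕ.+ i₁)))
  product-S^ t zero i₁ j₀ zero refl n = *-comm _ _ · product-corner₂ j₀ i₁ n
    · S^-cong (suc (j₀ ℕ.+ i₁)) (M-swap j₀ 0 0 i₁) n · cong (λ m → S^ (suc m) (M 0 i₁ j₀ 0) n) (ℕₚ.+-comm j₀ i₁ · cong (i₁ ℕ.+_) (sym (ℕₚ.+-identityʳ j₀)))

  -- Finite differences and 𝒲

  ∑-splitSum : ∀ n (F : ℕ → ℕ → Carrier) → ∑ (suc n) (λ k → F k (n ℕ.∸ k)) ≡ splitSum n F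
  ∑-splitSum zero    F = +-identityˡ (F 0 0)
  ∑-splitSum (suc n) F = ∑-head (suc n) (λ k → F k (suc n ℕ.∸ k)) · cong (F 0 (suc n) +_) (∑-splitSum n (λ k r → F (suc k) r))

  -- With the convention s(-1) = 0 this multiplies the generating function by 1 - x and is inverse
  -- to `S`.
  ∇ : (ℕ → Carrier) → (ℕ → Carrier)
  ∇ s zero    = s 0
  ∇ s (suc n) = s (suc n) + - s n

  ∇^ : ℕ → (ℕ → Carrier) → (ℕ → Carrier)
  ∇^ zero    s = s
  ∇^ (suc D) s = ∇^ D (∇ s)

  ∇-cong : ∀ {f g : ℕ → Carrier} → (∀ n → f n ≡ g n) → ∀ n → ∇ f n ≡ ∇ g n
  ∇-cong h zero    = h 0
  ∇-cong h (suc n) = cong₂ (λ x y → x + - y) (h (suc n)) (h n)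

  ∇^-cong : ∀ D {f g : ℕ → Carrier} → (∀ n → f n ≡ g n) → ∀ n → ∇^ D f n ≡ ∇^ D g n
  ∇^-cong zero    h = h
  ∇^-cong (suc D) h = ∇^-cong D (∇-cong h)

  ∇-S : ∀ (f : ℕ → Carrier) n → ∇ (S f) n ≡ f n
  ∇-S f zero    = refl
  ∇-S f (suc n) = solve 2 (λ a b → (a :+ b) :- a := b) refl (S f n) (f (suc n))

  S-∇ : ∀ (s : ℕ → Carrier) n → S (∇ s) n ≡ s n
  S-∇ s n = sym (S-unique {s} {∇ s} refl (λ n → solve 2 (λ a b → b := a :+ (b :- a)) refl (s n) (s (suc n))) n)

  ∇^-S^ : ∀ D (f : ℕ → Carrier) n → ∇^ D (S^ D f) n ≡ f n
  ∇^-S^ zero    f n = refl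
  ∇^-S^ (suc D) f n = ∇^-cong D (∇-S (S^ D f)) n · ∇^-S^ D f n

  S^-∇^ : ∀ D (s : ℕ → Carrier) n → S^ D (∇^ D s) n ≡ s n
  S^-∇^ zero    s n = refl
  S^-∇^ (suc D) s n = S-cong (S^-∇^ D (∇ s)) n · S-∇ s n

  ∇^-outer : ∀ D (s : ℕ → Carrier) n → ∇^ (suc D) s n ≡ ∇ (∇^ D s) n
  ∇^-outer zero    s n = refl
  ∇^-outer (suc D) s n = ∇^-outer D (∇ s) n

  signed : ℕ → ℕ → Carrier
  signed n k = _^_ R (- 1#) k * binom n k

  signed-pascal : ∀ n k → signed (suc n) (suc k) ≡ signed n (suc k) + - signed n k
  signed-pascal n k = cong (_^_ R (- 1#) (suc k) *_) (binom-pascal n k)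
    · solve 3 (λ p b c → ((:- # 1) :* p) :* (b :+ c) := ((:- # 1) :* p) :* c :- p :* b) refl (_^_ R (- 1#) k) (binom n k) (binom n (suc k))

  -- The right side is the alternating sum in the definition of `W`, whose weights are the
  -- coefficients of (1 - x)ⁿ.
  ∇^-expand : ∀ n (s : ℕ → Carrier) i → ∇^ n s i ≡ splitSum i (λ k r → signed n k * s r)
  ∇^-expand zero s zero = sym (cong (λ x → (1# * x) * s 0) (binom-0 0) · solve 1 (λ x → (# 1 :* # 1) :* x := x) refl (s 0))
  ∇^-expand zero s (suc i) = sym (cong₂ _+_ (cong (λ x → (1# * x) * s (suc i)) (binom-0 0) · solve 1 (λ x → (# 1 :* # 1) :* x := x) refl (s (suc i)))
      (splitSum-cong i (λ k r _ → cong (λ x → (_^_ R (- 1#) (suc k) * x) * s r) (binom-> {0} {suc k} (s≤s z≤n))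
          · solve 2 (λ p x → (p :* # 0) :* x := # 0 :* # 0) refl (_^_ R (- 1#) (suc k)) (s r))
        · splitSum-* i 0# (λ _ _ → 0#) · zeroˡ _)
    · +-identityʳ _)
  ∇^-expand (suc n) s zero = ∇^-expand n (∇ s) zero
  ∇^-expand (suc n) s (suc i) = begin
    ∇^ n (∇ s) (suc i)
      ≡⟨ ∇^-expand n (∇ s) (suc i) ⟩
    splitSum (suc i) (λ k r → signed n k * ∇ s r)
      ≡⟨ splitSum-last i (λ k r → signed n k * ∇ s r) ⟩
    splitSum i (λ k r → signed n k * (s (suc r) + - s r)) + last
      ≡⟨ cong (_+ last) (splitSum-cong i (λ k r _ → solve 3 (λ w a b → w :* (a :- b) := w :* a :+ (:- # 1) :* (w :* b)) refl (signed n k) (s (suc r)) (s r))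
           · splitSum-+ i _ _ · cong (A +_) (splitSum-* i (- 1#) _)) ⟩
    (A + - 1# * L) + last
      ≡⟨ solve 3 (λ a l z → (a :+ (:- # 1) :* l) :+ z := (a :+ z) :+ (:- # 1) :* l) refl A L last ⟩
    (A + last) + - 1# * L
      ≡⟨ cong (_+ - 1# * L) (sym (splitSum-last i (λ k r → signed n k * s r))) ⟩
    (signed n 0 * s (suc i) + splitSum i (λ k r → signed n (suc k) * s r)) + - 1# * L
      ≡⟨ +-assoc _ _ _ ⟩
    signed n 0 * s (suc i) + (splitSum i (λ k r → signed n (suc k) * s r) + - 1# * L)
      ≡⟨ cong (signed n 0 * s (suc i) +_) (cong (splitSum i (λ k r → signed n (suc k) * s r) +_) (sym (splitSum-* i (- 1#) _)) · sym (splitSum-+ i _ _)) ⟩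
    signed n 0 * s (suc i) + splitSum i (λ k r → signed n (suc k) * s r + - 1# * (signed n k * s r))
      ≡⟨ cong (signed n 0 * s (suc i) +_) (splitSum-cong i (λ k r _ →
           solve 3 (λ a b s → a :* s :+ (:- # 1) :* (b :* s) := (a :- b) :* s) refl (signed n (suc k)) (signed n k) (s r) · cong (_* s r) (sym (signed-pascal n k)))) ⟩
    splitSum (suc i) (λ k r → signed (suc n) k * s r) ∎
    where
    open ≡-Reasoning
    last = signed n (suc i) * s 0
    A = splitSum i (λ k r → signed n k * s (suc r))
    L = splitSum i (λ k r → signed n k * s r)

  Δ^ : ℕ → (ℕ → Carrier) → (ℕ → Carrier)
  Δ^ zero    f n = f n
  Δ^ (suc k) f n = Δ^ k f (suc n) + - Δ^ k f n

  -- From index D on the convention s(-1) = 0 is no longer felt, and the iterated difference is the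
  -- ordinary forward one.
  ∇^-Δ^ : ∀ D (s : ℕ → Carrier) n → ∇^ D s (D ℕ.+ n) ≡ Δ^ D s n
  ∇^-Δ^ zero    s n = refl
  ∇^-Δ^ (suc D) s n = ∇^-outer D s (suc (D ℕ.+ n))
    · cong₂ (λ x y → x + - y) (cong (∇^ D s) (sym (+-suc D n)) · ∇^-Δ^ D s (suc n)) (∇^-Δ^ D s n)

  Δ^-∑ : ∀ k m (c : ℕ → Carrier) (F : ℕ → ℕ → Carrier) n → Δ^ k (λ n → ∑ m (λ i → c i * F i n)) n ≡ ∑ m (λ i → c i * Δ^ k (F i) n)
  Δ^-∑ zero    m c F n = refl
  Δ^-∑ (suc k) m c F n = cong₂ (λ x y → x + - y) (Δ^-∑ k m c F (suc n)) (Δ^-∑ k m c F n)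
    · solve 2 (λ a b → a :- b := a :+ (:- # 1) :* b) refl (∑ m (λ i → c i * Δ^ k (F i) (suc n))) (∑ m (λ i → c i * Δ^ k (F i) n))
    · cong (∑ m (λ i → c i * Δ^ k (F i) (suc n)) +_) (sym (∑-* m (- 1#) (λ i → c i * Δ^ k (F i) n))) · sym (∑-+ m _ _)
    · ∑-cong m (λ i _ → solve 3 (λ c a b → c :* a :+ (:- # 1) :* (c :* b) := c :* (a :- b)) refl (c i) (Δ^ k (F i) (suc n)) (Δ^ k (F i) n))

  Δ^-leibniz : ∀ k (f : ℕ → Carrier) n → Δ^ (suc k) (λ n → ι n * f n) n ≡ ι n * Δ^ (suc k) f n + ι (suc k) * Δ^ k f (suc n)
  Δ^-leibniz zero f n = solve 3 (λ n a b → (# 1 :+ n) :* a :- n :* b := n :* (a :- b) :+ (# 1 :+ # 0) :* a) refl (ι n) (f (suc n)) (f n)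
  Δ^-leibniz (suc k) f n = cong₂ (λ x y → x + - y) (Δ^-leibniz k f (suc n)) (Δ^-leibniz k f n)
    · solve 5 (λ n k a b c → ((# 1 :+ n) :* (a :- b) :+ k :* a) :- (n :* (b :- c) :+ k :* b)
                 := n :* ((a :- b) :- (b :- c)) :+ (# 1 :+ k) :* (a :- b)) refl
        (ι n) (ι (suc k)) (Δ^ k f (suc (suc n))) (Δ^ k f (suc n)) (Δ^ k f n)

  Δ^-vanish-mono : ∀ {k l} (f : ℕ → Carrier) → k ℕ.≤ l → (∀ n → Δ^ k f n ≡ 0#) → ∀ n → Δ^ l f n ≡ 0#
  Δ^-vanish-mono {k} {l} f k≤l h n with m≤n⇒m<n∨m≡n k≤l
  ... | inj₂ refl = h n
  Δ^-vanish-mono {k} {suc l} f k≤l h n | inj₁ (s≤s k≤l′) =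
    cong₂ (λ x y → x + - y) (Δ^-vanish-mono f k≤l′ h (suc n)) (Δ^-vanish-mono f k≤l′ h n) · -‿inverseʳ 0#

  Δ^-power : ∀ i n → Δ^ (suc i) (λ n → _^_ R (ι n) i) n ≡ 0#
  Δ^-power zero    n = -‿inverseʳ 1#
  Δ^-power (suc i) n = Δ^-leibniz (suc i) (λ n → _^_ R (ι n) i) n
    · cong₂ (λ x y → ι n * x + ι (suc (suc i)) * y) (Δ^-vanish-mono {suc i} (λ n → _^_ R (ι n) i) (n≤1+n (suc i)) (Δ^-power i) n) (Δ^-power i (suc n))
    · solve 2 (λ a b → a :* # 0 :+ b :* # 0 := # 0) refl (ι n) (ι (suc (suc i)))

  values : ℕ → (ℕ → Carrier) → (ℕ → Carrier)
  values d p n = eval R d p (ι n)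

  W-≤ : ∀ d p {i} → i ℕ.≤ d → W R d p i ≡ ∇^ (suc d) (values d p) i
  W-≤ d p {i} i≤d with i ℕ.≤? d
  ... | yes _ = ∑-splitSum i (λ k r → signed (suc d) k * values d p r) · sym (∇^-expand (suc d) (values d p) i)
  ... | no i≰d = ⊥-elim (i≰d i≤d)

  W-> : ∀ d p {i} → d ℕ.< i → W R d p i ≡ 0#
  W-> d p {i} d<i with i ℕ.≤? d
  ... | yes i≤d = ⊥-elim (<⇒≱ d<i i≤d)
  ... | no _ = refl

  -- `W` is cut off above d by definition. The iterated difference vanishes there too, having order
  -- d + 1 while the values come from a polynomial of degree at most d. So the identity holds at all
  -- indices, and `S^` can invert it.
  W-∇^ : ∀ d p i → W R d p i ≡ ∇^ (suc d) (values d p) i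
  W-∇^ d p i with <-≤-connex d i
  ... | inj₂ i≤d = W-≤ d p i≤d
  ... | inj₁ d<i = W-> d p d<i · sym (cong (∇^ (suc d) (values d p)) (sym (m+[n∸m]≡n d<i)) · ∇^-Δ^ (suc d) (values d p) n
      · Δ^-∑ (suc d) (suc d) p (λ i n → _^_ R (ι n) i) n
      · ∑-zero (suc d) (λ { j (s≤s j≤d) → cong (p j *_) (Δ^-vanish-mono (λ n → _^_ R (ι n) j) (s≤s j≤d) (Δ^-power j) n) · zeroʳ _ }))
    where n = i ℕ.∸ suc d

  ∑-δ-≥ : ∀ m (h : ℕ → Carrier) {k} → m ℕ.≤ k → ∑ m (λ i → h i * δ i k) ≡ 0#
  ∑-δ-≥ m h {k} m≤k = ∑-zero m λ i i<m → sym (δ-support h i k) · vanish i (<-≤-trans i<m m≤k)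
    where
    vanish : ∀ i → i ℕ.< k → h k * δ i k ≡ 0#
    vanish i i<k = cong (h k *_) (cong (δ i) (sym (m+[n∸m]≡n (<⇒≤ i<k))) · sh-+ i (binom 0) (k ℕ.∸ i) · binom-> (m<n⇒0<n∸m i<k)) · zeroʳ _

  ∑-δ : ∀ m (h : ℕ → Carrier) {k} → k ℕ.< m → ∑ m (λ i → h i * δ i k) ≡ h k
  ∑-δ (suc m) h {k} (s≤s k≤m) with m≤n⇒m<n∨m≡n k≤m
  ... | inj₁ k<m = cong₂ _+_ (∑-δ m h k<m) (cong (h m *_) (sh-< (binom 0) k<m) · zeroʳ _) · +-identityʳ _
  ... | inj₂ refl = cong₂ _+_ (∑-δ-≥ m h ℕₚ.≤-refl) (cong (h m *_) (cong (δ m) (sym (ℕₚ.+-identityʳ m)) · sh-+ m (binom 0) 0 · binom-0 0) · *-identityʳ _) · +-identityˡ _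

  ∑-δ-expand : ∀ m (h : ℕ → Carrier) → (∀ i → m ℕ.≤ i → h i ≡ 0#) → ∀ k → h k ≡ ∑ m (λ i → h i * δ i k)
  ∑-δ-expand m h hz k with <-≤-connex k m
  ... | inj₁ k<m = sym (∑-δ m h k<m)
  ... | inj₂ m≤k = hz k m≤k · sym (∑-δ-≥ m h m≤k)

  -- The other description of 𝒲, by the basis C(x + d - i, d): divide by (1 - x)^(d + 1) again and
  -- expand each xⁱ by `S^-δ`.
  values-W : ∀ d p n → values d p n ≡ ∑ (suc d) (λ i → W R d p i * B i (d ℕ.∸ i) n)
  values-W d p n = begin
    values d p n
      ≡⟨ sym (S^-∇^ (suc d) (values d p) n) ⟩
    S^ (suc d) (∇^ (suc d) (values d p)) n
      ≡⟨ S^-cong (suc d) (λ k → sym (W-∇^ d p k) · ∑-δ-expand (suc d) (W R d p) (λ i → W-> d p) k) n ⟩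
    S^ (suc d) (λ k → ∑ (suc d) (λ i → W R d p i * δ i k)) n
      ≡⟨ S^-∑ (suc d) (suc d) (W R d p) δ n ⟩
    ∑ (suc d) (λ i → W R d p i * S^ (suc d) (δ i) n)
      ≡⟨ ∑-cong (suc d) (λ { i (s≤s i≤d) → cong (W R d p i *_) (cong (λ D → S^ (suc D) (δ i) n) (sym (m+[n∸m]≡n i≤d)) · S^-δ i (d ℕ.∸ i) n) }) ⟩
    ∑ (suc d) (λ i → W R d p i * B i (d ℕ.∸ i) n) ∎
    where open ≡-Reasoning

  polyMul-head : ∀ (p q : ℕ → Carrier) k → polyMul R p q (suc k) ≡ p 0 * q (suc k) + polyMul R (λ i → p (suc i)) q k
  polyMul-head p q k = ∑-head (suc k) (λ i → p i * q (suc k ℕ.∸ i))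

  eval-head : ∀ d (p : ℕ → Carrier) x → eval R (suc d) p x ≡ p 0 + x * eval R d (λ i → p (suc i)) x
  eval-head d p x = ∑-head (suc d) (λ i → p i * _^_ R x i) · cong₂ _+_ (*-identityʳ (p 0))
    (∑-cong (suc d) (λ i _ → solve 3 (λ a x y → a :* (x :* y) := x :* (a :* y)) refl (p (suc i)) x (_^_ R x i)) · ∑-* (suc d) x (λ i → p (suc i) * _^_ R x i))

  eval-extend : ∀ k e (q : ℕ → Carrier) x → (∀ i → e ℕ.< i → q i ≡ 0#) → eval R (k ℕ.+ e) q x ≡ eval R e q x
  eval-extend zero    e q x h = refl
  eval-extend (suc k) e q x h = cong₂ _+_ (eval-extend k e q x h) (cong (_* _^_ R x (suc (k ℕ.+ e))) (h (suc (k ℕ.+ e)) (s≤s (m≤n+m e k))) · zeroˡ _) · +-identityʳ _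

  eval-polyMul : ∀ d e (p q : ℕ → Carrier) x → (∀ i → d ℕ.< i → p i ≡ 0#) → (∀ i → e ℕ.< i → q i ≡ 0#) →
    eval R (d ℕ.+ e) (polyMul R p q) x ≡ eval R d p x * eval R e q x
  eval-polyMul zero e p q x hp hq = ∑-cong (suc e) (λ k _ → cong (_* _^_ R x k) (only k) · *-assoc _ _ _) · ∑-* (suc e) (p 0) (λ k → q k * _^_ R x k)
    · cong (_* eval R e q x) (sym (+-identityˡ _ · *-identityʳ (p 0)))
    where
    only : ∀ k → polyMul R p q k ≡ p 0 * q k
    only k = ∑-head k (λ i → p i * q (k ℕ.∸ i)) · cong (p 0 * q k +_) (∑-zero k (λ i _ → cong (_* q (k ℕ.∸ suc i)) (hp (suc i) (s≤s z≤n)) · zeroˡ _)) · +-identityʳ _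
  eval-polyMul (suc d) e p q x hp hq = begin
    eval R (suc (d ℕ.+ e)) (polyMul R p q) x
      ≡⟨ eval-head (d ℕ.+ e) (polyMul R p q) x ⟩
    polyMul R p q 0 + x * eval R (d ℕ.+ e) (λ k → polyMul R p q (suc k)) x
      ≡⟨ cong₂ (λ a b → a + x * b) (+-identityˡ (p 0 * q 0)) (∑-cong (suc (d ℕ.+ e)) (λ k _ → cong (_* _^_ R x k) (polyMul-head p q k) · distribʳ _ _ _)
           · ∑-+ (suc (d ℕ.+ e)) _ _ · cong₂ _+_ (∑-cong (suc (d ℕ.+ e)) (λ k _ → *-assoc _ _ _) · ∑-* (suc (d ℕ.+ e)) (p 0) (λ k → q (suc k) * _^_ R x k)) (eval-polyMul d e p′ q x (λ i lt → hp (suc i) (s≤s lt)) hq)) ⟩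
    p 0 * q 0 + x * (p 0 * Q′ + eval R d p′ x * eval R e q x)
      ≡⟨ solve 6 (λ p q x Q P E → p :* q :+ x :* (p :* Q :+ P :* E) := p :* (q :+ x :* Q) :+ (x :* P) :* E) refl (p 0) (q 0) x Q′ (eval R d p′ x) (eval R e q x) ⟩
    p 0 * (q 0 + x * Q′) + (x * eval R d p′ x) * eval R e q x
      ≡⟨ cong (λ a → p 0 * a + (x * eval R d p′ x) * eval R e q x) (sym (eval-head (d ℕ.+ e) q x) · eval-extend (suc d) e q x hq) ⟩
    p 0 * eval R e q x + (x * eval R d p′ x) * eval R e q x
      ≡⟨ sym (distribʳ _ _ _) ⟩
    (p 0 + x * eval R d p′ x) * eval R e q x
      ≡⟨ cong (_* eval R e q x) (sym (eval-head d p x)) ⟩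
    eval R (suc d) p x * eval R e q x ∎
    where
    open ≡-Reasoning
    p′ = λ i → p (suc i)
    Q′ = eval R (d ℕ.+ e) (λ k → q (suc k)) x

  -- The bilinear extension of `M`, that is, multiplication of polynomials as seen through 𝒲.
  𝒯 : (d e : ℕ) (h g : ℕ → Carrier) → ℕ → Carrier
  𝒯 d e h g k = ∑ (suc d) (λ i → h i * ∑ (suc e) (λ j → g j * M i (d ℕ.∸ i) j (e ℕ.∸ j) k))

  W-polyMul : ∀ d e p q → (∀ i → d ℕ.< i → p i ≡ 0#) → (∀ i → e ℕ.< i → q i ≡ 0#) → ∀ {k} → k ℕ.≤ d ℕ.+ e →
    W R (d ℕ.+ e) (polyMul R p q) k ≡ 𝒯 d e (W R d p) (W R e q) k
  W-polyMul d e p q hp hq {k} k≤ = W-≤ (d ℕ.+ e) (polyMul R p q) k≤ · ∇^-cong m product k · ∇^-S^ m (𝒯 d e h g) k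
    where
    open ≡-Reasoning
    m = suc (d ℕ.+ e)
    h = W R d p
    g = W R e q
    product : ∀ n → values (d ℕ.+ e) (polyMul R p q) n ≡ S^ m (𝒯 d e h g) n
    product n = begin
      values (d ℕ.+ e) (polyMul R p q) n
        ≡⟨ eval-polyMul d e p q (ι n) hp hq ⟩
      values d p n * values e q n
        ≡⟨ cong₂ _*_ (values-W d p n) (values-W e q n) ⟩
      ∑ (suc d) (λ i → h i * B i (d ℕ.∸ i) n) * G
        ≡⟨ *-comm _ G · sym (∑-* (suc d) G (λ i → h i * B i (d ℕ.∸ i) n)) ⟩
      ∑ (suc d) (λ i → G * (h i * B i (d ℕ.∸ i) n))
        ≡⟨ ∑-cong (suc d) (λ i i<d → solve 3 (λ g h b → g :* (h :* b) := h :* (b :* g)) refl G (h i) (B i (d ℕ.∸ i) n) · cong (h i *_) (inner i i<d)) ⟩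
      ∑ (suc d) (λ i → h i * S^ m (λ k → ∑ (suc e) (λ j → g j * M i (d ℕ.∸ i) j (e ℕ.∸ j) k)) n)
        ≡⟨ sym (S^-∑ m (suc d) h (λ i k → ∑ (suc e) (λ j → g j * M i (d ℕ.∸ i) j (e ℕ.∸ j) k)) n) ⟩
      S^ m (𝒯 d e h g) n ∎
      where
      G = ∑ (suc e) (λ j → g j * B j (e ℕ.∸ j) n)
      inner : ∀ i → i ℕ.< suc d → B i (d ℕ.∸ i) n * G ≡ S^ m (λ k → ∑ (suc e) (λ j → g j * M i (d ℕ.∸ i) j (e ℕ.∸ j) k)) n
      inner i (s≤s i≤d) = sym (∑-* (suc e) (B i (d ℕ.∸ i) n) (λ j → g j * B j (e ℕ.∸ j) n))
        · ∑-cong (suc e) (λ { j (s≤s j≤e) → solve 3 (λ b g c → b :* (g :* c) := g :* (b :* c)) refl (B i (d ℕ.∸ i) n) (g j) (B j (e ℕ.∸ j) n)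
            · cong (g j *_) (product-S^ (d ℕ.+ e) i (d ℕ.∸ i) j (e ℕ.∸ j) (cong₂ ℕ._+_ (m+[n∸m]≡n i≤d) (m+[n∸m]≡n j≤e)) n) })
        · sym (S^-∑ m (suc e) g (λ j → M i (d ℕ.∸ i) j (e ℕ.∸ j)) n)

  -- The derivatives of f as coefficients of 𝒲

  δ-sym : ∀ i k → δ i k ≡ δ k i
  δ-sym zero    zero    = refl
  δ-sym zero    (suc k) = binom-> {0} {suc k} (s≤s z≤n)
  δ-sym (suc i) zero    = sym (binom-> {0} {suc i} (s≤s z≤n))
  δ-sym (suc i) (suc k) = δ-sym i k

  pascal-expand : ∀ d (α : ℕ → Carrier) → (∀ i → d ℕ.< i → α i ≡ 0#) → ∀ n i → pascal n α i ≡ ∑ (suc d) (λ i₀ → α i₀ * sh i (binom n) i₀)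
  pascal-expand d α hα zero    i = ∑-δ-expand (suc d) α hα i · ∑-cong (suc d) (λ i₀ _ → cong (α i₀ *_) (δ-sym i₀ i))
  pascal-expand d α hα (suc n) i = cong₂ _+_ (pascal-expand d α hα n i) (pascal-expand d α hα n (suc i)) · sym (∑-+ (suc d) _ _)
    · ∑-cong (suc d) (λ i₀ _ → sym (distribˡ (α i₀) _ _) · cong (α i₀ *_) (sym (sh-binom-suc i n i₀)))

  above-cong : ∀ e s {f g : ℕ → Carrier} → (∀ n → f n ≡ g n) → above e s f ≡ above e s g
  above-cong zero    s       h = h s
  above-cong (suc e) zero    h = refl
  above-cong (suc e) (suc s) h = above-cong e s h

  above-∑ : ∀ e s m (c : ℕ → Carrier) (F : ℕ → ℕ → Carrier) → above e s (λ n → ∑ m (λ i → c i * F i n)) ≡ ∑ m (λ i → c i * above e s (F i))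
  above-∑ zero    s       m c F = refl
  above-∑ (suc e) zero    m c F = sym (∑-zero m (λ i _ → zeroʳ (c i)))
  above-∑ (suc e) (suc s) m c F = above-∑ e s m c F

  above-zero : ∀ e s {f : ℕ → Carrier} → (∀ n → f n ≡ 0#) → above e s f ≡ 0#
  above-zero e s h = above-cong e s h · zeros e s
    where
    zeros : ∀ e s → above e s (λ _ → 0#) ≡ 0#
    zeros zero    s       = refl
    zeros (suc e) zero    = refl
    zeros (suc e) (suc s) = zeros e s

  -- coef for α = δ i₀ and β = δ j₀.
  unit : (e i₀ j₀ : ℕ) → Family
  unit e i₀ j₀ i u w = above e (u ℕ.+ w) (λ n → sh i (binom n) i₀ * (binom u n * binom w n * sh (e ℕ.∸ w) (binom n) j₀))

  coef-expand : ∀ d e α β → (∀ i → d ℕ.< i → α i ≡ 0#) → (∀ i → e ℕ.< i → β i ≡ 0#) → ∀ i u w →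
    coef e α β i u w ≡ ∑ (suc d) (λ i₀ → α i₀ * ∑ (suc e) (λ j₀ → β j₀ * unit e i₀ j₀ i u w))
  coef-expand d e α β hα hβ i u w = above-cong e (u ℕ.+ w) bilinear
    · above-∑ e (u ℕ.+ w) (suc d) α (λ i₀ n → ∑ (suc e) (λ j₀ → β j₀ * term i₀ j₀ n))
    · ∑-cong (suc d) (λ i₀ _ → cong (α i₀ *_) (above-∑ e (u ℕ.+ w) (suc e) β (term i₀)))
    where
    open ≡-Reasoning
    term : ℕ → ℕ → ℕ → Carrier
    term i₀ j₀ n = sh i (binom n) i₀ * (binom u n * binom w n * sh (e ℕ.∸ w) (binom n) j₀)
    bilinear : ∀ n → pascal n α i * κ e β u w n ≡ ∑ (suc d) (λ i₀ → α i₀ * ∑ (suc e) (λ j₀ → β j₀ * term i₀ j₀ n))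
    bilinear n = begin
      pascal n α i * (b * pascal n β (e ℕ.∸ w))
        ≡⟨ cong₂ (λ x y → x * (b * y)) (pascal-expand d α hα n i) (pascal-expand e β hβ n (e ℕ.∸ w)) ⟩
      ∑ (suc d) (λ i₀ → α i₀ * sh i (binom n) i₀) * (b * sum)
        ≡⟨ *-comm _ _ · sym (∑-* (suc d) (b * sum) (λ i₀ → α i₀ * sh i (binom n) i₀)) ⟩
      ∑ (suc d) (λ i₀ → (b * sum) * (α i₀ * sh i (binom n) i₀))
        ≡⟨ ∑-cong (suc d) (λ i₀ _ → solve 4 (λ b t a s → (b :* t) :* (a :* s) := a :* ((s :* b) :* t)) refl b sum (α i₀) (sh i (binom n) i₀)
             · cong (α i₀ *_) (sym (∑-* (suc e) (sh i (binom n) i₀ * b) (λ j₀ → β j₀ * sh (e ℕ.∸ w) (binom n) j₀))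
             · ∑-cong (suc e) (λ j₀ _ → solve 4 (λ s b c t → (s :* b) :* (c :* t) := c :* (s :* (b :* t))) refl (sh i (binom n) i₀) b (β j₀) (sh (e ℕ.∸ w) (binom n) j₀)))) ⟩
      ∑ (suc d) (λ i₀ → α i₀ * ∑ (suc e) (λ j₀ → β j₀ * term i₀ j₀ n)) ∎
      where
      b = binom u n * binom w n
      sum = ∑ (suc e) (λ j₀ → β j₀ * sh (e ℕ.∸ w) (binom n) j₀)

  sh-> : ∀ {j N k} → j ℕ.+ N ℕ.< k → sh j (binom N) k ≡ 0#
  sh-> {j} {N} {k} lt = cong (sh j (binom N)) (sym (m+[n∸m]≡n j≤k)) · sh-+ j (binom N) (k ℕ.∸ j)
    · binom-> (+-cancelˡ-< j N (k ℕ.∸ j) (<-≤-trans lt (ℕₚ.≤-reflexive (sym (m+[n∸m]≡n j≤k)))))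
    where j≤k = ℕₚ.≤-trans (m≤m+n j N) (<⇒≤ lt)

  sh-in-range : ∀ j N k → j ℕ.≤ k → k ℕ.≤ j ℕ.+ N → ∃ λ q → ∃ λ P → k ≡ j ℕ.+ q × N ≡ q ℕ.+ P
  sh-in-range j N k j≤k k≤ = k ℕ.∸ j , N ℕ.∸ (k ℕ.∸ j) , sym (m+[n∸m]≡n j≤k) , sym (m+[n∸m]≡n (m≤n+o⇒m∸n≤o k j k≤))

  private
    both-zero : ∀ {a f b x y} → x ≡ 0# → y ≡ 0# → a * (f * x) ≡ b * y
    both-zero {a} {f} {b} refl refl = solve 3 (λ a f b → a :* (f :* # 0) := b :* # 0) refl a f b

  -- By Taylor's formula (xy)ⁿ/n! Dⁿ(x^j₀ y^j₁) is the part of degree j₀ + j₁ + n of (x + xy)^j₀ (y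
  -- + xy)^j₁ = x^j₀ (1 + x)^j₁ y^j₁ (1 + y)^j₀. Both sides are its coefficient at xᵘ yʷ times u!
  -- w!. Inside the support the factorials are compared; outside it each side has a vanishing
  -- binomial.
  unit-G : ∀ j₀ j₁ u w n → u ℕ.+ w ≡ j₀ ℕ.+ j₁ ℕ.+ n →
    (fact j₀ * fact j₁) * (fact n * (binom u n * binom w n * sh (j₀ ℕ.+ j₁ ℕ.∸ w) (binom n) j₀))
    ≡ (fact u * fact w) * (sh j₀ (binom j₁) u * sh j₁ (binom j₀) w)
  unit-G j₀ j₁ u w n eq with j₀ ℕ.≤? u | u ℕ.≤? j₀ ℕ.+ j₁ | j₁ ℕ.≤? w | w ℕ.≤? j₁ ℕ.+ j₀
  ... | _ | no u≰e | _ | _ = both-zero {fact j₀ * fact j₁} {fact n} {fact u * fact w}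
      (cong (λ x → binom u n * x * rest) (binom-> w<n) · solve 2 (λ a b → a :* # 0 :* b := # 0) refl (binom u n) rest)
      (cong (_* sh j₁ (binom j₀) w) (sh-> {j₀} {j₁} (≰⇒> u≰e)) · zeroˡ _)
    where
    rest = sh (j₀ ℕ.+ j₁ ℕ.∸ w) (binom n) j₀
    w<n : w ℕ.< n
    w<n = +-cancelˡ-< (j₀ ℕ.+ j₁) w n (<-≤-trans (+-monoˡ-< w (≰⇒> u≰e)) (ℕₚ.≤-reflexive eq))
  ... | _ | yes _ | _ | no w≰e = both-zero {fact j₀ * fact j₁} {fact n} {fact u * fact w}
      (cong (λ x → x * binom w n * rest) (binom-> u<n) · solve 2 (λ a b → # 0 :* a :* b := # 0) refl (binom w n) rest)
      (cong (sh j₀ (binom j₁) u *_) (sh-> {j₁} {j₀} (≰⇒> w≰e)) · zeroʳ _)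
    where
    rest = sh (j₀ ℕ.+ j₁ ℕ.∸ w) (binom n) j₀
    u<n : u ℕ.< n
    u<n = +-cancelˡ-< (j₀ ℕ.+ j₁) u n (<-≤-trans (+-monoˡ-< u (subst (ℕ._< w) (ℕₚ.+-comm j₁ j₀) (≰⇒> w≰e))) (ℕₚ.≤-reflexive (ℕₚ.+-comm w u · eq)))
  ... | no j₀≰u | yes _ | _ | yes w≤e′ = both-zero {fact j₀ * fact j₁} {fact n} {fact u * fact w}
      (cong (binom u n * binom w n *_) (sh-> {Q} (subst (ℕ._< j₀) u≡ (≰⇒> j₀≰u))) · zeroʳ _)
      (cong (_* sh j₁ (binom j₀) w) (sh-< (binom j₁) (≰⇒> j₀≰u)) · zeroˡ _)
    where
    Q = j₀ ℕ.+ j₁ ℕ.∸ w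
    w≤e : w ℕ.≤ j₀ ℕ.+ j₁
    w≤e = ℕₚ.≤-trans w≤e′ (ℕₚ.≤-reflexive (ℕₚ.+-comm j₁ j₀))
    u≡ : u ≡ Q ℕ.+ n
    u≡ = +-cancelˡ-≡ w u (Q ℕ.+ n) (ℕₚ.+-comm w u · eq · cong (ℕ._+ n) (sym (m+[n∸m]≡n w≤e)) · ℕₚ.+-assoc w Q n)
  ... | yes _ | yes _ | no j₁≰w | yes _ = both-zero {fact j₀ * fact j₁} {fact n} {fact u * fact w}
      (cong (binom u n * binom w n *_) (sh-< (binom n) (m+n≤o⇒m≤o∸n (suc j₀) (subst (ℕ._≤ j₀ ℕ.+ j₁) (+-suc j₀ w) (+-monoʳ-≤ j₀ (≰⇒> j₁≰w))))) · zeroʳ _)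
      (cong (sh j₀ (binom j₁) u *_) (sh-< (binom j₀) (≰⇒> j₁≰w)) · zeroʳ _)
  ... | yes j₀≤u | yes u≤e | yes j₁≤w | yes w≤e with sh-in-range j₀ j₁ u j₀≤u u≤e | sh-in-range j₁ j₀ w j₁≤w w≤e
  ...   | q , P , refl , refl | l , Q , refl , refl = main n≡
    where
    open ≡-Reasoning
    n≡ : n ≡ l ℕ.+ q
    n≡ = +-cancelˡ-≡ (l ℕ.+ Q ℕ.+ (q ℕ.+ P)) n (l ℕ.+ q) (sym eq · NS.solve 4 (λ l Q q P → (l NS.:+ Q NS.:+ q) NS.:+ ((q NS.:+ P) NS.:+ l) NS.:= (l NS.:+ Q NS.:+ (q NS.:+ P)) NS.:+ (l NS.:+ q)) refl l Q q P)
    Q≡ : l ℕ.+ Q ℕ.+ (q ℕ.+ P) ℕ.∸ (q ℕ.+ P ℕ.+ l) ≡ Q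
    Q≡ = cong (ℕ._∸ (q ℕ.+ P ℕ.+ l)) (NS.solve 4 (λ l Q q P → (l NS.:+ Q) NS.:+ (q NS.:+ P) NS.:= Q NS.:+ (q NS.:+ P NS.:+ l)) refl l Q q P) · m+n∸n≡m Q (q ℕ.+ P ℕ.+ l)
    bf : ∀ a b {m} → m ≡ a ℕ.+ b → binom m a * (fact a * fact b) ≡ fact m
    bf a b refl = binom-fact a b
    main : n ≡ l ℕ.+ q →
      (fact (l ℕ.+ Q) * fact (q ℕ.+ P)) * (fact n * (binom (l ℕ.+ Q ℕ.+ q) n * binom (q ℕ.+ P ℕ.+ l) n * sh (l ℕ.+ Q ℕ.+ (q ℕ.+ P) ℕ.∸ (q ℕ.+ P ℕ.+ l)) (binom n) (l ℕ.+ Q)))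
      ≡ (fact (l ℕ.+ Q ℕ.+ q) * fact (q ℕ.+ P ℕ.+ l)) * (sh (l ℕ.+ Q) (binom (q ℕ.+ P)) (l ℕ.+ Q ℕ.+ q) * sh (q ℕ.+ P) (binom (l ℕ.+ Q)) (q ℕ.+ P ℕ.+ l))
    main refl = begin
      (fact (l ℕ.+ Q) * fact (q ℕ.+ P)) * (fact m * (binom u′ m * binom w′ m * sh (l ℕ.+ Q ℕ.+ (q ℕ.+ P) ℕ.∸ (q ℕ.+ P ℕ.+ l)) (binom m) (l ℕ.+ Q)))
        ≡⟨ cong₂ (λ x y → x * (fact m * (binom u′ m * binom w′ m * y))) (sym (cong₂ _*_ (bf l Q refl) (bf q P refl))) (cong (λ j → sh j (binom m) (l ℕ.+ Q)) Q≡ · cong (sh Q (binom m)) (ℕₚ.+-comm l Q) · sh-+ Q (binom m) l) ⟩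
      ((bl * (fact l * fact Q)) * (bq * (fact q * fact P))) * (fact m * (binom u′ m * binom w′ m * binom m l))
        ≡⟨ solve 10 (λ bl fl fQ bq fq fP fm bu bw bm → ((bl :* (fl :* fQ)) :* (bq :* (fq :* fP))) :* (fm :* (bu :* bw :* bm))
                      := (bm :* (fl :* fq)) :* fm :* ((bu :* bw) :* (fQ :* fP)) :* (bq :* bl))
             refl bl (fact l) (fact Q) bq (fact q) (fact P) (fact m) (binom u′ m) (binom w′ m) (binom m l) ⟩
      (binom m l * (fact l * fact q)) * fact m * ((binom u′ m * binom w′ m) * (fact Q * fact P)) * (bq * bl)
        ≡⟨ cong (λ x → x * fact m * ((binom u′ m * binom w′ m) * (fact Q * fact P)) * (bq * bl)) (bf l q refl) ⟩
      fact m * fact m * ((binom u′ m * binom w′ m) * (fact Q * fact P)) * (bq * bl)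
        ≡⟨ solve 6 (λ fm bu bw fQ fP z → fm :* fm :* ((bu :* bw) :* (fQ :* fP)) :* z := ((bu :* (fm :* fQ)) :* (bw :* (fm :* fP))) :* z) refl (fact m) (binom u′ m) (binom w′ m) (fact Q) (fact P) (bq * bl) ⟩
      ((binom u′ m * (fact m * fact Q)) * (binom w′ m * (fact m * fact P))) * (bq * bl)
        ≡⟨ cong (_* (bq * bl)) (cong₂ _*_ (bf m Q (NS.solve 3 (λ l Q q → l NS.:+ Q NS.:+ q NS.:= l NS.:+ q NS.:+ Q) refl l Q q))
             (bf m P (NS.solve 3 (λ l q P → q NS.:+ P NS.:+ l NS.:= l NS.:+ q NS.:+ P) refl l q P))) ⟩
      (fact u′ * fact w′) * (bq * bl)
        ≡⟨ cong₂ (λ x y → (fact u′ * fact w′) * (x * y)) (sym (sh-+ (l ℕ.+ Q) (binom (q ℕ.+ P)) q)) (sym (sh-+ (q ℕ.+ P) (binom (l ℕ.+ Q)) l)) ⟩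
      (fact u′ * fact w′) * (sh (l ℕ.+ Q) (binom (q ℕ.+ P)) u′ * sh (q ℕ.+ P) (binom (l ℕ.+ Q)) w′) ∎
      where
      m = l ℕ.+ q
      u′ = l ℕ.+ Q ℕ.+ q
      w′ = q ℕ.+ P ℕ.+ l
      bl = binom (l ℕ.+ Q) l
      bq = binom (q ℕ.+ P) q

  -- This adds to `unit-G` the factor Dⁿ(x^i₀ y^i₁)/n!, the part of degree i₀ + i₁ - n of (1 + x)^i₀
  -- (1 + y)^i₁. The condition on the total degree makes n the same in both factors.
  unit-term : ∀ i₀ i₁ j₀ j₁ i u j w → i ℕ.+ u ℕ.+ (j ℕ.+ w) ≡ i₀ ℕ.+ i₁ ℕ.+ (j₀ ℕ.+ j₁) →
    ((fact i₀ * fact i₁) * (fact j₀ * fact j₁)) * (binom (i ℕ.+ u) i * (binom (j ℕ.+ w) j * unit (j₀ ℕ.+ j₁) i₀ j₀ i u w))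
    ≡ (fact (i ℕ.+ u) * fact (j ℕ.+ w)) * ((binom i₀ i * sh j₀ (binom j₁) u) * (binom i₁ j * sh j₁ (binom j₀) w))
  unit-term i₀ i₁ j₀ j₁ i u j w eq with i ℕ.≤? i₀ | j ℕ.≤? i₁
  ... | no i≰i₀ | _ =
      cong (λ x → F * (binom (i ℕ.+ u) i * (binom (j ℕ.+ w) j * x))) (above-zero (j₀ ℕ.+ j₁) (u ℕ.+ w) (λ n → cong (_* K n) (sh-< (binom n) (≰⇒> i≰i₀)) · zeroˡ _))
    · solve 6 (λ a b c d e f → a :* (b :* (c :* # 0)) := d :* ((# 0 :* e) :* f)) refl F (binom (i ℕ.+ u) i) (binom (j ℕ.+ w) j) _ (sh j₀ (binom j₁) u) (binom i₁ j * sh j₁ (binom j₀) w)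
    · cong (λ x → (fact (i ℕ.+ u) * fact (j ℕ.+ w)) * ((x * sh j₀ (binom j₁) u) * (binom i₁ j * sh j₁ (binom j₀) w))) (sym (binom-> (≰⇒> i≰i₀)))
    where
    F = (fact i₀ * fact i₁) * (fact j₀ * fact j₁)
    K : ℕ → Carrier
    K n = binom u n * binom w n * sh (j₀ ℕ.+ j₁ ℕ.∸ w) (binom n) j₀
  ... | yes _ | no j≰i₁ =
      cong (λ x → F * (binom (i ℕ.+ u) i * (binom (j ℕ.+ w) j * x))) unit≡0
    · solve 6 (λ a b c d e f → a :* (b :* (c :* # 0)) := d :* (e :* (# 0 :* f))) refl F (binom (i ℕ.+ u) i) (binom (j ℕ.+ w) j) _ (binom i₀ i * sh j₀ (binom j₁) u) (sh j₁ (binom j₀) w)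
    · cong (λ x → (fact (i ℕ.+ u) * fact (j ℕ.+ w)) * ((binom i₀ i * sh j₀ (binom j₁) u) * (x * sh j₁ (binom j₀) w))) (sym (binom-> (≰⇒> j≰i₁)))
    where
    F = (fact i₀ * fact i₁) * (fact j₀ * fact j₁)
    e = j₀ ℕ.+ j₁
    unit≡0 : unit e i₀ j₀ i u w ≡ 0#
    unit≡0 with e ℕ.≤? u ℕ.+ w
    ... | no e≰ = above-< _ (≰⇒> e≰)
    ... | yes e≤ = cong (λ s → above e s (λ n → sh i (binom n) i₀ * (binom u n * binom w n * sh (e ℕ.∸ w) (binom n) j₀))) (sym (m+[n∸m]≡n e≤)) · above-+ e n _
        · cong (_* (binom u n * binom w n * sh (e ℕ.∸ w) (binom n) j₀)) (sh-> {i} {n} (+-cancelʳ-< j (i ℕ.+ n) i₀ (≤-<-trans (ℕₚ.≤-reflexive ijn) (+-monoʳ-< i₀ (≰⇒> j≰i₁))))) · zeroˡ _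
      where
      n = u ℕ.+ w ℕ.∸ e
      ijn : i ℕ.+ n ℕ.+ j ≡ i₀ ℕ.+ i₁
      ijn = +-cancelʳ-≡ e _ _ (NS.solve 4 (λ i n j e → (i NS.:+ n NS.:+ j) NS.:+ e NS.:= (i NS.:+ j) NS.:+ (e NS.:+ n)) refl i n j e
        · cong (i ℕ.+ j ℕ.+_) (m+[n∸m]≡n e≤) · NS.solve 4 (λ i j u w → (i NS.:+ j) NS.:+ (u NS.:+ w) NS.:= (i NS.:+ u) NS.:+ (j NS.:+ w)) refl i j u w · eq)
  ... | yes i≤i₀ | yes j≤i₁ = subst₂ Claim (m+[n∸m]≡n i≤i₀) (m+[n∸m]≡n j≤i₁) (main (i₀ ℕ.∸ i) (i₁ ℕ.∸ j)
      (cong₂ (λ a b → a ℕ.+ b ℕ.+ e) (m+[n∸m]≡n i≤i₀) (m+[n∸m]≡n j≤i₁)))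
    where
    open ≡-Reasoning
    e = j₀ ℕ.+ j₁
    T = sh j₀ (binom j₁) u
    T′ = sh j₁ (binom j₀) w
    Claim : ℕ → ℕ → Set
    Claim i₀ i₁ = ((fact i₀ * fact i₁) * (fact j₀ * fact j₁)) * (binom (i ℕ.+ u) i * (binom (j ℕ.+ w) j * unit e i₀ j₀ i u w))
      ≡ (fact (i ℕ.+ u) * fact (j ℕ.+ w)) * ((binom i₀ i * T) * (binom i₁ j * T′))
    main : ∀ l r → i ℕ.+ l ℕ.+ (j ℕ.+ r) ℕ.+ e ≡ i₀ ℕ.+ i₁ ℕ.+ e → Claim (i ℕ.+ l) (j ℕ.+ r)
    main l r eq′ = begin
      ((fact (i ℕ.+ l) * fact (j ℕ.+ r)) * (fact j₀ * fact j₁)) * (binom (i ℕ.+ u) i * (binom (j ℕ.+ w) j * unit e (i ℕ.+ l) j₀ i u w))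
        ≡⟨ cong₂ (λ x y → (x * (fact j₀ * fact j₁)) * (binom (i ℕ.+ u) i * (binom (j ℕ.+ w) j * y))) (sym (cong₂ _*_ (binom-fact i l) (binom-fact j r)))
             (cong (λ s → above e s (λ n → sh i (binom n) (i ℕ.+ l) * K n)) uw · above-+ e n _ · cong (_* K n) (sh-+ i (binom n) l)) ⟩
      (((bi * (fact i * fact l)) * (bj * (fact j * fact r))) * fj) * (binom (i ℕ.+ u) i * (binom (j ℕ.+ w) j * (binom n l * K n)))
        ≡⟨ solve 11 (λ bi fi fl bj f r fj ci cj bn K → (((bi :* (fi :* fl)) :* (bj :* (f :* r))) :* fj) :* (ci :* (cj :* (bn :* K)))
                      := ((bi :* bj) :* ((ci :* fi) :* (cj :* f))) :* (fj :* ((bn :* (fl :* r)) :* K)))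
             refl bi (fact i) (fact l) bj (fact j) (fact r) fj (binom (i ℕ.+ u) i) (binom (j ℕ.+ w) j) (binom n l) (K n) ⟩
      ((bi * bj) * ((binom (i ℕ.+ u) i * fact i) * (binom (j ℕ.+ w) j * fact j))) * (fj * ((binom n l * (fact l * fact r)) * K n))
        ≡⟨ cong (((bi * bj) * ((binom (i ℕ.+ u) i * fact i) * (binom (j ℕ.+ w) j * fact j))) *_) (cong (λ x → fj * (x * K n)) (binom-fact l r) · unit-G j₀ j₁ u w n uw) ⟩
      ((bi * bj) * ((binom (i ℕ.+ u) i * fact i) * (binom (j ℕ.+ w) j * fact j))) * ((fact u * fact w) * (T * T′))
        ≡⟨ solve 10 (λ bi bj ci fi cj f fu fw t t′ → ((bi :* bj) :* ((ci :* fi) :* (cj :* f))) :* ((fu :* fw) :* (t :* t′))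
                      := ((ci :* (fi :* fu)) :* (cj :* (f :* fw))) :* ((bi :* t) :* (bj :* t′)))
             refl bi bj (binom (i ℕ.+ u) i) (fact i) (binom (j ℕ.+ w) j) (fact j) (fact u) (fact w) T T′ ⟩
      ((binom (i ℕ.+ u) i * (fact i * fact u)) * (binom (j ℕ.+ w) j * (fact j * fact w))) * ((bi * T) * (bj * T′))
        ≡⟨ cong (_* ((bi * T) * (bj * T′))) (cong₂ _*_ (binom-fact i u) (binom-fact j w)) ⟩
      (fact (i ℕ.+ u) * fact (j ℕ.+ w)) * ((bi * T) * (bj * T′)) ∎
      where
      n = l ℕ.+ r
      bi = binom (i ℕ.+ l) i
      bj = binom (j ℕ.+ r) j
      fj = fact j₀ * fact j₁
      K : ℕ → Carrier
      K n = binom u n * binom w n * sh (e ℕ.∸ w) (binom n) j₀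
      uw : u ℕ.+ w ≡ e ℕ.+ n
      uw = +-cancelˡ-≡ (i ℕ.+ j) _ _ (NS.solve 4 (λ i j u w → (i NS.:+ j) NS.:+ (u NS.:+ w) NS.:= (i NS.:+ u) NS.:+ (j NS.:+ w)) refl i j u w · eq · sym eq′
        · NS.solve 5 (λ i j l r e → (i NS.:+ l NS.:+ (j NS.:+ r)) NS.:+ e NS.:= (i NS.:+ j) NS.:+ (e NS.:+ (l NS.:+ r))) refl i j l r e)

  splitSum-product : ∀ k k′ (f g : ℕ → ℕ → Carrier) → splitSum k (λ i u → splitSum k′ (λ j w → f i u * g j w)) ≡ splitSum k f * splitSum k′ g
  splitSum-product k k′ f g = splitSum-cong k (λ i u _ → splitSum-* k′ (f i u) g · *-comm _ _) · splitSum-* k (splitSum k′ g) f · *-comm _ _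

  mix : ℕ → ℕ → Family → Carrier
  mix k k′ g = splitSum k (λ i u → splitSum k′ (λ j w → binom k i * (binom k′ j * g i u w)))

  mixed-mix : ∀ e α β k k′ → mixed e α β k k′ ≡ mix k k′ (coef e α β)
  mixed-mix e α β k k′ = ∂^-splitSum k k′ (coef e α β) 0 0 0
    · splitSum-cong k (λ i u _ → sym (splitSum-* k′ (binom k i) _) · splitSum-cong k′ (λ j w _ →
        cong₂ (λ a b → binom k i * (binom k′ j * coef e α β a b (w ℕ.+ 0))) (ℕₚ.+-identityʳ i) (ℕₚ.+-identityʳ u)
        · cong (λ c → binom k i * (binom k′ j * coef e α β i u c)) (ℕₚ.+-identityʳ w)))

  -- The sums over the exponents of x and of y separate, and each is a Vandermonde convolution.
  -- Reflection turns the second factor, a coefficient at k′, into one at k.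
  mix-unit : ∀ i₀ i₁ j₀ j₁ k k′ → k ℕ.+ k′ ≡ i₀ ℕ.+ i₁ ℕ.+ (j₀ ℕ.+ j₁) →
    ((fact i₀ * fact i₁) * (fact j₀ * fact j₁)) * mix k k′ (unit (j₀ ℕ.+ j₁) i₀ j₀) ≡ (fact k * fact k′) * M i₀ i₁ j₀ j₁ k
  mix-unit i₀ i₁ j₀ j₁ k k′ eq = begin
    F * mix k k′ (unit (j₀ ℕ.+ j₁) i₀ j₀)
      ≡⟨ sym (splitSum-* k F _) · splitSum-cong k (λ i u ek → sym (splitSum-* k′ F _) · splitSum-cong k′ (λ j w ek′ → term i u j w ek ek′) · splitSum-* k′ (fact k * fact k′) _) · splitSum-* k (fact k * fact k′) _ ⟩
    (fact k * fact k′) * splitSum k (λ i u → splitSum k′ (λ j w → (binom i₀ i * sh j₀ (binom j₁) u) * (binom i₁ j * sh j₁ (binom j₀) w)))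
      ≡⟨ cong ((fact k * fact k′) *_) (splitSum-product k k′ (λ i u → binom i₀ i * sh j₀ (binom j₁) u) (λ j w → binom i₁ j * sh j₁ (binom j₀) w)
           · cong₂ _*_ (vandermonde-sh i₀ j₀ j₁ k) (vandermonde-sh i₁ j₁ j₀ k′ · sym (sh-binom-reflect i₀ (i₁ ℕ.+ j₀) j₁ {k} {k′} eq′))) ⟩
    (fact k * fact k′) * M i₀ i₁ j₀ j₁ k ∎
    where
    open ≡-Reasoning
    F = (fact i₀ * fact i₁) * (fact j₀ * fact j₁)
    eq′ : k ℕ.+ k′ ≡ i₀ ℕ.+ (i₁ ℕ.+ j₀ ℕ.+ j₁)
    eq′ = eq · NS.solve 4 (λ a b c d → (a NS.:+ b) NS.:+ (c NS.:+ d) NS.:= a NS.:+ (b NS.:+ c NS.:+ d)) refl i₀ i₁ j₀ j₁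
    term : ∀ i u j w → i ℕ.+ u ≡ k → j ℕ.+ w ≡ k′ →
      F * (binom k i * (binom k′ j * unit (j₀ ℕ.+ j₁) i₀ j₀ i u w)) ≡ (fact k * fact k′) * ((binom i₀ i * sh j₀ (binom j₁) u) * (binom i₁ j * sh j₁ (binom j₀) w))
    term i u j w refl refl = unit-term i₀ i₁ j₀ j₁ i u j w eq

  mix-∑ : ∀ k k′ m (c : ℕ → Carrier) (F : ℕ → Family) → mix k k′ (λ i u w → ∑ m (λ s → c s * F s i u w)) ≡ ∑ m (λ s → c s * mix k k′ (F s))
  mix-∑ k k′ m c F = splitSum-cong k (λ i u _ → splitSum-cong k′ (λ j w _ →
        cong (binom k i *_) (sym (∑-* m (binom k′ j) _)) · sym (∑-* m (binom k i) _)
        · ∑-cong m (λ s _ → solve 4 (λ a b c f → a :* (b :* (c :* f)) := c :* (a :* (b :* f))) refl (binom k i) (binom k′ j) (c s) (F s i u w)))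
      · splitSum-∑ k′ m _ · ∑-cong m (λ s _ → splitSum-* k′ (c s) _))
    · splitSum-∑ k m _ · ∑-cong m (λ s _ → splitSum-* k (c s) _)

  mix-cong : ∀ k k′ {f g : Family} → (∀ i u w → f i u w ≡ g i u w) → mix k k′ f ≡ mix k k′ g
  mix-cong k k′ h = splitSum-cong k (λ i u _ → splitSum-cong k′ (λ j w _ → cong (λ x → binom k i * (binom k′ j * x)) (h i u w)))

  -- The comparison of f(x,y,x,y) with 𝒲(p₁p₂), extended bilinearly from monomials. The factor k!
  -- k′! comes from differentiation, and d! e! from the scaling of `coef`.
  mixed-𝒯 : ∀ d e α β → (∀ i → d ℕ.< i → α i ≡ 0#) → (∀ i → e ℕ.< i → β i ≡ 0#) → ∀ k k′ → k ℕ.+ k′ ≡ d ℕ.+ e →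
    (fact d * fact e) * mixed e α β k k′ ≡ (fact k * fact k′) * 𝒯 d e (λ i → binom d i * α i) (λ j → binom e j * β j) k
  mixed-𝒯 d e α β hα hβ k k′ eq = begin
    F * mixed e α β k k′
      ≡⟨ cong (F *_) (mixed-mix e α β k k′ · mix-cong k k′ (coef-expand d e α β hα hβ)
           · mix-∑ k k′ (suc d) α (λ i₀ i u w → ∑ (suc e) (λ j₀ → β j₀ * unit e i₀ j₀ i u w))
           · ∑-cong (suc d) (λ i₀ _ → cong (α i₀ *_) (mix-∑ k k′ (suc e) β (λ j₀ → unit e i₀ j₀)))) ⟩
    F * ∑ (suc d) (λ i₀ → α i₀ * ∑ (suc e) (λ j₀ → β j₀ * mix k k′ (unit e i₀ j₀)))
      ≡⟨ sym (∑-* (suc d) F _) ⟩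
    ∑ (suc d) (λ i₀ → F * (α i₀ * ∑ (suc e) (λ j₀ → β j₀ * mix k k′ (unit e i₀ j₀))))
      ≡⟨ ∑-cong (suc d) (λ { i₀ (s≤s i₀≤d) → inner i₀ i₀≤d }) ⟩
    ∑ (suc d) (λ i₀ → (fact k * fact k′) * ((binom d i₀ * α i₀) * ∑ (suc e) (λ j₀ → (binom e j₀ * β j₀) * M i₀ (d ℕ.∸ i₀) j₀ (e ℕ.∸ j₀) k)))
      ≡⟨ ∑-* (suc d) (fact k * fact k′) _ ⟩
    (fact k * fact k′) * 𝒯 d e (λ i → binom d i * α i) (λ j → binom e j * β j) k ∎
    where
    open ≡-Reasoning
    F = fact d * fact e
    KK = fact k * fact k′
    unit≡ : ∀ i₀ j₀ → i₀ ℕ.≤ d → j₀ ℕ.≤ e → F * mix k k′ (unit e i₀ j₀) ≡ (binom d i₀ * binom e j₀) * (KK * M i₀ (d ℕ.∸ i₀) j₀ (e ℕ.∸ j₀) k)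
    unit≡ i₀ j₀ i₀≤d j₀≤e = reindex i₀ (d ℕ.∸ i₀) j₀ (e ℕ.∸ j₀) (m+[n∸m]≡n i₀≤d) (m+[n∸m]≡n j₀≤e)
      where
      reindex : ∀ i₀ i₁ j₀ j₁ → i₀ ℕ.+ i₁ ≡ d → j₀ ℕ.+ j₁ ≡ e → F * mix k k′ (unit e i₀ j₀) ≡ (binom d i₀ * binom e j₀) * (KK * M i₀ i₁ j₀ j₁ k)
      reindex i₀ i₁ j₀ j₁ refl refl = cong (_* mix k k′ (unit e i₀ j₀)) (sym (cong₂ _*_ (binom-fact i₀ i₁) (binom-fact j₀ j₁)))
        · solve 7 (λ b f g c p q m → ((b :* (f :* g)) :* (c :* (p :* q))) :* m := (b :* c) :* (((f :* g) :* (p :* q)) :* m)) refl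
            (binom d i₀) (fact i₀) (fact i₁) (binom e j₀) (fact j₀) (fact j₁) (mix k k′ (unit e i₀ j₀))
        · cong ((binom d i₀ * binom e j₀) *_) (mix-unit i₀ i₁ j₀ j₁ k k′ eq)
    inner : ∀ i₀ → i₀ ℕ.≤ d → F * (α i₀ * ∑ (suc e) (λ j₀ → β j₀ * mix k k′ (unit e i₀ j₀)))
      ≡ KK * ((binom d i₀ * α i₀) * ∑ (suc e) (λ j₀ → (binom e j₀ * β j₀) * M i₀ (d ℕ.∸ i₀) j₀ (e ℕ.∸ j₀) k))
    inner i₀ i₀≤d = begin
      F * (α i₀ * ∑ (suc e) (λ j₀ → β j₀ * mix k k′ (unit e i₀ j₀)))
        ≡⟨ solve 3 (λ a b c → a :* (b :* c) := (a :* b) :* c) refl F (α i₀) _ · sym (∑-* (suc e) (F * α i₀) _) ⟩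
      ∑ (suc e) (λ j₀ → (F * α i₀) * (β j₀ * mix k k′ (unit e i₀ j₀)))
        ≡⟨ ∑-cong (suc e) (λ { j₀ (s≤s j₀≤e) →
             solve 4 (λ f a b m → (f :* a) :* (b :* m) := (a :* b) :* (f :* m)) refl F (α i₀) (β j₀) (mix k k′ (unit e i₀ j₀))
             · cong ((α i₀ * β j₀) *_) (unit≡ i₀ j₀ i₀≤d j₀≤e)
             · solve 6 (λ a b c d k m → (a :* b) :* ((c :* d) :* (k :* m)) := (k :* (c :* a)) :* ((d :* b) :* m)) refl (α i₀) (β j₀) (binom d i₀) (binom e j₀) KK (M i₀ (d ℕ.∸ i₀) j₀ (e ℕ.∸ j₀) k) }) ⟩
      ∑ (suc e) (λ j₀ → (KK * (binom d i₀ * α i₀)) * ((binom e j₀ * β j₀) * M i₀ (d ℕ.∸ i₀) j₀ (e ℕ.∸ j₀) k))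
        ≡⟨ ∑-* (suc e) (KK * (binom d i₀ * α i₀)) _ · *-assoc _ _ _ ⟩
      KK * ((binom d i₀ * α i₀) * ∑ (suc e) (λ j₀ → (binom e j₀ * β j₀) * M i₀ (d ℕ.∸ i₀) j₀ (e ℕ.∸ j₀) k)) ∎

  -- Ultra log-concavity

  inv-≢0 : ∀ {x} → x ≢ 0# → x ⁻¹ ≢ 0#
  inv-≢0 {x} x≢0 h = 0≢1 (sym (sym (⁻¹-inverse x x≢0) · cong (x *_) h · zeroʳ x))

  *-≢0⁻¹ : ∀ {x y} → x * y ≢ 0# → x ≢ 0# × y ≢ 0#
  *-≢0⁻¹ h = (λ { refl → h (zeroˡ _) }) , (λ { refl → h (zeroʳ _) })

  ∑-≢0 : ∀ n {f : ℕ → Carrier} → ∑ n f ≢ 0# → ∃ λ i → i ℕ.< n × f i ≢ 0#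
  ∑-≢0 zero h = ⊥-elim (h refl)
  ∑-≢0 (suc n) {f} h with f n ≟ 0#
  ... | no fn≢0 = n , ℕₚ.≤-refl , fn≢0
  ... | yes fn≡0 with ∑-≢0 n {f} (λ s → h (cong₂ _+_ s fn≡0 · +-identityˡ 0#))
  ...   | i , i<n , fi≢0 = i , m≤n⇒m≤1+n i<n , fi≢0

  NoInternalZeros : (ℕ → Carrier) → Set
  NoInternalZeros a = ∀ {i j k} → i ℕ.< j → j ℕ.< k → a i ≢ 0# → a k ≢ 0# → a j ≢ 0#

  module _ {m : ℕ} {a : ℕ → Carrier} (ulc : ULC R m a) where

    normalised : ℕ → Carrier
    normalised j = a j * binom m j ⁻¹

    ULC-nonneg : ∀ j → 0# ≤ a j
    ULC-nonneg = proj₁ ulc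

    ULC-vanish : ∀ j → m ℕ.< j → a j ≡ 0#
    ULC-vanish = proj₁ (proj₂ ulc)

    ULC-noInternalZeros : NoInternalZeros a
    ULC-noInternalZeros {i} {j} {k} i<j j<k ai≢0 ak≢0 aj≡0 = proj₂ (proj₂ (proj₂ ulc)) (i , j , k , i<j , j<k , aj≡0 , *-≢0 ai≢0 ak≢0)

    ULC-support : ∀ {j} → a j ≢ 0# → j ℕ.≤ m
    ULC-support {j} aj≢0 with j ℕ.≤? m
    ... | yes j≤m = j≤m
    ... | no j≰m = ⊥-elim (aj≢0 (ULC-vanish j (≰⇒> j≰m)))

    normalised-nonneg : ∀ j → 0# ≤ normalised j
    normalised-nonneg j = 0≤* (ULC-nonneg j) (inv-nonneg (binom-nonneg m j))

    normalised-vanish : ∀ j → m ℕ.< j → normalised j ≡ 0#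
    normalised-vanish j m<j = cong (_* binom m j ⁻¹) (ULC-vanish j m<j) · zeroˡ _

    binom-normalised : ∀ j → binom m j * normalised j ≡ a j
    binom-normalised j with j ℕ.≤? m
    ... | yes j≤m = solve 3 (λ b a i → b :* (a :* i) := a :* (b :* i)) refl (binom m j) (a j) (binom m j ⁻¹)
                    · cong (a j *_) (⁻¹-inverse (binom m j) (proj₂ (binom-pos j≤m))) · *-identityʳ (a j)
    ... | no j≰m = cong (binom m j *_) (normalised-vanish j (≰⇒> j≰m)) · zeroʳ _ · sym (ULC-vanish j (≰⇒> j≰m))

    normalised-pos : ∀ {i j k} → i ℕ.≤ j → j ℕ.≤ k → normalised i ≢ 0# → normalised k ≢ 0# → Pos (normalised j)
    normalised-pos {i} {j} {k} i≤j j≤k ni≢0 nk≢0 with m≤n⇒m<n∨m≡n i≤j | m≤n⇒m<n∨m≡n j≤k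
    ... | inj₂ refl | _ = normalised-nonneg j , ni≢0
    ... | inj₁ _ | inj₂ refl = normalised-nonneg j , nk≢0
    ... | inj₁ i<j | inj₁ j<k = normalised-nonneg j ,
      *-≢0 (ULC-noInternalZeros i<j j<k (proj₁ (*-≢0⁻¹ ni≢0)) ak≢0) (inv-≢0 (proj₂ (binom-pos (ℕₚ.≤-trans j≤k (ULC-support ak≢0)))))
      where ak≢0 = proj₁ (*-≢0⁻¹ nk≢0)

    -- The hypothesis compares neighbours only. In the induction on the outer index it is multiplied
    -- by the inequality one index lower, and two common factors are cancelled. They are positive
    -- for lack of internal zeros, unless the left side is zero already.
    normalised-LC : LC normalised
    normalised-LC = adjacent⇒LC (λ {i} {k} → adjacent k i)
      where
      c = normalised
      adjacent : ∀ k i → i ℕ.≤ k → c i * c (suc k) ≤ c (suc i) * c k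
      adjacent k i i≤k with c i * c (suc k) ≟ 0#
      ... | yes ≡0 = subst (_≤ c (suc i) * c k) (sym ≡0) (0≤* (normalised-nonneg (suc i)) (normalised-nonneg k))
      ... | no ≢0 with m≤n⇒m<n∨m≡n i≤k
      ...   | inj₂ refl = ≤-reflexive (*-comm _ _)
      adjacent (suc k) i i≤k | no ≢0 | inj₁ (s≤s i≤k′) = cancel-≤ˡ (pos* (pos k i≤k′ (ℕₚ.≤-trans (n≤1+n k) (n≤1+n _))) (pos (suc k) i≤k (n≤1+n _)))
          (subst₂ _≤_
            (solve 4 (λ w x y z → (w :* y) :* (x :* z) := (x :* y) :* (w :* z)) refl (c i) (c k) (c (suc k)) (c (suc (suc k))))
            (solve 3 (λ v x y → (v :* x) :* (y :* y) := (x :* y) :* (v :* y)) refl (c (suc i)) (c k) (c (suc k)))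
            (*-mono (0≤* (normalised-nonneg i) (normalised-nonneg (suc k))) (sq≥0 (c (suc k)))
              (adjacent k i i≤k′)
              (proj₁ (proj₂ (proj₂ ulc)) (suc k) (s≤s z≤n) (ULC-support (proj₁ (*-≢0⁻¹ (proj₂ (*-≢0⁻¹ ≢0))))))))
        where
        pos : ∀ j → i ℕ.≤ j → j ℕ.≤ suc (suc k) → Pos (c j)
        pos j i≤j j≤ = normalised-pos i≤j j≤ (proj₁ (*-≢0⁻¹ ≢0)) (proj₂ (*-≢0⁻¹ ≢0))

  -- The support of a product

  sh-binom-pos : ∀ {j N k} → j ℕ.≤ k → k ℕ.≤ j ℕ.+ N → Pos (sh j (binom N) k)
  sh-binom-pos {j} {N} {k} j≤k k≤ with sh-in-range j N k j≤k k≤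
  ... | q , P , refl , refl = subst Pos (sym (sh-+ j (binom (q ℕ.+ P)) q)) (binom-pos (m≤m+n q P))

  sh-binom-≢0 : ∀ {j N k} → sh j (binom N) k ≢ 0# → j ℕ.≤ k × k ℕ.≤ j ℕ.+ N
  sh-binom-≢0 {j} {N} {k} h = ≮⇒≥ (λ k<j → h (sh-< (binom N) k<j)) , ≮⇒≥ (λ lt → h (sh-> {j} {N} lt))

  -- For i ≤ d and j ≤ e, `M i (d ∸ i) j (e ∸ j) k` is nonzero exactly when j ≤ k ≤ i + e and i ≤ k
  -- ≤ j + d. Regrouped, this is one condition on i and one on j, each of the present kind.
  Covers : ℕ → (ℕ → Carrier) → ℕ → Set
  Covers r h k = ∃ λ i → h i ≢ 0# × i ℕ.≤ k × k ℕ.≤ i ℕ.+ r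

  -- If b lies neither in [i, i + r] nor in [k, k + r], then i < b < k, and b itself belongs to the
  -- support of h.
  covers-between : ∀ {r h} → NoInternalZeros h → ∀ {a b c} → a ℕ.< b → b ℕ.< c → Covers r h a → Covers r h c → Covers r h b
  covers-between {r} {h} niz {a} {b} {c} a<b b<c (i , hi , i≤a , _) (k , hk , _ , c≤k+r) with b ℕ.≤? i ℕ.+ r | k ℕ.≤? b
  ... | yes b≤ | _      = i , hi , ℕₚ.≤-trans i≤a (<⇒≤ a<b) , b≤
  ... | no _   | yes k≤ = k , hk , k≤ , ℕₚ.≤-trans (<⇒≤ b<c) c≤k+r
  ... | no b≰  | no k≰  = b , niz (≤-<-trans i≤a a<b) (≰⇒> k≰) hi hk , ℕₚ.≤-refl , m≤m+n b r

  module _ {d e : ℕ} {h g : ℕ → Carrier} where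

    M-nonneg : ∀ i j k → 0# ≤ M i (d ℕ.∸ i) j (e ℕ.∸ j) k
    M-nonneg i j k = 0≤* (sh-nonneg j (binom-nonneg _) k) (sh-nonneg i (binom-nonneg _) k)

    private
      span : ∀ i j {e} → j ℕ.≤ e → j ℕ.+ (i ℕ.+ (e ℕ.∸ j)) ≡ i ℕ.+ e
      span i j {e} j≤e = sym (ℕₚ.+-assoc j i _) · cong (ℕ._+ (e ℕ.∸ j)) (ℕₚ.+-comm j i) · ℕₚ.+-assoc i j _ · cong (i ℕ.+_) (m+[n∸m]≡n j≤e)

      span′ : ∀ i j {d} → i ℕ.≤ d → i ℕ.+ (d ℕ.∸ i ℕ.+ j) ≡ j ℕ.+ d
      span′ i j {d} i≤d = sym (ℕₚ.+-assoc i _ j) · cong (ℕ._+ j) (m+[n∸m]≡n i≤d) · ℕₚ.+-comm d j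

    𝒯-nonneg : (∀ i → 0# ≤ h i) → (∀ j → 0# ≤ g j) → ∀ k → 0# ≤ 𝒯 d e h g k
    𝒯-nonneg 0≤h 0≤g k = ∑-nonneg (suc d) (λ i → 0≤* (0≤h i) (∑-nonneg (suc e) (λ j → 0≤* (0≤g j) (M-nonneg i j k))))

    𝒯-covers : ∀ {k} → 𝒯 d e h g k ≢ 0# → Covers e h k × Covers d g k
    𝒯-covers {k} T≢0 with ∑-≢0 (suc d) T≢0
    ... | i , s≤s i≤d , hi*≢0 with *-≢0⁻¹ hi*≢0
    ...   | hi≢0 , inner≢0 with ∑-≢0 (suc e) inner≢0
    ...     | j , s≤s j≤e , gj*≢0 with *-≢0⁻¹ gj*≢0
    ...       | gj≢0 , M≢0 with *-≢0⁻¹ M≢0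
    ...         | m₁ , m₂ with sh-binom-≢0 {j} {i ℕ.+ (e ℕ.∸ j)} m₁ | sh-binom-≢0 {i} {d ℕ.∸ i ℕ.+ j} m₂
    ...           | j≤k , k≤ | i≤k , k≤′ =
        (i , hi≢0 , i≤k , ℕₚ.≤-trans k≤ (ℕₚ.≤-reflexive (span i j j≤e))) ,
        (j , gj≢0 , j≤k , ℕₚ.≤-trans k≤′ (ℕₚ.≤-reflexive (span′ i j i≤d)))

    covers-𝒯 : (∀ i → 0# ≤ h i) → (∀ j → 0# ≤ g j) → (∀ {i} → h i ≢ 0# → i ℕ.≤ d) → (∀ {j} → g j ≢ 0# → j ℕ.≤ e) →
      ∀ {k} → Covers e h k → Covers d g k → 𝒯 d e h g k ≢ 0#
    covers-𝒯 0≤h 0≤g hd ge {k} (i , hi≢0 , i≤k , k≤) (j , gj≢0 , j≤k , k≤′) = proj₂ (∑-pos (suc d)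
      (λ i → 0≤* (0≤h i) (∑-nonneg (suc e) (λ j → 0≤* (0≤g j) (M-nonneg i j k)))) (s≤s (hd hi≢0))
      (pos* (0≤h i , hi≢0) (∑-pos (suc e) (λ j → 0≤* (0≤g j) (M-nonneg i j k)) (s≤s (ge gj≢0))
        (pos* (0≤g j , gj≢0) (pos* (sh-binom-pos {j} j≤k (ℕₚ.≤-trans k≤ (ℕₚ.≤-reflexive (sym (span i j (ge gj≢0))))))
          (sh-binom-pos {i} i≤k (ℕₚ.≤-trans k≤′ (ℕₚ.≤-reflexive (sym (span′ i j (hd hi≢0)))))))))))

  𝒯-cong : ∀ d e {h h′ g g′ : ℕ → Carrier} → (∀ i → h i ≡ h′ i) → (∀ j → g j ≡ g′ j) → ∀ k → 𝒯 d e h g k ≡ 𝒯 d e h′ g′ k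
  𝒯-cong d e eh eg k = ∑-cong (suc d) (λ i _ → cong₂ _*_ (eh i) (∑-cong (suc e) (λ j _ → cong (_* M i (d ℕ.∸ i) j (e ℕ.∸ j) k) (eg j))))

  module _ {d e : ℕ} {p q : ℕ → Carrier} (hp : ∀ i → d ℕ.< i → p i ≡ 0#) (hq : ∀ i → e ℕ.< i → q i ≡ 0#)
    (ulcₚ : ULC R d (W R d p)) (ulcᵩ : ULC R e (W R e q)) where

    private
      m = d ℕ.+ e
      h = W R d p
      g = W R e q
      w = W R m (polyMul R p q)
      α = normalised ulcₚ
      β = normalised ulcᵩ
      γ = mixed e α β
      c : ℕ → Carrier
      c k = w k * binom m k ⁻¹

      w≡𝒯 : ∀ {k} → k ℕ.≤ m → w k ≡ 𝒯 d e h g k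
      w≡𝒯 = W-polyMul d e p q hp hq

      w-support : ∀ {k} → w k ≢ 0# → k ℕ.≤ m
      w-support {k} wk≢0 with <-≤-connex m k
      ... | inj₂ k≤m = k≤m
      ... | inj₁ m<k = ⊥-elim (wk≢0 (W-> m (polyMul R p q) m<k))

      w-covers : ∀ {k} → w k ≢ 0# → Covers e h k × Covers d g k
      w-covers wk≢0 = 𝒯-covers {d} {e} (λ T≡0 → wk≢0 (w≡𝒯 (w-support wk≢0) · T≡0))

      scale = (fact d * fact e) * fact m ⁻¹

      -- Since C(m, k) = m! / (k! k′!), dividing by it cancels the factor k! k′! of `mixed-𝒯`. Ultra
      -- log-concavity thus becomes plain log-concavity of the mixed derivatives.
      fact-c : ∀ k k′ → k ℕ.+ k′ ≡ m → fact m * c k ≡ (fact d * fact e) * γ k k′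
      fact-c k k′ eq = begin
        fact m * (w k * b ⁻¹)
          ≡⟨ cong₂ (λ x y → x * (y * b ⁻¹)) (sym (binom-fact k k′ · cong fact eq)) (w≡𝒯 k≤m) ⟩
        (binom (k ℕ.+ k′) k * (fact k * fact k′)) * (T * b ⁻¹)
          ≡⟨ cong (λ n → (binom n k * (fact k * fact k′)) * (T * b ⁻¹)) eq · solve 4 (λ b f t i → (b :* f) :* (t :* i) := (b :* i) :* (f :* t)) refl b (fact k * fact k′) T (b ⁻¹) ⟩
        (b * b ⁻¹) * ((fact k * fact k′) * T)
          ≡⟨ cong (_* ((fact k * fact k′) * T)) (⁻¹-inverse b (proj₂ (binom-pos k≤m))) · *-identityˡ _ ⟩
        (fact k * fact k′) * T
          ≡⟨ cong ((fact k * fact k′) *_) (𝒯-cong d e (λ i → sym (binom-normalised ulcₚ i)) (λ j → sym (binom-normalised ulcᵩ j)) k) ⟩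
        (fact k * fact k′) * 𝒯 d e (λ i → binom d i * α i) (λ j → binom e j * β j) k
          ≡⟨ sym (mixed-𝒯 d e α β (normalised-vanish ulcₚ) (normalised-vanish ulcᵩ) k k′ eq) ⟩
        (fact d * fact e) * γ k k′ ∎
        where
        open ≡-Reasoning
        b = binom m k
        T = 𝒯 d e h g k
        k≤m = ℕₚ.≤-trans (m≤m+n k k′) (ℕₚ.≤-reflexive eq)

      c≡ : ∀ k k′ → k ℕ.+ k′ ≡ m → c k ≡ scale * γ k k′
      c≡ k k′ eq = cancel-≡ˡ (proj₂ (fact-pos m)) (fact-c k k′ eq
        · sym (solve 4 (λ f x i y → f :* ((x :* i) :* y) := (f :* i) :* (x :* y)) refl (fact m) (fact d * fact e) (fact m ⁻¹) (γ k k′)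
               · cong (_* ((fact d * fact e) * γ k k′)) (⁻¹-inverse (fact m) (proj₂ (fact-pos m))) · *-identityˡ _))

      normalised-≢0 : ∀ {n a} (ulc : ULC R n a) {r k} → Covers r a k → ∃ λ i → normalised ulc i ≢ 0#
      normalised-≢0 ulc (i , ai≢0 , _) = i , *-≢0 ai≢0 (inv-≢0 (proj₂ (binom-pos (ULC-support ulc ai≢0))))

      c-logconcave : ∀ j → 1 ℕ.≤ j → suc j ℕ.≤ m → c (j ℕ.∸ 1) * c (suc j) ≤ c j * c j
      c-logconcave (suc a) _ 2+a≤m with c (suc (suc a)) ≟ 0#
      ... | yes c≡0 = subst (_≤ c (suc a) * c (suc a)) (sym (cong (c a *_) c≡0 · zeroʳ _)) (sq≥0 (c (suc a)))
      -- A nonzero coefficient of 𝒲(p₁p₂) forces nonzero entries of α and β, from which the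
      -- perturbation starts.
      ... | no c≢0 = subst₂ _≤_
          (solve 3 (λ s x y → (s :* s) :* (x :* y) := (s :* y) :* (s :* x)) refl scale (γ (2 ℕ.+ a) b) (γ a (2 ℕ.+ b)) · sym (cong₂ _*_ (c≡ a (2 ℕ.+ b) eq₀) (c≡ (2 ℕ.+ a) b eq₂)))
          (solve 2 (λ s x → (s :* s) :* (x :* x) := (s :* x) :* (s :* x)) refl scale (γ (suc a) (suc b)) · sym (cong₂ _*_ (c≡ (suc a) (suc b) eq₁) (c≡ (suc a) (suc b) eq₁)))
          (*-monoˡ (sq≥0 scale) (mixed-logconcave {e} (normalised-nonneg ulcₚ) (normalised-nonneg ulcᵩ) (normalised-LC ulcₚ) (normalised-LC ulcᵩ)
            (normalised-≢0 ulcₚ (proj₁ covers)) (normalised-≢0 ulcᵩ (proj₂ covers)) a b))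
        where
        covers = w-covers {2 ℕ.+ a} (proj₁ (*-≢0⁻¹ c≢0))
        b = m ℕ.∸ (2 ℕ.+ a)
        eq₂ : 2 ℕ.+ a ℕ.+ b ≡ m
        eq₂ = m+[n∸m]≡n 2+a≤m
        eq₁ : suc a ℕ.+ suc b ≡ m
        eq₁ = +-suc (suc a) b · eq₂
        eq₀ : a ℕ.+ (2 ℕ.+ b) ≡ m
        eq₀ = +-suc a (suc b) · eq₁

      w-nonneg : ∀ k → 0# ≤ w k
      w-nonneg k with <-≤-connex m k
      ... | inj₂ k≤m = subst (0# ≤_) (sym (w≡𝒯 k≤m)) (𝒯-nonneg {d} {e} (ULC-nonneg ulcₚ) (ULC-nonneg ulcᵩ) k)
      ... | inj₁ m<k = subst (0# ≤_) (sym (W-> m (polyMul R p q) m<k)) ≤-refl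

      w-noInternalZeros : ∀ {i j k} → i ℕ.< j → j ℕ.< k → w j ≡ 0# → w i * w k ≢ 0# → ⊥
      w-noInternalZeros {i} {j} {k} i<j j<k wj≡0 wiwk≢0 = covers-𝒯 {d} {e} (ULC-nonneg ulcₚ) (ULC-nonneg ulcᵩ) (ULC-support ulcₚ) (ULC-support ulcᵩ)
        (covers-between (ULC-noInternalZeros ulcₚ) i<j j<k (proj₁ ci) (proj₁ ck))
        (covers-between (ULC-noInternalZeros ulcᵩ) i<j j<k (proj₂ ci) (proj₂ ck))
        (sym (w≡𝒯 (ℕₚ.≤-trans (<⇒≤ j<k) (w-support {k} wk≢0))) · wj≡0)
        where
        wk≢0 = proj₂ (*-≢0⁻¹ wiwk≢0)
        ci = w-covers {i} (proj₁ (*-≢0⁻¹ wiwk≢0))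
        ck = w-covers {k} wk≢0

    ULC-polyMul : ULC R m w
    ULC-polyMul = w-nonneg , (λ k → W-> m (polyMul R p q)) , c-logconcave ,
      λ { (_ , _ , _ , i<j , j<k , wj≡0 , wiwk≢0) → w-noInternalZeros i<j j<k wj≡0 wiwk≢0 }

open import Data.Nat using (_+_)

theorem1p2 : (R : RealField) → (d₁ d₂ : ℕ) → (p₁ p₂ : ℕ → RealField.Carrier R) →
    HasDegree R p₁ d₁ → HasDegree R p₂ d₂ →
    ULC R d₁ (W R d₁ p₁) → ULC R d₂ (W R d₂ p₂) →
    ULC R (d₁ + d₂) (W R (d₁ + d₂) (polyMul R p₁ p₂))
theorem1p2 R d₁ d₂ p₁ p₂ (_ , p₁-vanish) (_ , p₂-vanish) = Development.ULC-polyMul R p₁-vanish p₂-vanish
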